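{- Let $n>1$, $d\ge 2$ and $t$ be integers with $\gcd(t,d)=1$, $n\equiv t\pmod d$ and $n+d-nd\le t\le n$. Then \[ \sum_{k=0}^{(n-t)/d}[2dk+t]\frac{(q^t;q^d)_k^4}{(q^d;q^d)_k^4}q^{(d-2t)k}\equiv \frac{(q^{2t};q^d)_{(n-t)/d}}{(q^d;q^d)_{(n-t)/d}}[n]\,q^{t(t-n)/d}\pmod{[n]\Phi_n(q)^2}, \] and \[ \sum_{k=0}^{n-1}[2dk+t]\frac{(q^t;q^d)_k^4}{(q^d;q^d)_k^4}q^{(d-2t)k}\equiv \frac{(q^{2t};q^d)_{(n-t)/d}}{(q^d;q^d)_{(n-t)/d}}[n]\,q^{t(t-n)/d}\pmod{[n]\Phi_n(q)^2}. \]
   Context: For an indeterminate $q$, $(x;q)_k=(1-x)(1-xq)\cdots(1-xq^{k-1})$ (with $(x;q)_0=1$). For any integer $m$, $[m]=(1-q^m)/(1-q)$. $\Phi_n(q)$ is the $n$-th cyclotomic polynomial. A congruence $A\equiv B\pmod{P(q)}$ between rational functions in $q$ means that $A-B$, written as a quotient of polynomials with denominator coprime to $P(q)$, has numerator divisible by $P(q)$. -}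

module Defs where

open import Algebra.Bundles.Raw using (RawRing)
import Algebra.Definitions.RawSemiring as RawSemiringDefinitions
open import Data.Bool.Base using (if_then_else_)
open import Data.Fin.Base using (Fin; toℕ)
open import Data.Fin.Properties using (toℕ<n)
open import Data.Integer.Base using (ℤ; +_; -[1+_])
open import Data.List.Base using (List; []; _∷_; map)
open import Data.Nat.Base using (ℕ; zero; suc; _<_)
open import Data.Nat.Divisibility using (_∣?_)
open import Data.Nat.Induction using (<-wellFounded)
open import Data.Product.Base using (_×_; ∃₂)
open import Data.Rational.Base as ℚ using (ℚ; 0ℚ; 1ℚ)
import Data.Rational.Properties as ℚ
open import Data.Sum.Base using (_⊎_; inj₁; inj₂; [_,_]′; map₁; map₂)
open import Induction.WellFounded using (Acc; acc)
open import Level using (0ℓ)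
open import Relation.Binary.PropositionalEquality using (_≡_; _≢_; refl; sym; trans; cong; subst; module ≡-Reasoning)
open import Relation.Nullary using (¬_; Dec; yes; no; does; contradiction; toSum)

module Polynomial where

  infix  8 -_
  infixl 7 _*_
  infixl 6 _+_
  infix  4 _≈_

  -- Coefficients in order of increasing degree; trailing zeros are
  -- allowed, so equality is equality of all coefficients.
  Poly : Set
  Poly = List ℚ

  coeff : Poly → ℕ → ℚ
  coeff []      _       = 0ℚ
  coeff (a ∷ _) zero    = a
  coeff (_ ∷ p) (suc k) = coeff p k

  record _≈_ (p r : Poly) : Set where
    constructor coeffwise
    field coeff≡ : ∀ k → coeff p k ≡ coeff r k

  open _≈_ public

  0ₚ 1ₚ : Poly
  0ₚ = []
  1ₚ = 1ℚ ∷ []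

  _+_ : Poly → Poly → Poly
  []      + r       = r
  (a ∷ p) + []      = a ∷ p
  (a ∷ p) + (b ∷ r) = (a ℚ.+ b) ∷ (p + r)

  -_ : Poly → Poly
  -_ = map (λ a → ℚ.- a)

  scale : ℚ → Poly → Poly
  scale a = map (a ℚ.*_)

  _*_ : Poly → Poly → Poly
  []      * _ = []
  (a ∷ p) * r = scale a r + (0ℚ ∷ (p * r))

  rawRing : RawRing 0ℓ 0ℓ
  rawRing = record
    { Carrier = Poly ; _≈_ = _≈_ ; _+_ = _+_ ; _*_ = _*_
    ; -_ = -_ ; 0# = 0ₚ ; 1# = 1ₚ }

  open RawSemiringDefinitions (RawRing.rawSemiring rawRing) public
    using (_∣_; Coprime)

  ∷-≈0 : ∀ {a p} → a ≡ 0ℚ → p ≈ 0ₚ → (a ∷ p) ≈ 0ₚ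
  ∷-≈0 a≡0 p≈0 = coeffwise λ { zero → a≡0 ; (suc k) → coeff≡ p≈0 k }

  tail-≈0 : ∀ {a p} → (a ∷ p) ≈ 0ₚ → p ≈ 0ₚ
  tail-≈0 ap≈0 = coeffwise λ k → coeff≡ ap≈0 (suc k)

  _≈0? : ∀ p → Dec (p ≈ 0ₚ)
  []      ≈0? = yes (coeffwise λ _ → refl)
  (a ∷ p) ≈0? with a ℚ.≟ 0ℚ | p ≈0?
  ... | yes a≡0 | yes p≈0 = yes (∷-≈0 a≡0 p≈0)
  ... | no  a≢0 | _       = no λ ap≈0 → a≢0 (coeff≡ ap≈0 0)
  ... | _       | no  p≉0 = no λ ap≈0 → p≉0 (tail-≈0 ap≈0)

  1≉0 : ¬ (1ₚ ≈ 0ₚ)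
  1≉0 1≈0 with () ← coeff≡ 1≈0 0

  coeff-+ : ∀ p r k → coeff (p + r) k ≡ coeff p k ℚ.+ coeff r k
  coeff-+ []      r       k       = sym (ℚ.+-identityˡ _)
  coeff-+ (a ∷ p) []      k       = sym (ℚ.+-identityʳ _)
  coeff-+ (a ∷ p) (b ∷ r) zero    = refl
  coeff-+ (a ∷ p) (b ∷ r) (suc k) = coeff-+ p r k

  coeff-scale : ∀ a p k → coeff (scale a p) k ≡ a ℚ.* coeff p k
  coeff-scale a []      k       = sym (ℚ.*-zeroʳ a)
  coeff-scale a (b ∷ p) zero    = refl
  coeff-scale a (b ∷ p) (suc k) = coeff-scale a p k

  scale-0 : ∀ p k → coeff (scale 0ℚ p) k ≡ 0ℚ
  scale-0 p k = trans (coeff-scale 0ℚ p k) (ℚ.*-zeroˡ (coeff p k))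

  0∷-*ˡ : ∀ p r k → coeff ((0ℚ ∷ p) * r) k ≡ coeff (0ℚ ∷ (p * r)) k
  0∷-*ˡ p r k = begin
    coeff (scale 0ℚ r + (0ℚ ∷ (p * r))) k
      ≡⟨ coeff-+ (scale 0ℚ r) _ k ⟩
    coeff (scale 0ℚ r) k ℚ.+ coeff (0ℚ ∷ (p * r)) k
      ≡⟨ cong (ℚ._+ coeff (0ℚ ∷ (p * r)) k) (scale-0 r k) ⟩
    0ℚ ℚ.+ coeff (0ℚ ∷ (p * r)) k
      ≡⟨ ℚ.+-identityˡ _ ⟩
    coeff (0ℚ ∷ (p * r)) k ∎
    where open ≡-Reasoning

  0∷-*ʳ : ∀ p r k → coeff (p * (0ℚ ∷ r)) k ≡ coeff (0ℚ ∷ (p * r)) k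
  0∷-*ʳ []      r zero    = refl
  0∷-*ʳ []      r (suc k) = refl
  0∷-*ʳ (a ∷ p) r zero    = trans (ℚ.+-identityʳ _) (ℚ.*-zeroʳ a)
  0∷-*ʳ (a ∷ p) r (suc k) = begin
    coeff (scale a r + (p * (0ℚ ∷ r))) k
      ≡⟨ coeff-+ (scale a r) _ k ⟩
    coeff (scale a r) k ℚ.+ coeff (p * (0ℚ ∷ r)) k
      ≡⟨ cong (coeff (scale a r) k ℚ.+_) (0∷-*ʳ p r k) ⟩
    coeff (scale a r) k ℚ.+ coeff (0ℚ ∷ (p * r)) k
      ≡⟨ coeff-+ (scale a r) _ k ⟨
    coeff (scale a r + (0ℚ ∷ (p * r))) k ∎
    where open ≡-Reasoning

  a*b≡0⇒b≡0 : ∀ a b → a ≢ 0ℚ → a ℚ.* b ≡ 0ℚ → b ≡ 0ℚ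
  a*b≡0⇒b≡0 a b a≢0 ab≡0 = begin
    b                       ≡⟨ ℚ.*-identityˡ b ⟨
    1ℚ ℚ.* b                ≡⟨ cong (ℚ._* b) (ℚ.*-inverseˡ a) ⟨
    (ℚ.1/ a) ℚ.* a ℚ.* b    ≡⟨ ℚ.*-assoc (ℚ.1/ a) a b ⟩
    (ℚ.1/ a) ℚ.* (a ℚ.* b)  ≡⟨ cong ((ℚ.1/ a) ℚ.*_) ab≡0 ⟩
    (ℚ.1/ a) ℚ.* 0ℚ         ≡⟨ ℚ.*-zeroʳ (ℚ.1/ a) ⟩
    0ℚ                      ∎
    where
    open ≡-Reasoning
    instance _ = ℚ.≢-nonZero a≢0

  integral : ∀ p r → p * r ≈ 0ₚ → p ≈ 0ₚ ⊎ r ≈ 0ₚ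
  integral []      r       _    = inj₁ (coeffwise λ _ → refl)
  integral (a ∷ p) []      _    = inj₂ (coeffwise λ _ → refl)
  integral (a ∷ p) (b ∷ r) pr≈0 =
    [ (λ a≡0 → map₁ (∷-≈0 a≡0) (integral p (b ∷ r) (tail-≈0 (coeffwise λ k →
        trans (sym (0∷-*ˡ p (b ∷ r) k))
              (subst (λ x → coeff ((x ∷ p) * (b ∷ r)) k ≡ 0ℚ) a≡0 (coeff≡ pr≈0 k))))))
    , (λ a≢0 →
    [ (λ b≡0 → map₂ (∷-≈0 b≡0) (integral (a ∷ p) r (tail-≈0 (coeffwise λ k →
        trans (sym (0∷-*ʳ (a ∷ p) r k))
              (subst (λ x → coeff ((a ∷ p) * (x ∷ r)) k ≡ 0ℚ) b≡0 (coeff≡ pr≈0 k))))))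
    , (λ b≢0 → contradiction (a*b≡0⇒b≡0 a b a≢0
        (trans (sym (ℚ.+-identityʳ _)) (coeff≡ pr≈0 0))) b≢0)
    ]′ (toSum (b ℚ.≟ 0ℚ)))
    ]′ (toSum (a ℚ.≟ 0ℚ))

  *-≉0 : ∀ {p r} → ¬ (p ≈ 0ₚ) → ¬ (r ≈ 0ₚ) → ¬ (p * r ≈ 0ₚ)
  *-≉0 {p} {r} p≉0 r≉0 pr≈0 = [ p≉0 , r≉0 ]′ (integral p r pr≈0)

open Polynomial public using (Poly; coeff)
private module P = Polynomial

infix  9 _⁻¹
infix  8 -_
infixl 7 _*_ _÷_
infixl 6 _+_ _-_
infix  4 _≈_

record RatFun : Set where
  constructor _/_[_]
  field
    num   : Poly
    den   : Poly
    den≉0 : ¬ (den P.≈ P.0ₚ)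

open RatFun public

record _≈_ (f g : RatFun) : Set where
  constructor cross
  field cross≈ : num f P.* den g P.≈ num g P.* den f

open _≈_ public

fromPoly : Poly → RatFun
fromPoly p = p / P.1ₚ [ P.1≉0 ]

_+_ : RatFun → RatFun → RatFun
f + g = (num f P.* den g P.+ num g P.* den f) / den f P.* den g
          [ P.*-≉0 (den≉0 f) (den≉0 g) ]

_*_ : RatFun → RatFun → RatFun
f * g = (num f P.* num g) / den f P.* den g
          [ P.*-≉0 (den≉0 f) (den≉0 g) ]

-_ : RatFun → RatFun
- f = (P.- num f) / den f [ den≉0 f ]

_-_ : RatFun → RatFun → RatFun
f - g = f + (- g)

-- Made total by 0 ⁻¹ = 0; the denominators of interest are nonzero.
_⁻¹ : RatFun → RatFun
f ⁻¹ with P._≈0? (num f)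
... | yes _     = fromPoly P.0ₚ
... | no  num≉0 = den f / num f [ num≉0 ]

_÷_ : RatFun → RatFun → RatFun
f ÷ g = f * g ⁻¹

0# 1# q : RatFun
0# = fromPoly P.0ₚ
1# = fromPoly P.1ₚ
q  = fromPoly (0ℚ ∷ 1ℚ ∷ [])

rawRing : RawRing 0ℓ 0ℓ
rawRing = record
  { Carrier = RatFun ; _≈_ = _≈_ ; _+_ = _+_ ; _*_ = _*_
  ; -_ = -_ ; 0# = 0# ; 1# = 1# }

open RawSemiringDefinitions (RawRing.rawSemiring rawRing) public
  using (_^_; sum; product)

infix 9 q^_

q^_ : ℤ → RatFun
q^ (+ m)    = q ^ m
q^ -[1+ m ] = (q ^ suc m) ⁻¹

-- The q-shifted factorial ⟨ x ⨾ y ⟩ k = (1 - x) (1 - x y) ⋯ (1 - x y^(k-1)).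
⟨_⨾_⟩ : RatFun → RatFun → ℕ → RatFun
⟨ x ⨾ y ⟩ k = product {k} λ j → 1# - x * y ^ toℕ j

[_] : ℤ → RatFun
[ m ] = (1# - q^ m) ÷ (1# - q)

-- Cyclotomic polynomials, by solving  ∏_{e ∣ n} Φ e = q^n - 1  for Φ n.
-- They are viewed in ℚ(q); only n ≥ 1 is meaningful.
cyclotomic : ∀ n → Acc _<_ n → RatFun
cyclotomic n (acc rs) = (q ^ n - 1#) ÷ product {n} λ e →
  if does (toℕ e ∣? n) then cyclotomic (toℕ e) (rs (toℕ<n e)) else 1#

Φ : ℕ → RatFun
Φ n = cyclotomic n (<-wellFounded n)

-- The modulus M is given as an element of ℚ(q); that it is a polynomial P
-- is part of what the congruence asserts.  The fraction f is any quotient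
-- of polynomials representing A - B, not necessarily the one computed by _-_.
infix 4 _≅_[mod_]

_≅_[mod_] : RatFun → RatFun → RatFun → Set
A ≅ B [mod M ] = ∃₂ λ (P : Poly) (f : RatFun) →
  fromPoly P ≈ M × f ≈ A - B × P.Coprime (den f) P × P P.∣ num f

-- Let e > 1 divide n.  Modulo Φ_e the factors 1 - q^m are periodic in m, so
-- each block of e consecutive terms is a multiple of the block of the first
-- e terms.  There, writing t ≡ -dM (mod e) with 0 ≤ M < e, the terms with
-- k > M vanish and those with indices k and M - k cancel.  Hence both sums,
-- and the right-hand side because of its factor [n], vanish modulo Φ_e.
--
-- To improve this to Φ_n³, replace two of the four factors
-- (q^t;q^d)_k / (q^d;q^d)_k by (q^{t±n};q^d)_k / (q^{d±n};q^d)_k.  The sum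
-- becomes a terminating ₆φ₅ whose value is exactly the right-hand side.  The
-- k-th term has been multiplied by 1 + ε η(k) + O(ε²) with ε = (1 - q^n)² / q^n
-- divisible by Φ_n² and η(N - k) ≡ η(k) (mod Φ_n), so that the corrections of
-- first order cancel in pairs as well.
--
-- The congruences are glued by the Chinese remainder theorem: distinct Φ_e are
-- comaximal, and their irreducibility is never needed.
module Submission where

import Algebra.Definitions.RawMagma as RawMagma
import Algebra.Definitions.RawSemiring
import Algebra.Properties.AbelianGroup
import Algebra.Properties.CommutativeSemigroup
import Algebra.Properties.Monoid.Sum
import Algebra.Properties.Ring
import Algebra.Properties.Semiring.Exp
import Algebra.Properties.Semiring.Mult.TCOptimised
import Algebra.Solver.Ring
open import Algebra.Bundles using (CommutativeMonoid; CommutativeRing; RawRing)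
open import Algebra.Solver.Ring.AlmostCommutativeRing using (fromCommutativeRing; _-Raw-AlmostCommutative⟶_)
open import Data.Bool.Base as 𝔹 using (true; false; if_then_else_)
open import Data.Fin.Base using (Fin; toℕ)
open import Data.Fin.Properties using (toℕ<n)
open import Data.Integer.Base as ℤ using (ℤ; +_; -[1+_]; ∣_∣; 0ℤ; 1ℤ)
open import Data.Integer.Divisibility.Signed as ℤ using (divides; ∣⇒∣ᵤ; ∣ᵤ⇒∣; ∣m∣n⇒∣m+n; ∣m∣n⇒∣m-n; ∣n⇒∣m*n)
import Data.Integer.DivMod as ℤ
open import Data.Integer.GCD using (gcd)
import Data.Integer.Properties as ℤ
open import Data.Integer.Tactic.RingSolver using (solve-∀)
open import Data.List.Base using ([]; _∷_)
open import Data.Maybe.Base using (Maybe; just; nothing; is-just)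
open import Data.Nat.Base as ℕ using (ℕ; zero; suc; _<_; _≤_; z≤n; s≤s; NonZero)
import Data.Nat.Divisibility as ℕ
import Data.Nat.DivMod as ℕ
import Data.Nat.GCD as ℕ
open import Data.Nat.Induction using (<-wellFounded)
import Data.Nat.Properties as ℕ
open import Data.Product.Base using (_×_; _,_; proj₁; proj₂; ∃; ∃₂)
open import Data.Rational.Base as ℚ using (ℚ; 0ℚ; 1ℚ)
import Data.Rational.Properties as ℚ
open import Data.Sum.Base using (_⊎_; inj₁; inj₂; [_,_]′)
open import Data.Vec.Base using (allFin) renaming (map to mapᵛ)
open import Data.Vec.Functional using (foldr)
open import Data.Vec.N-ary using (N-ary; _$ⁿ_; curryⁿ; Eq; curryⁿ-cong)
import Defs
open import Induction.WellFounded using (Acc; acc)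
open import Level as Level using (Level; 0ℓ; _⊔_)
import Relation.Binary.PropositionalEquality as ≡
open ≡ using (_≡_; _≢_)
import Relation.Binary.Reasoning.Setoid
open import Relation.Nullary using (¬_; Dec; yes; no; does; contradiction)
open import Relation.Nullary.Decidable using (dec-true; dec-false)

-- From k = e on, (q^d;q^d)_k vanishes modulo Φ_e, so a single term has apparent poles. The
-- congruences modulo Φ_e therefore live in the subring `O` of fractions whose denominator is
-- comaximal with Φ_e, and it has to be proved that every term lies in `O`. Comaximality is always
-- carried as a Bézout identity, which makes each divisibility an explicit linear combination. The
-- exact summation rests on n = t + dN: the perturbed parameter q^(t-n) is q^(-dN), which terminates
-- the sum, whereas q^(t+n) is a parameter that stays fixed while the WZ recurrence changes the
-- length. Since [n] already contains one factor Φ_n, the modulus is regrouped as Φ_n³ times the Φ_e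
-- with e a divisor of n and 1 < e < n; only at Φ_n is more than a first power required. All of this
-- is argued over an abstract ring, given the powers q^m and inverses of 1 - q^m. Representatives of
-- rational functions enter only at the end.

-- The ring solver with integer coefficients, where (a , b) stands for a - b.
module RingSolver {c ℓ} (R : CommutativeRing c ℓ) where

  open CommutativeRing R
  open Algebra.Properties.AbelianGroup +-abelianGroup using (⁻¹-∙-comm; ⁻¹-involutive; ε⁻¹≈ε)
  open Algebra.Properties.CommutativeSemigroup +-commutativeSemigroup using (interchange)
  open Algebra.Properties.Ring ring using (-‿distribˡ-*; -‿distribʳ-*)
  open Algebra.Properties.Semiring.Mult.TCOptimised semiring
    using (×-homo-+; ×1-homo-*) renaming (_×_ to _·_)
  open Relation.Binary.Reasoning.Setoid setoid

  Coeff : RawRing _ _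
  Coeff = record
    { Carrier = ℕ × ℕ
    ; _≈_ = ≡._≡_
    ; _+_ = λ (a , b) (a′ , b′) → a ℕ.+ a′ , b ℕ.+ b′
    ; _*_ = λ (a , b) (a′ , b′) → a ℕ.* a′ ℕ.+ b ℕ.* b′ , a ℕ.* b′ ℕ.+ b ℕ.* a′
    ; -_ = λ (a , b) → b , a
    ; 0# = 0 , 0
    ; 1# = 1 , 0
    }

  private
    module C = RawRing Coeff

    -- The case `b = 0` is separate so that the constants 0 and 1 evaluate definitionally to `0#`
    -- and `1#`, with no difference left over.
    eval : C.Carrier → Carrier
    eval (a , zero)  = a · 1#
    eval (a , suc b) = a · 1# - suc b · 1#

    eval≈ : ∀ a b → eval (a , b) ≈ a · 1# - b · 1#
    eval≈ a zero    = sym (trans (+-congˡ ε⁻¹≈ε) (+-identityʳ _))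
    eval≈ a (suc b) = refl

    -distrib : ∀ x y z w → (x + y) - (z + w) ≈ (x - z) + (y - w)
    -distrib x y z w = trans (+-congˡ (sym (⁻¹-∙-comm z w))) (interchange x y (- z) (- w))

    eval-+ : ∀ x y → eval (x C.+ y) ≈ eval x + eval y
    eval-+ (a , b) (a′ , b′) = begin
      eval (a ℕ.+ a′ , b ℕ.+ b′)                       ≈⟨ eval≈ (a ℕ.+ a′) (b ℕ.+ b′) ⟩
      (a ℕ.+ a′) · 1# - (b ℕ.+ b′) · 1#                ≈⟨ +-cong (×-homo-+ 1# a a′) (-‿cong (×-homo-+ 1# b b′)) ⟩
      (a · 1# + a′ · 1#) - (b · 1# + b′ · 1#)          ≈⟨ -distrib _ _ _ _ ⟩
      (a · 1# - b · 1#) + (a′ · 1# - b′ · 1#)          ≈⟨ +-cong (eval≈ a b) (eval≈ a′ b′) ⟨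
      eval (a , b) + eval (a′ , b′)                    ∎

    *-homo′ : ∀ a b a′ b′ → (a ℕ.* a′ ℕ.+ b ℕ.* b′) · 1# ≈ a · 1# * a′ · 1# + b · 1# * b′ · 1#
    *-homo′ a b a′ b′ = trans (×-homo-+ 1# (a ℕ.* a′) (b ℕ.* b′)) (+-cong (×1-homo-* a a′) (×1-homo-* b b′))

    eval-* : ∀ x y → eval (x C.* y) ≈ eval x * eval y
    eval-* (a , b) (a′ , b′) = begin
      eval ((a , b) C.* (a′ , b′))
        ≈⟨ eval≈ (a ℕ.* a′ ℕ.+ b ℕ.* b′) (a ℕ.* b′ ℕ.+ b ℕ.* a′) ⟩
      (a ℕ.* a′ ℕ.+ b ℕ.* b′) · 1# - (a ℕ.* b′ ℕ.+ b ℕ.* a′) · 1#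
        ≈⟨ +-cong (*-homo′ a b a′ b′) (-‿cong (*-homo′ a b b′ a′)) ⟩
      (x * x′ + y * y′) - (x * y′ + y * x′)
        ≈⟨ +-congˡ (-‿cong (+-comm _ _)) ⟩
      (x * x′ + y * y′) - (y * x′ + x * y′)
        ≈⟨ -distrib _ _ _ _ ⟩
      (x * x′ - y * x′) + (y * y′ - x * y′)
        ≈⟨ +-cong (trans (+-congˡ (-‿distribˡ-* y x′)) (sym (distribʳ x′ x (- y))))
                  (trans (+-cong (trans (sym (⁻¹-involutive _)) (-‿cong (-‿distribˡ-* y y′))) refl)
                    (trans (⁻¹-∙-comm _ _) (trans (-‿cong (trans (+-comm _ _) (sym (distribʳ y′ x (- y))))) (-‿distribʳ-* _ _)))) ⟩
      (x - y) * x′ + (x - y) * - y′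
        ≈⟨ distribˡ (x - y) x′ (- y′) ⟨
      (x - y) * (x′ - y′)
        ≈⟨ *-cong (eval≈ a b) (eval≈ a′ b′) ⟨
      eval (a , b) * eval (a′ , b′) ∎
      where
      x = a · 1#
      y = b · 1#
      x′ = a′ · 1#
      y′ = b′ · 1#

    eval-neg : ∀ x → eval (C.- x) ≈ - eval x
    eval-neg (a , b) = begin
      eval (b , a)               ≈⟨ eval≈ b a ⟩
      b · 1# - a · 1#            ≈⟨ +-comm _ _ ⟩
      - (a · 1#) + b · 1#        ≈⟨ +-congˡ (⁻¹-involutive _) ⟨
      - (a · 1#) - - (b · 1#)    ≈⟨ ⁻¹-∙-comm _ _ ⟩
      - (a · 1# - b · 1#)        ≈⟨ -‿cong (eval≈ a b) ⟨
      - eval (a , b)             ∎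

    morphism : Coeff -Raw-AlmostCommutative⟶ fromCommutativeRing R
    morphism = record
      { ⟦_⟧ = eval
      ; +-homo = eval-+
      ; *-homo = eval-*
      ; -‿homo = eval-neg
      ; 0-homo = refl
      ; 1-homo = refl
      }

    x-y≈z-w : ∀ {x y z w} → x + w ≈ z + y → x - y ≈ z - w
    x-y≈z-w {x} {y} {z} {w} eq = begin
      x - y                  ≈⟨ +-identityʳ _ ⟨
      (x - y) + 0#           ≈⟨ +-congˡ (-‿inverseʳ w) ⟨
      (x - y) + (w - w)      ≈⟨ -distrib x w y w ⟨
      (x + w) - (y + w)      ≈⟨ +-congʳ eq ⟩
      (z + y) - (y + w)      ≈⟨ +-congˡ (-‿cong (+-comm y w)) ⟩
      (z + y) - (w + y)      ≈⟨ -distrib z y w y ⟩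
      (z - w) + (y - y)      ≈⟨ +-congˡ (-‿inverseʳ y) ⟩
      (z - w) + 0#           ≈⟨ +-identityʳ _ ⟩
      z - w                  ∎

    -- Pairs are never reduced, so one integer arises as many pairs; comparing a + b′ with a′ + b
    -- identifies them without subtraction.
    _coeff≟_ : ∀ x y → Maybe (eval x ≈ eval y)
    (a , b) coeff≟ (a′ , b′) with a ℕ.+ b′ ℕ.≟ a′ ℕ.+ b
    ... | no  _  = nothing
    ... | yes eq = just (trans (eval≈ a b) (trans (x-y≈z-w (begin
      a · 1# + b′ · 1#    ≈⟨ ×-homo-+ 1# a b′ ⟨
      (a ℕ.+ b′) · 1#     ≡⟨ ≡.cong (_· 1#) eq ⟩
      (a′ ℕ.+ b) · 1#     ≈⟨ ×-homo-+ 1# a′ b ⟩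
      a′ · 1# + b · 1#    ∎)) (sym (eval≈ a′ b′))))

  open Algebra.Solver.Ring Coeff (fromCommutativeRing R) morphism _coeff≟_ public
    using (_:+_; _:*_; _:-_; :-_; _:^_; _:=_)
  open Algebra.Solver.Ring Coeff (fromCommutativeRing R) morphism _coeff≟_
    using (Polynomial; con; var; ⟦_⟧; ⟦_⟧↓; ⟦_⟧N-cong; normalise; _≟N_; prove)

  :0 :1 : ∀ {n} → Polynomial n
  :0 = con C.0#
  :1 = con C.1#

  -- Unlike the library's solve, this compares the normal forms before
  -- evaluating them in R, which is much cheaper to check.
  solve : ∀ n (f : N-ary n (Polynomial n) (Polynomial n × Polynomial n)) →
    let p = f $ⁿ mapᵛ var (allFin n) in
    {𝔹.T (is-just (normalise (proj₁ p) ≟N normalise (proj₂ p)))} →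
    Eq n _≈_ (curryⁿ ⟦ proj₁ p ⟧) (curryⁿ ⟦ proj₂ p ⟧)
  solve n f {eq} = curryⁿ-cong _≈_ ⟦ proj₁ p ⟧ ⟦ proj₂ p ⟧ λ ρ → prove ρ (proj₁ p) (proj₂ p) (same ρ eq)
    where
    p = f $ⁿ mapᵛ var (allFin n)
    same : ∀ ρ → 𝔹.T (is-just (normalise (proj₁ p) ≟N normalise (proj₂ p))) → ⟦ proj₁ p ⟧↓ ρ ≈ ⟦ proj₂ p ⟧↓ ρ
    same ρ _ with just eq ← normalise (proj₁ p) ≟N normalise (proj₂ p) = ⟦ eq ⟧N-cong ρ

-- Finite sums and products over initial segments of ℕ

module BigOperator {c ℓ} (M : CommutativeMonoid c ℓ) where

  open CommutativeMonoid M
  open Algebra.Properties.CommutativeSemigroup commutativeSemigroup using (interchange)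

  big : ℕ → (ℕ → Carrier) → Carrier
  big zero    f = ε
  big (suc n) f = big n f ∙ f n

  big-cong : ∀ {f g} n → (∀ i → i < n → f i ≈ g i) → big n f ≈ big n g
  big-cong zero    e = refl
  big-cong (suc n) e = ∙-cong (big-cong n λ i i<n → e i (ℕ.m<n⇒m<1+n i<n)) (e n (ℕ.n<1+n n))

  big-∙ : ∀ f g n → big n (λ i → f i ∙ g i) ≈ big n f ∙ big n g
  big-∙ f g zero    = sym (identityˡ ε)
  big-∙ f g (suc n) = trans (∙-congʳ (big-∙ f g n)) (interchange _ _ _ _)

  big-ε : ∀ f n → (∀ i → i < n → f i ≈ ε) → big n f ≈ ε
  big-ε f zero    e = refl
  big-ε f (suc n) e = trans (∙-cong (big-ε f n λ i i<n → e i (ℕ.m<n⇒m<1+n i<n)) (e n (ℕ.n<1+n n))) (identityˡ ε)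

  big-split : ∀ f m n → big (m ℕ.+ n) f ≈ big m f ∙ big n (λ i → f (m ℕ.+ i))
  big-split f m zero    rewrite ℕ.+-identityʳ m = sym (identityʳ _)
  big-split f m (suc n) rewrite ℕ.+-suc m n = trans (∙-congʳ (big-split f m n)) (assoc _ _ _)

  -- Pairing the indices by an equation instead of the map i ↦ n - 1 - i lets both families be
  -- written without truncated subtraction. In the induction the last value of `f` meets the first
  -- of `g`.
  big-reverse : ∀ {f g} n → (∀ i j → suc (i ℕ.+ j) ≡ n → f i ≈ g j) → big n f ≈ big n g
  big-reverse         zero    e = refl
  big-reverse {f} {g} (suc n) e = begin
    big n f ∙ f n                       ≈⟨ ∙-cong (big-reverse n λ i j eq → e i (suc j) (≡.cong suc (≡.trans (ℕ.+-suc i j) eq)))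
                                                  (e n 0 (≡.cong suc (ℕ.+-identityʳ n))) ⟩
    big n (λ i → g (suc i)) ∙ g 0       ≈⟨ comm _ _ ⟩
    g 0 ∙ big n (λ i → g (suc i))       ≈⟨ ∙-congʳ (identityˡ (g 0)) ⟨
    ε ∙ g 0 ∙ big n (λ i → g (suc i))   ≈⟨ big-split g 1 n ⟨
    big (suc n) g                       ∎
    where open Relation.Binary.Reasoning.Setoid setoid

  foldr≈big : ∀ f n → foldr _∙_ ε {n} (λ i → f (toℕ i)) ≈ big n f
  foldr≈big f zero    = refl
  foldr≈big f (suc n) = trans (∙-congˡ (foldr≈big (λ i → f (suc i)) n))
    (sym (trans (big-split f 1 n) (∙-congʳ (identityˡ (f 0)))))

-- Sums, products and certificates in a commutative ring

module RingKit {c ℓ} (R : CommutativeRing c ℓ) where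

  open CommutativeRing R
  open RingSolver R
  open Relation.Binary.Reasoning.Setoid setoid
  open BigOperator +-commutativeMonoid public
    using () renaming (big to Σ<; big-cong to Σ-cong; big-∙ to Σ-+; big-ε to Σ-0; big-split to Σ-split; big-reverse to Σ-reverse; foldr≈big to sum≈Σ)
  open BigOperator *-commutativeMonoid public
    using () renaming (big to Π<; big-cong to Π-cong; big-∙ to Π-*; big-ε to Π-1; big-split to Π-split; big-reverse to Π-reverse; foldr≈big to product≈Π)

  *-Σ : ∀ a f n → a * Σ< n f ≈ Σ< n (λ i → a * f i)
  *-Σ a f zero    = zeroʳ a
  *-Σ a f (suc n) = trans (distribˡ a _ _) (+-congʳ (*-Σ a f n))

  x≈y⇒x-y≈0 : ∀ {x y} → x ≈ y → x - y ≈ 0#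
  x≈y⇒x-y≈0 {x} {y} e = trans (+-congʳ e) (-‿inverseʳ y)

  -- The certificates below express l - r as a combination of differences
  -- known to vanish.
  combine₁ : ∀ {l r} k {a b} → a ≈ b → l ≈ r + k * (a - b) → l ≈ r
  combine₁ {l} {r} k {a} {b} e eq = begin
    l                  ≈⟨ eq ⟩
    r + k * (a - b)    ≈⟨ +-congˡ (*-congˡ (x≈y⇒x-y≈0 e)) ⟩
    r + k * 0#         ≈⟨ solve 2 (λ r k → r :+ k :* :0 := r) r k ⟩
    r                  ∎

  combine₂ : ∀ {l r} k {a b} → a ≈ b → ∀ k′ {a′ b′} → a′ ≈ b′ →
    l ≈ r + k * (a - b) + k′ * (a′ - b′) → l ≈ r
  combine₂ k e k′ e′ eq = combine₁ k e (combine₁ k′ e′ eq)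

  combine₃ : ∀ {l r} k {a b} → a ≈ b → ∀ k′ {a′ b′} → a′ ≈ b′ → ∀ k″ {a″ b″} → a″ ≈ b″ →
    l ≈ r + k * (a - b) + k′ * (a′ - b′) + k″ * (a″ - b″) → l ≈ r
  combine₃ k e k′ e′ k″ e″ eq = combine₂ k e k′ e′ (combine₁ k″ e″ eq)

  *-cancelʳ-invertible : ∀ {x y u v} → u * v ≈ 1# → x * u ≈ y * u → x ≈ y
  *-cancelʳ-invertible {x} {y} {u} {v} uv≈1 e = combine₂ (- (x - y)) uv≈1 v e
    (solve 4 (λ x y u v → x := y :+ (:- (x :- y)) :* (u :* v :- :1) :+ v :* (x :* u :- y :* u)) x y u v)

  divide : ∀ {x f t u} → x ≈ f * t → t * u ≈ 1# → x * u ≈ f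
  divide {x} {f} {t} {u} e e′ = combine₂ u e f e′
    (solve 4 (λ x f t u → x :* u := f :+ u :* (x :- f :* t) :+ f :* (t :* u :- :1)) x f t u)

-- A terminating very-well-poised sum

module _ {c ℓ} (R : CommutativeRing c ℓ) where

  open CommutativeRing R
  open RingSolver R
  open RingKit R
  open Relation.Binary.Reasoning.Setoid setoid

  -- The terminating ₆φ₅ summation with one parameter equal to A, by the
  -- WZ method in M: the sums satisfy a first-order recurrence, which is a
  -- telescoping sum of G.
  module VeryWellPoised
    (A C Q : Carrier) (x i₁ i₂ i₃ : ℕ → Carrier)
    (x-0 : x 0 ≈ 1#)
    (x-suc : ∀ k → x (suc k) ≈ Q * x k)
    (inverse₁ : ∀ k → (1# - x (suc k)) * i₁ k ≈ 1#)
    (inverse₂ : ∀ k → (C - A * x (suc k)) * i₂ k ≈ 1#)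
    (inverse₃ : ∀ k → (1# - A * x (suc k)) * i₃ k ≈ 1#)
    where

    x-+ : ∀ m n → x (m ℕ.+ n) ≈ x m * x n
    x-+ zero    n = trans (sym (*-identityˡ _)) (*-congʳ (sym x-0))
    x-+ (suc m) n = begin
      x (suc (m ℕ.+ n))    ≈⟨ x-suc _ ⟩
      Q * x (m ℕ.+ n)      ≈⟨ *-congˡ (x-+ m n) ⟩
      Q * (x m * x n)      ≈⟨ *-assoc _ _ _ ⟨
      Q * x m * x n        ≈⟨ *-congʳ (x-suc m) ⟨
      x (suc m) * x n      ∎

    -- With x k = Q^k these are the factors of the ₆φ₅ with parameters A, A, C and Q^(-M). Its
    -- argument Q^(M+1) / C is spread over them: C - A x (k+1) carries a C, x M - x k carries a Q^M,
    -- and the remaining Q is the x k in `term`.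
    u : ℕ → Carrier
    u k = (1# - A * x k) * (1# - A * x k) * (1# - C * x k) * (i₁ k * i₁ k * i₂ k)

    v : ℕ → ℕ → Carrier
    v M k = (x M - x k) * i₃ (M ℕ.+ k)

    -- The numerator is that of `v (suc M) k`, the denominator that of `v M k`: `Z` is the common
    -- part through which `V (suc M)` and `V M` are compared.
    z : ℕ → ℕ → Carrier
    z M k = (x (suc M) - x k) * i₃ (M ℕ.+ k)

    U : ℕ → Carrier
    U k = Π< k u

    V Z : ℕ → ℕ → Carrier
    V M k = Π< k (v M)
    Z M k = Π< k (z M)

    term : ℕ → ℕ → Carrier
    term M k = (1# - A * (x k * x k)) * x k * (U k * V M k)

    -- The WZ certificate. Its factors (1 - x k)² (C - A x k) are the denominators of `u` one step
    -- earlier, so they cancel in `G M (suc k)`; the first of them makes `G M 0` vanish.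
    G : ℕ → ℕ → Carrier
    G M k = U k * Z M k * ((1# - x k) * (1# - x k)) * (C - A * x k) * x (suc M)

    inverse₃′ : ∀ M k → (1# - A * (x (suc M) * x k)) * i₃ (M ℕ.+ k) ≈ 1#
    inverse₃′ M k = trans (*-congʳ (+-congˡ (-‿cong (*-congˡ (sym (x-+ (suc M) k)))))) (inverse₃ (M ℕ.+ k))

    -- Raising M by one shifts all denominators by one index, so in the ratio only the first and the
    -- last survive.
    V-suc≈Z : ∀ M k → V (suc M) k * (1# - A * (x (suc M) * x k)) ≈ Z M k * (1# - A * x (suc M))
    V-suc≈Z M zero    = *-congˡ (+-congˡ (-‿cong (*-congˡ (trans (*-congˡ x-0) (*-identityʳ _)))))
    V-suc≈Z M (suc k) = combine₃
      (V₀ * (Y - X)) inv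
      ((Y - X) * i₃ (M ℕ.+ k)) (V-suc≈Z M k)
      (- (V₀ * (Y - X))) (inverse₃′ M k)
      (solve 8 (λ V₀ Z₀ Y X X′ A j i →
        V₀ :* ((Y :- X) :* j) :* (:1 :- A :* (Y :* X′))
          := Z₀ :* ((Y :- X) :* i) :* (:1 :- A :* Y)
           :+ V₀ :* (Y :- X) :* ((:1 :- A :* (Y :* X′)) :* j :- :1)
           :+ (Y :- X) :* i :* (V₀ :* (:1 :- A :* (Y :* X)) :- Z₀ :* (:1 :- A :* Y))
           :+ :- (V₀ :* (Y :- X)) :* ((:1 :- A :* (Y :* X)) :* i :- :1))
        V₀ (Z M k) Y X (x (suc k)) A (i₃ (suc M ℕ.+ k)) (i₃ (M ℕ.+ k)))
      where
      V₀ = V (suc M) k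
      Y = x (suc M)
      X = x k
      inv : (1# - A * (x (suc M) * x (suc k))) * i₃ (suc M ℕ.+ k) ≈ 1#
      inv = trans (*-congʳ (+-congˡ (-‿cong (*-congˡ (sym
        (≡.subst (λ m → x (suc m) ≈ x (suc M) * x (suc k)) (ℕ.+-suc M k) (x-+ (suc M) (suc k))))))))
        (inverse₃ (suc M ℕ.+ k))

    -- Since Q (x M - x j) = x (M+1) - x (j+1), the two products of numerators overlap except at
    -- their ends, and the powers of Q collect to x k.
    V≈Z : ∀ M k → V M k * ((x (suc M) - 1#) * x k) ≈ Z M k * (x (suc M) - x k)
    V≈Z M zero    = *-congˡ (trans (*-congˡ x-0) (trans (*-identityʳ (x (suc M) - 1#)) (+-congˡ (-‿cong (sym x-0)))))
    V≈Z M (suc k) = combine₃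
      (V₀ * (x M - X) * i * (Y - 1#) - Z₀ * (Y - X) * i * (- 1#)) (x-suc k)
      (Q * (x M - X) * i) (V≈Z M k)
      (- (Z₀ * (Y - X) * i)) (x-suc M)
      (solve 8 (λ V₀ Z₀ Y X X′ W Q i →
        V₀ :* ((W :- X) :* i) :* ((Y :- :1) :* X′)
          := Z₀ :* ((Y :- X) :* i) :* (Y :- X′)
           :+ (V₀ :* (W :- X) :* i :* (Y :- :1) :- Z₀ :* (Y :- X) :* i :* (:- :1)) :* (X′ :- Q :* X)
           :+ Q :* (W :- X) :* i :* (V₀ :* ((Y :- :1) :* X) :- Z₀ :* (Y :- X))
           :+ :- (Z₀ :* (Y :- X) :* i) :* (Y :- Q :* W))
        V₀ Z₀ Y X (x (suc k)) (x M) Q i)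
      where
      V₀ = V M k
      Z₀ = Z M k
      Y = x (suc M)
      X = x k
      i = i₃ (M ℕ.+ k)

    G-suc : ∀ M k → G M (suc k) ≈
      U k * Z M k * ((1# - A * x k) * (1# - A * x k) * (1# - C * x k)) * ((x (suc M) - x k) * i₃ (M ℕ.+ k)) * x (suc M)
    G-suc M k = begin
      U k * u k * (Z M k * z M k) * ((1# - X′) * (1# - X′)) * (C - A * X′) * Y
        ≈⟨ solve 10 (λ U Z a zz X′ A C i₁ i₂ Y →
             U :* (a :* (i₁ :* i₁ :* i₂)) :* (Z :* zz) :* ((:1 :- X′) :* (:1 :- X′)) :* (C :- A :* X′) :* Y
             := U :* Z :* a :* zz :* Y :* (((:1 :- X′) :* i₁) :* ((:1 :- X′) :* i₁) :* ((C :- A :* X′) :* i₂)))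
             (U k) (Z M k) a (z M k) X′ A C (i₁ k) (i₂ k) Y ⟩
      U k * Z M k * a * z M k * Y * (((1# - X′) * i₁ k) * ((1# - X′) * i₁ k) * ((C - A * X′) * i₂ k))
        ≈⟨ *-congˡ (*-cong (*-cong (inverse₁ k) (inverse₁ k)) (inverse₂ k)) ⟩
      U k * Z M k * a * z M k * Y * (1# * 1# * 1#)
        ≈⟨ solve 1 (λ y → y :* (:1 :* :1 :* :1) := y) _ ⟩
      U k * Z M k * a * z M k * Y ∎
      where
      X′ = x (suc k)
      Y = x (suc M)
      a = (1# - A * x k) * (1# - A * x k) * (1# - C * x k)

    -- β M / α M is the ratio of the closed forms for M + 1 and M.
    α β : ℕ → Carrier
    α M = (1# - x (suc M)) * (C - A * x (suc M))
    β M = (1# - A * x (suc M)) * (C - x (suc M))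

    -- Writing both terms through `U k * Z M k` leaves a polynomial identity in A, C, x k and x
    -- (M+1). The factor x (M+1) - 1 comes from `V≈Z` and is cancelled only after summation.
    telescope : ∀ M k →
      (x (suc M) - 1#) * (α M * term (suc M) k - β M * term M k) ≈ (1# - A * x (suc M)) * (G M (suc k) - G M k)
    telescope M k = begin
      (Y - 1#) * (α M * (w * X * (U k * V (suc M) k)) - β M * (w * X * (U k * V M k)))
        ≈⟨ *-congˡ (+-congʳ (*-congˡ (*-congˡ (*-congˡ V′≈)))) ⟩
      (Y - 1#) * (α M * (w * X * (U k * (Z M k * (1# - A * Y) * i))) - β M * (w * X * (U k * V M k)))
        ≈⟨ combine₂
             ((1# - A * Y) * (U k * Z M k) * (w * (C - Y) * (Y - X) - (1# - X) * (1# - X) * (C - A * X) * Y)) (inverse₃′ M k)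
             (- (β M * w * U k)) (V≈Z M k)
             (solve 8 (λ A C X Y U Z V i →
               let w = :1 :- A :* (X :* X)
                   α = (:1 :- Y) :* (C :- A :* Y)
                   β = (:1 :- A :* Y) :* (C :- Y) in
               (Y :- :1) :* (α :* (w :* X :* (U :* (Z :* (:1 :- A :* Y) :* i))) :- β :* (w :* X :* (U :* V)))
               := (:1 :- A :* Y) :* (U :* Z :* ((:1 :- A :* X) :* (:1 :- A :* X) :* (:1 :- C :* X)) :* ((Y :- X) :* i) :* Y
                                      :- U :* Z :* ((:1 :- X) :* (:1 :- X)) :* (C :- A :* X) :* Y)
                :+ (:1 :- A :* Y) :* (U :* Z) :* (w :* (C :- Y) :* (Y :- X) :- (:1 :- X) :* (:1 :- X) :* (C :- A :* X) :* Y)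
                    :* ((:1 :- A :* (Y :* X)) :* i :- :1)
                :+ :- (β :* w :* U) :* (V :* ((Y :- :1) :* X) :- Z :* (Y :- X)))
               A C X Y (U k) (Z M k) (V M k) i) ⟩
      (1# - A * Y) * (U k * Z M k * ((1# - A * X) * (1# - A * X) * (1# - C * X)) * ((Y - X) * i) * Y - G M k)
        ≈⟨ *-congˡ (+-congʳ (G-suc M k)) ⟨
      (1# - A * Y) * (G M (suc k) - G M k) ∎
      where
      X = x k
      Y = x (suc M)
      i = i₃ (M ℕ.+ k)
      w = 1# - A * (X * X)
      V′≈ : V (suc M) k ≈ Z M k * (1# - A * Y) * i
      V′≈ = combine₂ (- V (suc M) k) (inverse₃′ M k) i (V-suc≈Z M k)
        (solve 6 (λ V′ Z A Y X i → V′ := Z :* (:1 :- A :* Y) :* i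
           :+ (:- V′) :* ((:1 :- A :* (Y :* X)) :* i :- :1)
           :+ i :* (V′ :* (:1 :- A :* (Y :* X)) :- Z :* (:1 :- A :* Y))) (V (suc M) k) (Z M k) A Y X i)

    G-0 : ∀ M → G M 0 ≈ 0#
    G-0 M = combine₁ (- (1# * 1# * (1# - x 0) * (C - A * x 0) * x (suc M))) x-0
      (solve 4 (λ X A C Y → :1 :* :1 :* ((:1 :- X) :* (:1 :- X)) :* (C :- A :* X) :* Y
        := :0 :+ :- (:1 :* :1 :* (:1 :- X) :* (C :- A :* X) :* Y) :* (X :- :1)) (x 0) A C (x (suc M)))

    partial-sum : ∀ M k →
      (x (suc M) - 1#) * (α M * Σ< k (term (suc M)) - β M * Σ< k (term M)) ≈ (1# - A * x (suc M)) * G M k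
    partial-sum M zero    = trans
      (solve 3 (λ a b c → a :* (b :* :0 :- c :* :0) := :0) (x (suc M) - 1#) (α M) (β M))
      (sym (trans (*-congˡ (G-0 M)) (zeroʳ _)))
    partial-sum M (suc k) = combine₂ 1# (partial-sum M k) 1# (telescope M k)
      (solve 10 (λ y a b s t f g c h h′ →
        y :* (a :* (s :+ f) :- b :* (t :+ g)) := c :* h′
          :+ :1 :* (y :* (a :* s :- b :* t) :- c :* h)
          :+ :1 :* (y :* (a :* f :- b :* g) :- c :* (h′ :- h)))
        (x (suc M) - 1#) (α M) (β M) (Σ< k (term (suc M))) (Σ< k (term M)) (term (suc M) k) (term M k)
        (1# - A * x (suc M)) (G M k) (G M (suc k)))

    recurrence : ∀ M → α M * Σ< (suc (suc M)) (term (suc M)) ≈ β M * Σ< (suc M) (term M)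
    recurrence M = combine₂ (- (α M * s′ - β M * s)) (inverse₁ M) (- i₁ M) vanishing
      (solve 5 (λ y i a s t →
        a :* s := t
          :+ :- (a :* s :- t) :* ((:1 :- y) :* i :- :1)
          :+ :- i :* ((y :- :1) :* (a :* s :- t) :- :0))
        (x (suc M)) (i₁ M) (α M) s′ (β M * s))
      where
      s s′ : Carrier
      s = Σ< (suc M) (term M)
      s′ = Σ< (suc (suc M)) (term (suc M))
      -- Both products contain a factor x j - x j. Hence `term M` may be summed one step further at
      -- no cost, and the telescoped `G` ends at 0.
      V-end : V M (suc M) ≈ 0#
      V-end = trans (*-congˡ (trans (*-congʳ (-‿inverseʳ (x M))) (zeroˡ _))) (zeroʳ _)
      Z-end : Z M (suc (suc M)) ≈ 0#
      Z-end = trans (*-congˡ (trans (*-congʳ (-‿inverseʳ (x (suc M)))) (zeroˡ _))) (zeroʳ _)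
      vanishing : (x (suc M) - 1#) * (α M * s′ - β M * s) ≈ 0#
      vanishing = begin
        (Y - 1#) * (α M * s′ - β M * s)
          ≈⟨ combine₁ ((Y - 1#) * β M * w * U (suc M)) V-end
               (solve 8 (λ y a b s s′ w u v →
                  y :* (a :* s′ :- b :* s) := y :* (a :* s′ :- b :* (s :+ w :* (u :* v))) :+ y :* b :* w :* u :* (v :- :0))
                  (Y - 1#) (α M) (β M) s s′ w (U (suc M)) (V M (suc M))) ⟩
        (Y - 1#) * (α M * s′ - β M * Σ< (suc (suc M)) (term M))
          ≈⟨ partial-sum M (suc (suc M)) ⟩
        (1# - A * Y) * G M (suc (suc M))
          ≈⟨ combine₁ ((1# - A * Y) * U (suc (suc M)) * ((1# - X″) * (1# - X″)) * (C - A * X″) * Y) Z-end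
               (solve 6 (λ p u z a b y → p :* (u :* z :* a :* b :* y) := :0 :+ p :* u :* a :* b :* y :* (z :- :0))
                 (1# - A * Y) (U (suc (suc M))) (Z M (suc (suc M))) ((1# - X″) * (1# - X″)) (C - A * X″) Y) ⟩
        0# ∎
        where
        Y = x (suc M)
        X″ = x (suc (suc M))
        w = (1# - A * (Y * Y)) * Y

    summation : ∀ M → Σ< (suc M) (term M) ≈
      Π< (suc M) (λ j → 1# - A * x j) * Π< M (λ j → i₁ j * ((C - x (suc j)) * i₂ j))
    summation zero    = combine₁ (1# - A * (x 0 * x 0) - A * x 0) x-0
      (solve 2 (λ A X → :0 :+ (:1 :- A :* (X :* X)) :* X :* (:1 :* :1)
        := :1 :* (:1 :- A :* X) :* :1 :+ (:1 :- A :* (X :* X) :- A :* X) :* (X :- :1)) A (x 0))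
    summation (suc M) = begin
      s′
        ≈⟨ combine₂ (- (s′ * ((C - A * Y) * i₂ M))) (inverse₁ M) (- s′) (inverse₂ M)
             (solve 3 (λ s a b → s := s :* (a :* b) :+ :- (s :* b) :* (a :- :1) :+ :- s :* (b :- :1))
               s′ ((1# - Y) * i₁ M) ((C - A * Y) * i₂ M)) ⟩
      s′ * (((1# - Y) * i₁ M) * ((C - A * Y) * i₂ M))
        ≈⟨ solve 5 (λ s a i b j → s :* (a :* i :* (b :* j)) := (a :* b :* s) :* (i :* j)) s′ (1# - Y) (i₁ M) (C - A * Y) (i₂ M) ⟩
      α M * s′ * (i₁ M * i₂ M)
        ≈⟨ *-congʳ (trans (recurrence M) (*-congˡ (summation M))) ⟩
      β M * (Π< (suc M) (λ j → 1# - A * x j) * Π< M (λ j → i₁ j * ((C - x (suc j)) * i₂ j))) * (i₁ M * i₂ M)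
        ≈⟨ solve 6 (λ a b p q i j → a :* b :* (p :* q) :* (i :* j) := p :* a :* (q :* (i :* (b :* j))))
             (1# - A * Y) (C - Y) (Π< (suc M) (λ j → 1# - A * x j)) (Π< M (λ j → i₁ j * ((C - x (suc j)) * i₂ j))) (i₁ M) (i₂ M) ⟩
      Π< (suc (suc M)) (λ j → 1# - A * x j) * Π< (suc M) (λ j → i₁ j * ((C - x (suc j)) * i₂ j)) ∎
      where
      s′ = Σ< (suc (suc M)) (term (suc M))
      Y = x (suc M)

-- Congruences relative to a subring

record Subring {c ℓ} (K : CommutativeRing c ℓ) (o : Level) : Set (c ⊔ ℓ ⊔ Level.suc o) where
  open CommutativeRing K
  field
    -- In the application, the fractions with denominator comaximal with a fixed polynomial. It is a
    -- predicate and not a ring of its own, so that identities are proved in K.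
    O      : Carrier → Set o
    O-resp : ∀ {x y} → x ≈ y → O x → O y
    O-+    : ∀ {x y} → O x → O y → O (x + y)
    O-*    : ∀ {x y} → O x → O y → O (x * y)
    O-neg  : ∀ {x} → O x → O (- x)
    O-1    : O 1#

module Congruences {c ℓ o} (K : CommutativeRing c ℓ) (S : Subring K o) where

  open CommutativeRing K
  open Subring S
  open RingSolver K
  open RingKit K

  O-0 : O 0#
  O-0 = O-resp (-‿inverseʳ 1#) (O-+ O-1 (O-neg O-1))

  O-Σ : ∀ {f} n → (∀ i → i < n → O (f i)) → O (Σ< n f)
  O-Σ zero    o = O-0
  O-Σ (suc n) o = O-+ (O-Σ n λ i i<n → o i (ℕ.m<n⇒m<1+n i<n)) (o n (ℕ.n<1+n n))

  O-Π : ∀ {f} n → (∀ i → i < n → O (f i)) → O (Π< n f)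
  O-Π zero    o = O-1
  O-Π (suc n) o = O-* (O-Π n λ i i<n → o i (ℕ.m<n⇒m<1+n i<n)) (o n (ℕ.n<1+n n))

  -- One factor may fail to be integral as long as `z` makes up for it. It is used with z = 1 - q^e
  -- against a pole and with z = 1 / (1 - q^e) to divide out a zero.
  O-*Π : ∀ {f} z n i₀ → i₀ < n → (∀ i → i < n → i ≢ i₀ → O (f i)) → O (z * f i₀) → O (z * Π< n f)
  O-*Π {f} z (suc n) i₀ i₀<1+n o oz with i₀ ℕ.≟ n
  ... | yes ≡.refl = O-resp (solve 3 (λ z p x → p :* (z :* x) := z :* (p :* x)) z (Π< n f) (f n))
    (O-* (O-Π n λ i i<n → o i (ℕ.m<n⇒m<1+n i<n) (ℕ.<⇒≢ i<n)) oz)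
  ... | no  i₀≢n   = O-resp (*-assoc z (Π< n f) (f n))
    (O-* (O-*Π z n i₀ (ℕ.≤∧≢⇒< (ℕ.≤-pred i₀<1+n) i₀≢n) (λ i i<n → o i (ℕ.m<n⇒m<1+n i<n)) oz)
         (o n (ℕ.n<1+n n) (λ n≡i₀ → i₀≢n (≡.sym n≡i₀))))

  infix 4 _∼_[_]

  record _∼_[_] (x y a : Carrier) : Set (c ⊔ ℓ ⊔ o) where
    constructor multiple
    field
      quotient  : Carrier
      integral  : O quotient
      difference : x ≈ y + a * quotient

  module _ {a : Carrier} where

    ∼-reflexive : ∀ {x y} → x ≈ y → x ∼ y [ a ]
    ∼-reflexive {x} {y} e = multiple 0# O-0 (trans e (solve 2 (λ y a → y := y :+ a :* :0) y a))

    ∼-refl : ∀ {x} → x ∼ x [ a ]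
    ∼-refl = ∼-reflexive refl

    ∼-sym : ∀ {x y} → x ∼ y [ a ] → y ∼ x [ a ]
    ∼-sym {x} {y} (multiple z oz e) = multiple (- z) (O-neg oz) (combine₁ (- 1#) e
      (solve 4 (λ x y a z → y := x :+ a :* :- z :+ :- :1 :* (x :- (y :+ a :* z))) x y a z))

    ∼-trans : ∀ {x y z} → x ∼ y [ a ] → y ∼ z [ a ] → x ∼ z [ a ]
    ∼-trans {x} {y} {z} (multiple u ou e) (multiple v ov e′) = multiple (u + v) (O-+ ou ov) (combine₂ 1# e 1# e′
      (solve 6 (λ x y z a u v → x := z :+ a :* (u :+ v) :+ :1 :* (x :- (y :+ a :* u)) :+ :1 :* (y :- (z :+ a :* v))) x y z a u v))

    ∼-+ : ∀ {x x′ y y′} → x ∼ x′ [ a ] → y ∼ y′ [ a ] → x + y ∼ x′ + y′ [ a ]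
    ∼-+ {x} {x′} {y} {y′} (multiple u ou e) (multiple v ov e′) = multiple (u + v) (O-+ ou ov) (trans (+-cong e e′)
      (solve 5 (λ x′ y′ a u v → x′ :+ a :* u :+ (y′ :+ a :* v) := x′ :+ y′ :+ a :* (u :+ v)) x′ y′ a u v))

    -- x y - x′ y′ = (x - x′) y′ + x (y - y′), so integrality is asked of x and y′ only.
    ∼-* : ∀ {x x′ y y′} → O x → O y′ → x ∼ x′ [ a ] → y ∼ y′ [ a ] → x * y ∼ x′ * y′ [ a ]
    ∼-* {x} {x′} {y} {y′} ox oy′ (multiple u ou e) (multiple v ov e′) =
      multiple (u * y′ + x * v) (O-+ (O-* ou oy′) (O-* ox ov)) (combine₂ y′ e x e′
        (solve 7 (λ x x′ y y′ a u v → x :* y := x′ :* y′ :+ a :* (u :* y′ :+ x :* v)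
          :+ y′ :* (x :- (x′ :+ a :* u)) :+ x :* (y :- (y′ :+ a :* v))) x x′ y y′ a u v))

    ∼-neg : ∀ {x y} → x ∼ y [ a ] → - x ∼ - y [ a ]
    ∼-neg {x} {y} (multiple u ou e) = multiple (- u) (O-neg ou) (trans (-‿cong e)
      (solve 3 (λ y a u → :- (y :+ a :* u) := :- y :+ a :* :- u) y a u))

    ∼-Σ : ∀ {f g} n → (∀ i → i < n → f i ∼ g i [ a ]) → Σ< n f ∼ Σ< n g [ a ]
    ∼-Σ zero    e = ∼-refl
    ∼-Σ (suc n) e = ∼-+ (∼-Σ n λ i i<n → e i (ℕ.m<n⇒m<1+n i<n)) (e n (ℕ.n<1+n n))

    ∼-Π : ∀ {f g} n → (∀ i → i < n → O (f i)) → (∀ i → i < n → O (g i)) →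
      (∀ i → i < n → f i ∼ g i [ a ]) → Π< n f ∼ Π< n g [ a ]
    ∼-Π zero    of og e = ∼-refl
    ∼-Π (suc n) of og e = ∼-* (O-Π n λ i i<n → of i (ℕ.m<n⇒m<1+n i<n)) (og n (ℕ.n<1+n n))
      (∼-Π n (λ i i<n → of i (ℕ.m<n⇒m<1+n i<n)) (λ i i<n → og i (ℕ.m<n⇒m<1+n i<n)) (λ i i<n → e i (ℕ.m<n⇒m<1+n i<n)))
      (e n (ℕ.n<1+n n))

    ∼-inverse : ∀ {x y x⁻¹ y⁻¹} → O x⁻¹ → O y⁻¹ → x * x⁻¹ ≈ 1# → y * y⁻¹ ≈ 1# → x ∼ y [ a ] → x⁻¹ ∼ y⁻¹ [ a ]
    ∼-inverse {x} {y} {x′} {y′} ox oy ex ey (multiple u ou e) =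
      multiple (- (u * x′ * y′)) (O-neg (O-* (O-* ou ox) oy)) (combine₃ (y′) ex (- x′) ey (- (x′ * y′)) e
        (solve 6 (λ x y x′ y′ a u → x′ := y′ :+ a :* :- (u :* x′ :* y′) :+ y′ :* (x :* x′ :- :1) :+ :- x′ :* (y :* y′ :- :1)
          :+ :- (x′ :* y′) :* (x :- (y :+ a :* u))) x y x′ y′ a u))

    ∼0-*ˡ : ∀ {x y} → O x → y ∼ 0# [ a ] → x * y ∼ 0# [ a ]
    ∼0-*ˡ {x} {y} ox e = ∼-trans (∼-* ox O-0 ∼-refl e) (∼-reflexive (zeroʳ x))

    ∼0-*ʳ : ∀ {x y} → O y → x ∼ 0# [ a ] → x * y ∼ 0# [ a ]
    ∼0-*ʳ {x} {y} oy e = ∼-trans (∼-reflexive (*-comm x y)) (∼0-*ˡ oy e)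

    ∼0-Π : ∀ {f} n i₀ → i₀ < n → (∀ i → i < n → O (f i)) → f i₀ ∼ 0# [ a ] → Π< n f ∼ 0# [ a ]
    ∼0-Π (suc n) i₀ i₀<1+n o e with i₀ ℕ.≟ n
    ... | yes ≡.refl = ∼0-*ˡ (O-Π n λ i i<n → o i (ℕ.m<n⇒m<1+n i<n)) e
    ... | no  i₀≢n   = ∼0-*ʳ (o n (ℕ.n<1+n n))
      (∼0-Π n i₀ (ℕ.≤∧≢⇒< (ℕ.≤-pred i₀<1+n) i₀≢n) (λ i i<n → o i (ℕ.m<n⇒m<1+n i<n)) e)

    ∼-move : ∀ {x y} → x - y ∼ 0# [ a ] → x ∼ y [ a ]
    ∼-move {x} {y} e = ∼-trans (∼-reflexive (solve 2 (λ x y → x := (x :- y) :+ y) x y))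
      (∼-trans (∼-+ e ∼-refl) (∼-reflexive (+-identityˡ y)))

    -- Reversal shows the sum to be congruent to its negative, and `h` is one half. Halving also
    -- disposes of a middle term paired with itself.
    antisymmetric-sum : ∀ {h} → O h → h + h ≈ 1# → ∀ M {f} →
      (∀ i j → i ℕ.+ j ≡ M → f i ∼ - f j [ a ]) → Σ< (suc M) f ∼ 0# [ a ]
    antisymmetric-sum {h} oh 2h≈1 M {f} e = ∼-trans (∼-reflexive halve) (∼0-*ˡ oh double)
      where
      s = Σ< (suc M) f
      halve : s ≈ h * (s + s)
      halve = combine₁ (- s) 2h≈1 (solve 2 (λ s h → s := h :* (s :+ s) :+ :- s :* (h :+ h :- :1)) s h)
      reversed : s ≈ Σ< (suc M) (λ j → f (M ℕ.∸ j))
      reversed = Σ-reverse (suc M) λ i j eq → reflexive (≡.cong f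
        (≡.trans (≡.sym (ℕ.m+n∸n≡m i j)) (≡.cong (ℕ._∸ j) (ℕ.suc-injective eq))))
      double : s + s ∼ 0# [ a ]
      double = ∼-trans (∼-+ (∼-reflexive reversed) ∼-refl)
        (∼-trans (∼-reflexive (sym (Σ-+ _ _ (suc M))))
        (∼-trans (∼-Σ (suc M) λ i i<1+M → ∼-trans
            (∼-+ (e (M ℕ.∸ i) i (ℕ.m∸n+n≡m (ℕ.≤-pred i<1+M))) (∼-refl {f i}))
            (∼-reflexive (-‿inverseˡ (f i))))
          (∼-reflexive (Σ-0 _ (suc M) λ _ _ → refl))))

  ∼-weaken : ∀ {a b x y} → O b → x ∼ y [ a * b ] → x ∼ y [ a ]
  ∼-weaken {a} {b} {x} {y} ob (multiple z oz e) = multiple (b * z) (O-* ob oz) (trans e (+-congˡ (*-assoc a b z)))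

  ∼0-*-∼0 : ∀ {a b x y} → x ∼ 0# [ a ] → y ∼ 0# [ b ] → x * y ∼ 0# [ a * b ]
  ∼0-*-∼0 {a} {b} (multiple u ou e) (multiple v ov e′) = multiple (u * v) (O-* ou ov) (trans (*-cong e e′)
    (solve 4 (λ a b u v → (:0 :+ a :* u) :* (:0 :+ b :* v) := :0 :+ a :* b :* (u :* v)) a b u v))

-- Arithmetic progressions with difference invertible modulo e

module Progressions (d e : ℕ) .{{_ : NonZero e}}
  (d⁻¹ l₀ : ℤ) (d-inverse : + d ℤ.* d⁻¹ ≡ 1ℤ ℤ.+ l₀ ℤ.* + e)
  where

  open ≡.≡-Reasoning
  open import Data.Integer.Base using (_+_; _-_; -_; _*_)
  open import Data.Integer.Divisibility.Signed using (_∣_)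

  ∣-+-multiple : ∀ {m} l → + e ∣ m + l * + e → + e ∣ m
  ∣-+-multiple {m} l p = ≡.subst (+ e ∣_) (cancel m (l * + e))
    (∣m∣n⇒∣m-n p (divides l ≡.refl))
    where
    cancel : ∀ m x → m + x - x ≡ m
    cancel = solve-∀

  ∣-cancel-d : ∀ m → + e ∣ + d * m → + e ∣ m
  ∣-cancel-d m p = ∣-+-multiple (m * l₀) (≡.subst (+ e ∣_) (begin
    d⁻¹ * (+ d * m)          ≡⟨ rotate d⁻¹ (+ d) m ⟩
    m * (+ d * d⁻¹)          ≡⟨ ≡.cong (m *_) d-inverse ⟩
    m * (1ℤ + l₀ * + e)      ≡⟨ expand m l₀ (+ e) ⟩
    m + m * l₀ * + e         ∎) (∣n⇒∣m*n d⁻¹ p))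
    where
    rotate : ∀ a b c → a * (b * c) ≡ c * (b * a)
    rotate = solve-∀
    expand : ∀ m l e → m * (1ℤ + l * e) ≡ m + m * l * e
    expand = solve-∀

  ∤-small : ∀ {m} → 0 < m → m < e → ¬ (+ e ∣ + m)
  ∤-small {suc m} _ m<e p = ℕ.>⇒∤ m<e (∣⇒∣ᵤ p)

  -- The index is the residue of - s d⁻¹ modulo e.
  progression-hits : ∀ s → ∃ λ i → i < e × + e ∣ s + + d * + i
  progression-hits s = i , ℤ.n%ℕd<d a e , divides (- (+ d * q + s * l₀)) (begin
    s + + d * + i
      ≡⟨ expand s (+ d) (+ i) q (+ e) ⟩
    s + + d * (+ i + q * + e) - + d * q * + e
      ≡⟨ ≡.cong (λ x → s + + d * x - + d * q * + e) (ℤ.a≡a%ℕn+[a/ℕn]*n a e) ⟨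
    s + + d * a - + d * q * + e
      ≡⟨ rotate s (+ d) d⁻¹ q (+ e) ⟩
    s - s * (+ d * d⁻¹) - + d * q * + e
      ≡⟨ ≡.cong (λ x → s - s * x - + d * q * + e) d-inverse ⟩
    s - s * (1ℤ + l₀ * + e) - + d * q * + e
      ≡⟨ collect s (+ d) l₀ q (+ e) ⟩
    - (+ d * q + s * l₀) * + e ∎)
    where
    a q : ℤ
    a = - (s * d⁻¹)
    q = a ℤ./ℕ e
    i = a ℤ.%ℕ e
    expand : ∀ s d i q e → s + d * i ≡ s + d * (i + q * e) - d * q * e
    expand = solve-∀
    rotate : ∀ s d x q e → s + d * - (s * x) - d * q * e ≡ s - s * (d * x) - d * q * e
    rotate = solve-∀
    collect : ∀ s d l q e → s - s * (1ℤ + l * e) - d * q * e ≡ - (d * q + s * l) * e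
    collect = solve-∀

  window-unique : ∀ m {i j} → i < j → j < e → + e ∣ m + + d * + i → ¬ (+ e ∣ m + + d * + j)
  window-unique m {i} {j} i<j j<e p r = ∤-small (ℕ.m<n⇒0<n∸m i<j) (ℕ.≤-<-trans (ℕ.m∸n≤m j i) j<e)
    (∣-cancel-d (+ (j ℕ.∸ i)) (≡.subst (+ e ∣_) (begin
      m + + d * + j - (m + + d * + i)
        ≡⟨ ≡.cong (λ x → m + + d * x - (m + + d * + i)) (≡.cong +_ (ℕ.m∸n+n≡m (ℕ.<⇒≤ i<j))) ⟨
      m + + d * (+ (j ℕ.∸ i) + + i) - (m + + d * + i)
        ≡⟨ cancel m (+ d) (+ (j ℕ.∸ i)) (+ i) ⟩
      + d * + (j ℕ.∸ i) ∎) (∣m∣n⇒∣m-n r p)))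
    where
    cancel : ∀ m d x i → m + d * (x + i) - (m + d * i) ≡ d * x
    cancel = solve-∀

  window-others : ∀ m {i j} → i < e → j < e → i ≢ j → + e ∣ m + + d * + i → ¬ (+ e ∣ m + + d * + j)
  window-others m {i} {j} i<e j<e i≢j p r with i ℕ.<? j
  ... | yes i<j = window-unique m i<j j<e p r
  ... | no  i≮j = window-unique m (ℕ.≤∧≢⇒< (ℕ.≮⇒≥ i≮j) λ j≡i → i≢j (≡.sym j≡i)) i<e r p

  -- The number is d (i + 1), and d can be cancelled modulo e.
  ∤-denominator : ∀ {i} → suc i < e → ¬ (+ e ∣ + d + + d * + i)
  ∤-denominator {i} i<e p = ∤-small ℕ.z<s i<e (∣-cancel-d (+ suc i) (≡.subst (+ e ∣_) (≡.sym (ℤ.*-suc (+ d) (+ i))) p))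

  positive-quotient : ∀ m n .{{_ : NonZero n}} → m ≡ + n → + e ∣ m → ∃ λ k → m ≡ + suc k * + e
  positive-quotient m n ≡.refl p with ∣⇒∣ᵤ p
  ... | ℕ.divides (suc k) eq = k , ≡.trans (≡.cong +_ eq) (ℤ.pos-* (suc k) e)
  ... | ℕ.divides zero    eq = contradiction eq (ℕ.≢-nonZero⁻¹ n)

module CoprimeProgression (d n N : ℕ) (1<d : 1 < d) (t x y : ℤ) (bézout : x ℤ.* t ℤ.+ y ℤ.* + d ≡ 1ℤ)
  (n≡t+dN : + n ≡ t ℤ.+ + d ℤ.* + N)
  where

  open ≡.≡-Reasoning
  open import Data.Integer.Base using (_+_; _-_; -_; _*_)
  open import Data.Integer.Divisibility.Signed using (_∣_)

  d∤t : ¬ (+ d ∣ t)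
  d∤t p = ℕ.>⇒∤ 1<d (∣⇒∣ᵤ (≡.subst (+ d ∣_) bézout
    (∣m∣n⇒∣m+n (∣n⇒∣m*n x p) (∣n⇒∣m*n y (divides 1ℤ (≡.sym (ℤ.*-identityˡ (+ d))))))))

  -- A zero would make d divide t, against the Bézout identity and d > 1. So 1 - q^(t+dk) is
  -- invertible in ℚ(q) for every k, although t may be negative.
  t+dk≢0 : ∀ k → t + + d * + k ≢ 0ℤ
  t+dk≢0 k eq = d∤t (divides (- + k) (begin
    t                                  ≡⟨ cancel t (+ d) (+ k) ⟩
    t + + d * + k + - + k * + d        ≡⟨ ≡.cong (_+ - + k * + d) eq ⟩
    0ℤ + - + k * + d                   ≡⟨ ℤ.+-identityˡ _ ⟩
    - + k * + d                        ∎))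
    where
    cancel : ∀ t d k → t ≡ t + d * k + - k * d
    cancel = solve-∀

  -- n is t modulo d, so a zero would again make d divide t.
  d-n+dk≢0 : ∀ k → + d - + n + + d * + k ≢ 0ℤ
  d-n+dk≢0 k eq = d∤t (divides (1ℤ + + k - + N) (begin
    t                                                                        ≡⟨ cancel t (+ d) (+ k) (+ N) ⟩
    - (+ d - (t + + d * + N) + + d * + k) + (1ℤ + + k - + N) * + d           ≡⟨ ≡.cong (λ z → - (+ d - z + + d * + k) + (1ℤ + + k - + N) * + d) n≡t+dN ⟨
    - (+ d - + n + + d * + k) + (1ℤ + + k - + N) * + d                       ≡⟨ ≡.cong (λ z → - z + (1ℤ + + k - + N) * + d) eq ⟩
    0ℤ + (1ℤ + + k - + N) * + d                                              ≡⟨ ℤ.+-identityˡ _ ⟩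
    (1ℤ + + k - + N) * + d                                                   ∎))
    where
    cancel : ∀ t d k N → t ≡ - (d - (t + d * N) + d * k) + (1ℤ + k - N) * d
    cancel = solve-∀

  -- Substituting t = n - dN into x t + y d = 1 gives d (y - x N) = 1 - x n, and e divides n.
  d-inverse : ∀ {e} → e ℕ.∣ n → ∃₂ λ d⁻¹ l → + d * d⁻¹ ≡ 1ℤ + l * + e
  d-inverse {e} (ℕ.divides κ eq) = y - x * + N , - (x * + κ) , (begin
    + d * (y - x * + N)                        ≡⟨ expand (+ d) x y (+ N) t ⟩
    x * t + y * + d - x * (t + + d * + N)      ≡⟨ ≡.cong₂ (λ z z′ → z - x * z′) bézout (≡.trans (≡.sym n≡t+dN) (≡.trans (≡.cong +_ eq) (ℤ.pos-* κ e))) ⟩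
    1ℤ - x * (+ κ * + e)                       ≡⟨ collect x (+ κ) (+ e) ⟩
    1ℤ + - (x * + κ) * + e                     ∎)
    where
    expand : ∀ d x y N t → d * (y - x * N) ≡ x * t + y * d - x * (t + d * N)
    expand = solve-∀
    collect : ∀ x κ e → 1ℤ - x * (κ * e) ≡ 1ℤ + - (x * κ) * e
    collect = solve-∀

-- q-shifted factorials and the reflection of the terms

module _ {c ℓ} (K : CommutativeRing c ℓ) where

  open CommutativeRing K
  open RingSolver K
  open RingKit K
  open Relation.Binary.Reasoning.Setoid setoid

  -- E m is the power q^m and, unless m = 0, iB m inverts B m = 1 - q^m.
  module PowersOfQ
    (E iB : ℤ → Carrier)
    (E-+ : ∀ a b → E (a ℤ.+ b) ≈ E a * E b)
    (E-0 : E 0ℤ ≈ 1#)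
    (B-inverse : ∀ {m} → m ≢ 0ℤ → (1# - E m) * iB m ≈ 1#)
    (d : ℕ) .{{_ : NonZero d}}
    where

    B : ℤ → Carrier
    B m = 1# - E m

    D : ℕ → ℤ
    D k = + d ℤ.* + k

    E-cong : ∀ {m n} → m ≡ n → E m ≈ E n
    E-cong e = reflexive (≡.cong E e)

    B-cong : ∀ {m n} → m ≡ n → B m ≈ B n
    B-cong e = reflexive (≡.cong B e)

    E-inverse : ∀ m → E m * E (ℤ.- m) ≈ 1#
    E-inverse m = trans (sym (E-+ m (ℤ.- m))) (trans (E-cong (ℤ.+-inverseʳ m)) E-0)

    B-neg : ∀ m → B (ℤ.- m) ≈ - (E (ℤ.- m) * B m)
    B-neg m = combine₁ (- 1#) (E-inverse m)
      (solve 2 (λ x y → :1 :- y := :- (y :* (:1 :- x)) :+ :- :1 :* (x :* y :- :1)) (E m) (E (ℤ.- m)))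

    B-+ : ∀ a b → B (a ℤ.+ b) ≈ B a + E a * B b
    B-+ a b = trans (+-congˡ (-‿cong (E-+ a b)))
      (solve 2 (λ x y → :1 :- x :* y := (:1 :- x) :+ x :* (:1 :- y)) (E a) (E b))

    D-suc : ∀ k → D (suc k) ≡ + d ℤ.+ D k
    D-suc k = ℤ.*-suc (+ d) (+ k)

    D-+ : ∀ j k → D (j ℕ.+ k) ≡ D j ℤ.+ D k
    D-+ j k = ℤ.*-distribˡ-+ (+ d) (+ j) (+ k)

    -- The quotient (q^s;q^d)_k / (q^s′;q^d)_k. Letting the denominator start anywhere covers the
    -- perturbed factors and the later blocks of a long product.
    W : ℤ → ℤ → ℕ → Carrier
    W s s′ k = Π< k λ i → B (s ℤ.+ D i) * iB (s′ ℤ.+ D i)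

    W-+ : ∀ s s′ j k → W s s′ (j ℕ.+ k) ≈ W s s′ j * W (s ℤ.+ D j) (s′ ℤ.+ D j) k
    W-+ s s′ j k = trans (Π-split _ j k) (*-congˡ (Π-cong k λ i _ → reflexive
      (≡.cong₂ (λ a b → B a * iB b) (shift s i) (shift s′ i))))
      where
      shift : ∀ s i → s ℤ.+ D (j ℕ.+ i) ≡ s ℤ.+ D j ℤ.+ D i
      shift s i = ≡.trans (≡.cong (λ x → s ℤ.+ x) (D-+ j i)) (≡.sym (ℤ.+-assoc s (D j) (D i)))

    fourth : Carrier → Carrier
    fourth x = (x * x) * (x * x)

    weight : ℤ → ℕ → Carrier
    weight t k = B (+ 2 ℤ.* D k ℤ.+ t) * iB 1ℤ * E ((+ d ℤ.- + 2 ℤ.* t) ℤ.* + k)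

    term : ℤ → ℕ → Carrier
    term t k = weight t k * fourth (W t (+ d) k)

    F : ℕ → Carrier
    F k = Π< k λ i → B (+ d ℤ.+ D i)

    G : ℕ → Carrier
    G k = Π< k λ i → iB (+ d ℤ.+ D i)

    d+D≢0 : ∀ i → + d ℤ.+ D i ≢ 0ℤ
    d+D≢0 i eq = ℕ.≢-nonZero⁻¹ _ {{ℕ.m*n≢0 d (suc i)}}
      (ℤ.+-injective (≡.trans (ℤ.pos-* d (suc i)) (≡.trans (D-suc i) eq)))

    F-inverse : ∀ k → F k * G k ≈ 1#
    F-inverse k = trans (sym (Π-* _ _ k)) (Π-1 _ k λ i _ → B-inverse (d+D≢0 i))

    quadratic : ℕ → ℕ → ℤ
    quadratic k m = + d ℤ.* + k ℤ.* (+ k ℤ.+ + 2 ℤ.* + m ℤ.+ 1ℤ)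

    -- The square avoids both the sign and the triangular number in the
    -- exponent of W (- D M) (+ d) k = ± q^… [ M choose k ].
    W-binomial : ∀ k m → let w = W (ℤ.- D (k ℕ.+ m)) (+ d) k * F k * F m in
      w * w ≈ E (ℤ.- quadratic k m) * (F (k ℕ.+ m) * F (k ℕ.+ m))
    W-binomial zero    m = trans
      (combine₁ (- (F m * F m)) E-0 (solve 2 (λ f x → :1 :* :1 :* f :* (:1 :* :1 :* f) := x :* (f :* f) :+ :- (f :* f) :* (x :- :1)) (F m) (E 0ℤ)))
      (*-congʳ (E-cong (≡.sym (zero-eq (+ d) (+ m)))))
      where
      zero-eq : ∀ d m → ℤ.- (d ℤ.* 0ℤ ℤ.* (0ℤ ℤ.+ + 2 ℤ.* m ℤ.+ 1ℤ)) ≡ 0ℤ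
      zero-eq = solve-∀
    W-binomial (suc k) m = ≡.subst (λ n → let w = W (ℤ.- D n) (+ d) (suc k) * F (suc k) * F m in
        w * w ≈ E (ℤ.- quadratic (suc k) m) * (F n * F n)) (ℕ.+-suc k m) (begin
      _ ≈⟨ *-cong step step ⟩
      _ ≈⟨ solve 4 (λ w f f′ x → w :* f :* f′ :* :- x :* (w :* f :* f′ :* :- x) := w :* f :* f′ :* (w :* f :* f′) :* (x :* x)) w (F k) (F (suc m)) (E (ℤ.- a)) ⟩
      w * F k * F (suc m) * (w * F k * F (suc m)) * (E (ℤ.- a) * E (ℤ.- a)) ≈⟨ *-congʳ (W-binomial k (suc m)) ⟩
      E (ℤ.- quadratic k (suc m)) * (F n * F n) * (E (ℤ.- a) * E (ℤ.- a))
        ≈⟨ solve 3 (λ x f y → x :* f :* (y :* y) := x :* y :* y :* f) (E (ℤ.- quadratic k (suc m))) (F n * F n) (E (ℤ.- a)) ⟩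
      E (ℤ.- quadratic k (suc m)) * E (ℤ.- a) * E (ℤ.- a) * (F n * F n)
        ≈⟨ *-congʳ (trans (*-congʳ (sym (E-+ _ _))) (trans (sym (E-+ _ _)) (E-cong (exponents (+ d) (+ k) (+ m))))) ⟩
      E (ℤ.- quadratic (suc k) m) * (F n * F n) ∎)
      where
      n = k ℕ.+ suc m
      a = + d ℤ.+ D m
      w = W (ℤ.- D n) (+ d) k
      b = + d ℤ.+ D k
      exponents : ∀ d k m → ℤ.- (d ℤ.* k ℤ.* (k ℤ.+ + 2 ℤ.* (1ℤ ℤ.+ m) ℤ.+ 1ℤ)) ℤ.+ ℤ.- (d ℤ.+ d ℤ.* m) ℤ.+ ℤ.- (d ℤ.+ d ℤ.* m)
        ≡ ℤ.- (d ℤ.* (1ℤ ℤ.+ k) ℤ.* (1ℤ ℤ.+ k ℤ.+ + 2 ℤ.* m ℤ.+ 1ℤ))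
      exponents = solve-∀
      reflect : ∀ d k m → ℤ.- (d ℤ.* (k ℤ.+ (1ℤ ℤ.+ m))) ℤ.+ d ℤ.* k ≡ ℤ.- (d ℤ.+ d ℤ.* m)
      reflect = solve-∀
      -- The numerator of index k is 1 - q^(-a), which is - q^(-a) times the last factor of
      -- `F (suc m)`: a factor moves from one product to the other.
      step : W (ℤ.- D n) (+ d) (suc k) * F (suc k) * F m ≈ w * F k * F (suc m) * - E (ℤ.- a)
      step = combine₂ (w * F k * F m * B (ℤ.- D n ℤ.+ D k)) (B-inverse (d+D≢0 k))
        (w * F k * F m) (trans (B-cong (reflect (+ d) (+ k) (+ m))) (B-neg a))
        (solve 8 (λ w x i f b f′ y c → w :* (x :* i) :* (f :* b) :* f′
          := w :* f :* (f′ :* c) :* :- y :+ w :* f :* f′ :* x :* (b :* i :- :1) :+ w :* f :* f′ :* (x :- :- (y :* c)))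
          w (B (ℤ.- D n ℤ.+ D k)) (iB b) (F k) (B b) (F m) (E (ℤ.- a)) (B a))

    -- By the symmetry of the binomial coefficient in `W-binomial`, the squares of the two `W`
    -- differ by a power of q. The sign comes from 2 D k + s = - (2 D m + s) for s = - D (k + m),
    -- and the powers of q balance.
    term-reflection : ∀ k m → term (ℤ.- D (k ℕ.+ m)) k ≈ - term (ℤ.- D (k ℕ.+ m)) m
    term-reflection k m = begin
      weight s k * fourth (W s (+ d) k)
        ≈⟨ *-congˡ (*-cong square square) ⟩
      weight s k * ((y * (wₘ * wₘ)) * (y * (wₘ * wₘ)))
        ≈⟨ solve 3 (λ v y w → v :* ((y :* w) :* (y :* w)) := v :* (y :* y) :* (w :* w)) (weight s k) y (wₘ * wₘ) ⟩
      weight s k * (y * y) * fourth wₘ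
        ≈⟨ *-congʳ weights ⟩
      - weight s m * fourth wₘ
        ≈⟨ solve 2 (λ x y → :- x :* y := :- (x :* y)) (weight s m) (fourth wₘ) ⟩
      - (weight s m * fourth wₘ) ∎
      where
      s δ : ℤ
      s = ℤ.- D (k ℕ.+ m)
      δ = D m ℤ.- D k
      wₖ wₘ y : Carrier
      wₖ = W s (+ d) k
      wₘ = W s (+ d) m
      y = E (quadratic m k ℤ.- quadratic k m)
      cancel-pair : ∀ {x z f g f′ g′} → f * f′ ≈ 1# → g * g′ ≈ 1# → x * f * g * (x * f * g) ≈ z * (f * g * (f * g)) → x * x ≈ z
      cancel-pair {x} {z} {f} {g} {f′} {g′} ef eg eq = *-cancelʳ-invertible {v = f′ * g′ * (f′ * g′)}
        (trans (solve 4 (λ f g f′ g′ → f :* g :* (f :* g) :* (f′ :* g′ :* (f′ :* g′)) := (f :* f′) :* (f :* f′) :* ((g :* g′) :* (g :* g′))) f g f′ g′)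
          (trans (*-cong (*-cong ef ef) (*-cong eg eg)) (solve 0 (:1 :* :1 :* (:1 :* :1) := :1))))
        (trans (solve 3 (λ x f g → x :* x :* (f :* g :* (f :* g)) := x :* f :* g :* (x :* f :* g)) x f g) eq)
      swapped : wₘ * F m * F k * (wₘ * F m * F k) ≈ E (ℤ.- quadratic m k) * (F (k ℕ.+ m) * F (k ℕ.+ m))
      swapped = ≡.subst (λ n → W (ℤ.- D n) (+ d) m * F m * F k * (W (ℤ.- D n) (+ d) m * F m * F k) ≈ E (ℤ.- quadratic m k) * (F n * F n))
        (ℕ.+-comm m k) (W-binomial m k)
      square : wₖ * wₖ ≈ y * (wₘ * wₘ)
      square = cancel-pair (F-inverse k) (F-inverse m) (begin
        wₖ * F k * F m * (wₖ * F k * F m)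
          ≈⟨ W-binomial k m ⟩
        E (ℤ.- quadratic k m) * (F (k ℕ.+ m) * F (k ℕ.+ m))
          ≈⟨ *-congʳ (trans (E-cong (exponents (quadratic k m) (quadratic m k))) (E-+ _ _)) ⟩
        y * E (ℤ.- quadratic m k) * (F (k ℕ.+ m) * F (k ℕ.+ m))
          ≈⟨ combine₁ (- y) swapped (solve 6 (λ y z h w f g →
               y :* z :* h := y :* (w :* w) :* (f :* g :* (f :* g)) :+ :- y :* (w :* g :* f :* (w :* g :* f) :- z :* h))
               y (E (ℤ.- quadratic m k)) (F (k ℕ.+ m) * F (k ℕ.+ m)) wₘ (F k) (F m)) ⟩
        y * (wₘ * wₘ) * (F k * F m * (F k * F m)) ∎)
        where
        exponents : ∀ a b → ℤ.- a ≡ b ℤ.- a ℤ.+ ℤ.- b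
        exponents = solve-∀
      weights : weight s k * (y * y) ≈ - weight s m
      weights = begin
        B (+ 2 ℤ.* D k ℤ.+ s) * iB 1ℤ * E ((+ d ℤ.- + 2 ℤ.* s) ℤ.* + k) * (y * y)
          ≈⟨ *-congʳ (*-congʳ (*-congʳ (trans (B-cong (eqₖ (+ d) (+ k) (+ m))) (B-neg δ)))) ⟩
        - (E (ℤ.- δ) * B δ) * iB 1ℤ * E ((+ d ℤ.- + 2 ℤ.* s) ℤ.* + k) * (y * y)
          ≈⟨ solve 5 (λ x b i z y → :- (x :* b) :* i :* z :* (y :* y) := :- (b :* i :* (x :* z :* y :* y))) (E (ℤ.- δ)) (B δ) (iB 1ℤ) (E ((+ d ℤ.- + 2 ℤ.* s) ℤ.* + k)) y ⟩
        - (B δ * iB 1ℤ * (E (ℤ.- δ) * E ((+ d ℤ.- + 2 ℤ.* s) ℤ.* + k) * y * y))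
          ≈⟨ -‿cong (*-cong (*-congʳ (B-cong (eqₘ (+ d) (+ k) (+ m))))
               (trans (*-congʳ (trans (*-congʳ (sym (E-+ _ _))) (sym (E-+ _ _)))) (trans (sym (E-+ _ _)) (E-cong (exponents (+ d) (+ k) (+ m)))))) ⟩
        - (B (+ 2 ℤ.* D m ℤ.+ s) * iB 1ℤ * E ((+ d ℤ.- + 2 ℤ.* s) ℤ.* + m)) ∎
        where
        eqₖ : ∀ d k m → + 2 ℤ.* (d ℤ.* k) ℤ.+ ℤ.- (d ℤ.* (k ℤ.+ m)) ≡ ℤ.- (d ℤ.* m ℤ.- d ℤ.* k)
        eqₖ = solve-∀
        eqₘ : ∀ d k m → d ℤ.* m ℤ.- d ℤ.* k ≡ + 2 ℤ.* (d ℤ.* m) ℤ.+ ℤ.- (d ℤ.* (k ℤ.+ m))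
        eqₘ = solve-∀
        exponents : ∀ d k m → let q = λ k m → d ℤ.* k ℤ.* (k ℤ.+ + 2 ℤ.* m ℤ.+ 1ℤ)
                                  y = q m k ℤ.- q k m
                                  a = d ℤ.- + 2 ℤ.* (ℤ.- (d ℤ.* (k ℤ.+ m))) in
          ℤ.- (d ℤ.* m ℤ.- d ℤ.* k) ℤ.+ a ℤ.* k ℤ.+ y ℤ.+ y ≡ a ℤ.* m
        exponents = solve-∀

    closed-form : ℤ → ℕ → ℕ → Carrier
    closed-form t n N = W (+ 2 ℤ.* t) (+ d) N * (B (+ n) * iB 1ℤ) * E (ℤ.- t ℤ.* + N)

  -- The perturbed sum in closed form

  module _
    (E iB : ℤ → Carrier)
    (E-+ : ∀ a b → E (a ℤ.+ b) ≈ E a * E b)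
    (E-0 : E 0ℤ ≈ 1#)
    (B-inverse : ∀ {m} → m ≢ 0ℤ → (1# - E m) * iB m ≈ 1#)
    (d : ℕ) .{{_ : NonZero d}}
    where

    open PowersOfQ E iB E-+ E-0 B-inverse d

    module ExactSum
      (t : ℤ) (n M : ℕ) (n-eq : + n ≡ t ℤ.+ D M)
      (t+D≢0 : ∀ k → t ℤ.+ D k ≢ 0ℤ)
      (d-n+D≢0 : ∀ k → + d ℤ.- + n ℤ.+ D k ≢ 0ℤ)
      where

      private
        ν : ℤ
        ν = + n

      perturbed-term : ℕ → Carrier
      perturbed-term k = weight t k *
        ((W t (+ d) k * W t (+ d) k) * (W (t ℤ.+ ν) (+ d ℤ.+ ν) k * W (t ℤ.- ν) (+ d ℤ.- ν) k))

      private
        i₁ i₂ i₃ : ℕ → Carrier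
        i₁ k = iB (+ d ℤ.+ D k)
        -- C - A x (k+1) equals q^(t+n) (1 - q^(d-n+dk)).
        i₂ k = E (ℤ.- (t ℤ.+ ν)) * iB (+ d ℤ.- ν ℤ.+ D k)
        i₃ k = iB (t ℤ.+ D (suc k))

        inverse₁ : ∀ k → (1# - E (D (suc k))) * i₁ k ≈ 1#
        inverse₁ k = trans (*-congʳ (B-cong (D-suc k))) (B-inverse (d+D≢0 k))

        inverse₂ : ∀ k → (E (t ℤ.+ ν) - E t * E (D (suc k))) * i₂ k ≈ 1#
        inverse₂ k = begin
          (E (t ℤ.+ ν) - E t * E (D (suc k))) * i₂ k
            ≈⟨ *-congʳ (+-congˡ (-‿cong (trans (sym (E-+ _ _)) (trans (E-cong (≡.trans (≡.cong (λ x → t ℤ.+ x) (D-suc k)) (exponents t ν (+ d) (D k)))) (E-+ _ _))))) ⟩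
          (E (t ℤ.+ ν) - E (t ℤ.+ ν) * E m) * i₂ k
            ≈⟨ combine₂ 1# (E-inverse (t ℤ.+ ν)) (E (t ℤ.+ ν) * E (ℤ.- (t ℤ.+ ν))) (B-inverse (d-n+D≢0 k))
                 (solve 4 (λ c c′ x i → (c :- c :* x) :* (c′ :* i) := :1 :+ :1 :* (c :* c′ :- :1) :+ c :* c′ :* ((:1 :- x) :* i :- :1))
                   (E (t ℤ.+ ν)) (E (ℤ.- (t ℤ.+ ν))) (E m) (iB m)) ⟩
          1# ∎
          where
          m = + d ℤ.- ν ℤ.+ D k
          exponents : ∀ t ν d x → t ℤ.+ (d ℤ.+ x) ≡ t ℤ.+ ν ℤ.+ (d ℤ.- ν ℤ.+ x)
          exponents = solve-∀

        inverse₃ : ∀ k → (1# - E t * E (D (suc k))) * i₃ k ≈ 1#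
        inverse₃ k = trans (*-congʳ (+-congˡ (-‿cong (sym (E-+ _ _))))) (B-inverse (t+D≢0 (suc k)))

        -- `C` is q^(t+n) with n fixed, so the recurrence in the length of the sum leaves it alone;
        -- n = t + D M enters only once the length is set to M.
        module VWP = VeryWellPoised K (E t) (E (t ℤ.+ ν)) (E (+ d)) (λ k → E (D k)) i₁ i₂ i₃
          (trans (E-cong (ℤ.*-zeroʳ (+ d))) E-0)
          (λ k → trans (E-cong (D-suc k)) (E-+ _ _))
          inverse₁ inverse₂ inverse₃

        Π-E : ∀ a k → Π< k (λ _ → E a) ≈ E (a ℤ.* + k)
        Π-E a zero    = trans (sym E-0) (E-cong (≡.sym (ℤ.*-zeroʳ a)))
        Π-E a (suc k) = trans (*-congʳ (Π-E a k)) (trans (sym (E-+ _ _)) (E-cong (exponents a (+ k))))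
          where
          exponents : ∀ a k → a ℤ.* k ℤ.+ a ≡ a ℤ.* (1ℤ ℤ.+ k)
          exponents = solve-∀

        -- Because n = t + D M, the terminating factor x M - x i is q^(dM) (1 - q^(t-n+di)), and
        -- `i₃ (M + i)` inverts 1 - q^(d+n+di). The leftover power q^(dM-t-n) is q^(-2t), the same
        -- for every i.
        factor : ∀ i → VWP.u i * VWP.v M i ≈
          (B (t ℤ.+ D i) * iB (+ d ℤ.+ D i)) * (B (t ℤ.+ D i) * iB (+ d ℤ.+ D i))
            * ((B (t ℤ.+ ν ℤ.+ D i) * iB (+ d ℤ.+ ν ℤ.+ D i)) * (B (t ℤ.- ν ℤ.+ D i) * iB (+ d ℤ.- ν ℤ.+ D i)))
            * E (ℤ.- + 2 ℤ.* t)
        factor i = begin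
          (1# - E t * E (D i)) * (1# - E t * E (D i)) * (1# - E (t ℤ.+ ν) * E (D i)) * (i₁ i * i₁ i * i₂ i)
            * ((E (D M) - E (D i)) * i₃ (M ℕ.+ i))
            ≈⟨ *-cong (*-congʳ (*-cong (*-cong b b) b′)) (*-cong difference (reflexive (≡.cong iB (index)))) ⟩
          B T * B T * B (t ℤ.+ ν ℤ.+ D i) * (i₁ i * i₁ i * i₂ i) * (E (D M) * B (t ℤ.- ν ℤ.+ D i) * iB (+ d ℤ.+ ν ℤ.+ D i))
            ≈⟨ solve 8 (λ a b c i j x y k → a :* a :* b :* (i :* i :* (x :* j)) :* (y :* c :* k)
                 := a :* i :* (a :* i) :* (b :* k :* (c :* j)) :* (y :* x))
                 (B T) (B (t ℤ.+ ν ℤ.+ D i)) (B (t ℤ.- ν ℤ.+ D i)) (i₁ i) (iB (+ d ℤ.- ν ℤ.+ D i)) (E (ℤ.- (t ℤ.+ ν))) (E (D M)) (iB (+ d ℤ.+ ν ℤ.+ D i)) ⟩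
          _ * (E (D M) * E (ℤ.- (t ℤ.+ ν)))
            ≈⟨ *-congˡ (trans (sym (E-+ _ _)) (E-cong (≡.trans (≡.cong (λ x → D M ℤ.+ ℤ.- (t ℤ.+ x)) n-eq) (exponents t (D M))))) ⟩
          _ * E (ℤ.- + 2 ℤ.* t) ∎
          where
          T = t ℤ.+ D i
          b : 1# - E t * E (D i) ≈ B T
          b = +-congˡ (-‿cong (sym (E-+ _ _)))
          b′ : 1# - E (t ℤ.+ ν) * E (D i) ≈ B (t ℤ.+ ν ℤ.+ D i)
          b′ = +-congˡ (-‿cong (sym (E-+ _ _)))
          exponents : ∀ t x → x ℤ.+ ℤ.- (t ℤ.+ (t ℤ.+ x)) ≡ ℤ.- + 2 ℤ.* t
          exponents = solve-∀
          difference : E (D M) - E (D i) ≈ E (D M) * B (t ℤ.- ν ℤ.+ D i)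
          difference = begin
            E (D M) - E (D i)
              ≈⟨ +-congˡ (-‿cong (trans (E-cong (≡.trans (shift t (D M) (D i)) (≡.cong (λ x → D M ℤ.+ (t ℤ.- x ℤ.+ D i)) (≡.sym n-eq)))) (E-+ _ _))) ⟩
            E (D M) - E (D M) * E (t ℤ.- ν ℤ.+ D i)
              ≈⟨ solve 2 (λ x y → x :- x :* y := x :* (:1 :- y)) (E (D M)) (E (t ℤ.- ν ℤ.+ D i)) ⟩
            E (D M) * B (t ℤ.- ν ℤ.+ D i) ∎
            where
            shift : ∀ t x y → y ≡ x ℤ.+ (t ℤ.- (t ℤ.+ x) ℤ.+ y)
            shift = solve-∀
          index : t ℤ.+ D (suc (M ℕ.+ i)) ≡ + d ℤ.+ ν ℤ.+ D i
          index = ≡.trans (≡.cong (λ x → t ℤ.+ x) (≡.trans (D-suc (M ℕ.+ i)) (≡.cong (λ x → + d ℤ.+ x) (D-+ M i))))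
            (≡.trans (shift t (+ d) (D M) (D i)) (≡.cong (λ x → + d ℤ.+ x ℤ.+ D i) (≡.sym n-eq)))
            where
            shift : ∀ t d x y → t ℤ.+ (d ℤ.+ (x ℤ.+ y)) ≡ d ℤ.+ (t ℤ.+ x) ℤ.+ y
            shift = solve-∀

        term≈ : ∀ k → iB 1ℤ * VWP.term M k ≈ perturbed-term k
        term≈ k = begin
          iB 1ℤ * ((1# - E t * (E (D k) * E (D k))) * E (D k) * (VWP.U k * VWP.V M k))
            ≈⟨ *-congˡ (*-cong (*-congʳ (+-congˡ (-‿cong (trans (*-congˡ (sym (E-+ _ _))) (trans (sym (E-+ _ _)) (E-cong (double t (D k)))))))) product) ⟩
          iB 1ℤ * (B (+ 2 ℤ.* D k ℤ.+ t) * E (D k) * (w * E (ℤ.- + 2 ℤ.* t ℤ.* + k)))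
            ≈⟨ solve 5 (λ i b x w y → i :* (b :* x :* (w :* y)) := b :* i :* (x :* y) :* w) (iB 1ℤ) (B (+ 2 ℤ.* D k ℤ.+ t)) (E (D k)) w (E (ℤ.- + 2 ℤ.* t ℤ.* + k)) ⟩
          B (+ 2 ℤ.* D k ℤ.+ t) * iB 1ℤ * (E (D k) * E (ℤ.- + 2 ℤ.* t ℤ.* + k)) * w
            ≈⟨ *-congʳ (*-congˡ (trans (sym (E-+ _ _)) (E-cong (exponents t (+ d) (+ k))))) ⟩
          perturbed-term k ∎
          where
          w = (W t (+ d) k * W t (+ d) k) * (W (t ℤ.+ ν) (+ d ℤ.+ ν) k * W (t ℤ.- ν) (+ d ℤ.- ν) k)
          double : ∀ t x → t ℤ.+ (x ℤ.+ x) ≡ + 2 ℤ.* x ℤ.+ t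
          double = solve-∀
          exponents : ∀ t d k → d ℤ.* k ℤ.+ ℤ.- + 2 ℤ.* t ℤ.* k ≡ (d ℤ.- + 2 ℤ.* t) ℤ.* k
          exponents = solve-∀
          product : VWP.U k * VWP.V M k ≈ w * E (ℤ.- + 2 ℤ.* t ℤ.* + k)
          product = trans (sym (Π-* _ _ k)) (trans (Π-cong k λ i _ → factor i)
            (trans (Π-* _ _ k) (*-cong (trans (Π-* _ _ k) (*-cong (Π-* _ _ k) (Π-* _ _ k))) (Π-E _ k))))

        quotient≈ : ∀ j → i₁ j * ((E (t ℤ.+ ν) - E (D (suc j))) * i₂ j) ≈
          iB (+ d ℤ.+ D j) * (B (+ d ℤ.- ν ℤ.+ D j ℤ.- t) * iB (+ d ℤ.- ν ℤ.+ D j))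
        quotient≈ j = *-congˡ (begin
          (E (t ℤ.+ ν) - E (D (suc j))) * (E (ℤ.- (t ℤ.+ ν)) * i)
            ≈⟨ *-congʳ (+-congˡ (-‿cong (trans (E-cong (≡.trans (D-suc j) (exponents t ν (+ d) (D j)))) (E-+ _ _)))) ⟩
          (E (t ℤ.+ ν) - E (t ℤ.+ ν) * E m) * (E (ℤ.- (t ℤ.+ ν)) * i)
            ≈⟨ combine₁ (B m * i) (E-inverse (t ℤ.+ ν)) (solve 4 (λ c c′ x i → (c :- c :* x) :* (c′ :* i)
                 := (:1 :- x) :* i :+ (:1 :- x) :* i :* (c :* c′ :- :1)) (E (t ℤ.+ ν)) (E (ℤ.- (t ℤ.+ ν))) (E m) i) ⟩
          B m * i ∎)
          where
          m = + d ℤ.- ν ℤ.+ D j ℤ.- t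
          i = iB (+ d ℤ.- ν ℤ.+ D j)
          exponents : ∀ t ν d x → d ℤ.+ x ≡ t ℤ.+ ν ℤ.+ (d ℤ.- ν ℤ.+ x ℤ.- t)
          exponents = solve-∀

        reflected : ∀ i j → suc (i ℕ.+ j) ≡ M → + d ℤ.- ν ℤ.+ D i ≡ ℤ.- (t ℤ.+ D j)
        reflected i j eq = ≡.trans (≡.cong (λ x → + d ℤ.- x ℤ.+ D i) (≡.trans n-eq (≡.cong (λ m → t ℤ.+ D m) (≡.sym eq)))) (lemma t (+ d) (+ i) (+ j))
          where
          lemma : ∀ t d i j → d ℤ.- (t ℤ.+ d ℤ.* (1ℤ ℤ.+ (i ℤ.+ j))) ℤ.+ d ℤ.* i ≡ ℤ.- (t ℤ.+ d ℤ.* j)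
          lemma = solve-∀

        -- Read backwards, the denominators become 1 - q^(-(t+dj)), ready to cancel against the
        -- factors 1 - A x j of the summation formula.
        reversal : Π< M (λ j → B (+ d ℤ.- ν ℤ.+ D j ℤ.- t) * iB (+ d ℤ.- ν ℤ.+ D j)) ≈
          Π< M (λ j → B (ℤ.- (+ 2 ℤ.* t ℤ.+ D j)) * iB (ℤ.- (t ℤ.+ D j)))
        reversal = Π-reverse M λ i j eq → reflexive (≡.cong₂ (λ a b → B a * iB b)
          (≡.trans (≡.cong (λ x → x ℤ.- t) (reflected i j eq)) (lemma t (D j))) (reflected i j eq))
          where
          lemma : ∀ t x → ℤ.- (t ℤ.+ x) ℤ.- t ≡ ℤ.- (+ 2 ℤ.* t ℤ.+ x)
          lemma = solve-∀

        -- Changing the signs of both exponents contributes q^(-(2t+dj)) / q^(-(t+dj)) = q^(-t) per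
        -- factor; altogether this is the power q^(-tM) of the right-hand side.
        rhs-factor : ∀ j → B (t ℤ.+ D j) * (iB (+ d ℤ.+ D j) * (B (ℤ.- (+ 2 ℤ.* t ℤ.+ D j)) * iB (ℤ.- (t ℤ.+ D j)))) ≈
          B (+ 2 ℤ.* t ℤ.+ D j) * iB (+ d ℤ.+ D j) * E (ℤ.- t)
        rhs-factor j = begin
          b * (i * (B (ℤ.- a) * i′))
            ≈⟨ *-congˡ (*-congˡ (*-congʳ (trans (B-neg a) (-‿cong (*-congʳ (trans (E-cong (exponents t (D j))) (E-+ _ _))))))) ⟩
          b * (i * (- (x * y * B a) * i′))
            ≈⟨ combine₂ (B a * i * x) (B-inverse t′≢0) (- (B a * i * x * i′)) (B-neg T)
                 (solve 7 (λ b i x y a i′ b′ → b :* (i :* (:- (x :* y :* a) :* i′))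
                   := a :* i :* x :+ a :* i :* x :* (b′ :* i′ :- :1) :+ :- (a :* i :* x :* i′) :* (b′ :- :- (y :* b))) b i x y (B a) i′ (B (ℤ.- T))) ⟩
          B a * i * x ∎
          where
          T = t ℤ.+ D j
          a = + 2 ℤ.* t ℤ.+ D j
          b = B T
          i = iB (+ d ℤ.+ D j)
          i′ = iB (ℤ.- T)
          x = E (ℤ.- t)
          y = E (ℤ.- T)
          t′≢0 : ℤ.- T ≢ 0ℤ
          t′≢0 eq = t+D≢0 j (ℤ.neg-injective eq)
          exponents : ∀ t x → ℤ.- (+ 2 ℤ.* t ℤ.+ x) ≡ ℤ.- t ℤ.+ ℤ.- (t ℤ.+ x)
          exponents = solve-∀

      perturbed-sum : Σ< (suc M) perturbed-term ≈ closed-form t n M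
      perturbed-sum = begin
        Σ< (suc M) perturbed-term
          ≈⟨ Σ-cong (suc M) (λ k _ → term≈ k) ⟨
        Σ< (suc M) (λ k → iB 1ℤ * VWP.term M k)
          ≈⟨ *-Σ _ _ (suc M) ⟨
        iB 1ℤ * Σ< (suc M) (VWP.term M)
          ≈⟨ *-congˡ (VWP.summation M) ⟩
        iB 1ℤ * (Π< M (λ j → 1# - E t * E (D j)) * (1# - E t * E (D M)) * Π< M (λ j → i₁ j * ((E (t ℤ.+ ν) - E (D (suc j))) * i₂ j)))
          -- The last of the M + 1 factors 1 - A x j is 1 - q^n; with `iB 1ℤ` it forms [n].
          ≈⟨ *-congˡ (*-cong (*-cong (Π-cong M λ j _ → b j) (trans (b M) (B-cong (≡.sym n-eq))))
               (trans (Π-cong M λ j _ → quotient≈ j) (trans (Π-* _ _ M) (*-congˡ reversal)))) ⟩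
        iB 1ℤ * (p * B ν * (r * s))
          ≈⟨ solve 5 (λ i p b r s → i :* (p :* b :* (r :* s)) := p :* (r :* s) :* (b :* i)) (iB 1ℤ) p (B ν) r s ⟩
        p * (r * s) * (B ν * iB 1ℤ)
          ≈⟨ *-congʳ (trans (*-congˡ (sym (Π-* _ _ M))) (trans (sym (Π-* _ _ M)) (trans (Π-cong M λ j _ → rhs-factor j) (trans (Π-* _ _ M) (*-congˡ (Π-E _ M)))))) ⟩
        W (+ 2 ℤ.* t) (+ d) M * E (ℤ.- t ℤ.* + M) * (B ν * iB 1ℤ)
          ≈⟨ solve 3 (λ w x b → w :* x :* b := w :* b :* x) (W (+ 2 ℤ.* t) (+ d) M) (E (ℤ.- t ℤ.* + M)) (B ν * iB 1ℤ) ⟩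
        W (+ 2 ℤ.* t) (+ d) M * (B ν * iB 1ℤ) * E (ℤ.- t ℤ.* + M) ∎
        where
        p = Π< M λ j → B (t ℤ.+ D j)
        r = Π< M λ j → iB (+ d ℤ.+ D j)
        s = Π< M λ j → B (ℤ.- (+ 2 ℤ.* t ℤ.+ D j)) * iB (ℤ.- (t ℤ.+ D j))
        b : ∀ j → 1# - E t * E (D j) ≈ B (t ℤ.+ D j)
        b j = +-congˡ (-‿cong (sym (E-+ _ _)))

    -- The operations of the statement are parameters, so that instantiating
    -- them yields the statement's expressions verbatim.
    module StatementForm
      (bracket : ℤ → Carrier) (bracket≈ : ∀ m → bracket m ≈ (1# - E m) * iB 1ℤ)
      (poch : Carrier → Carrier → ℕ → Carrier)
      (poch≈ : ∀ x y k → poch x y k ≈ Π< k (λ j → 1# - x * Algebra.Properties.Semiring.Exp._^_ semiring y j))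
      (_⋆_ : Carrier → Carrier → Carrier) (⋆≈ : ∀ x y → x ⋆ y ≈ x * y)
      (_∸_ : Carrier → Carrier → Carrier) (∸≈ : ∀ x y → x ∸ y ≈ x - y)
      (_÷_ : Carrier → Carrier → Carrier) (÷≈ : ∀ f {g h} → g * h ≈ 1# → f ÷ g ≈ f * h)
      (_↑_ : Carrier → ℕ → Carrier) (↑2≈ : ∀ x → x ↑ 2 ≈ x * x) (↑4≈ : ∀ x → x ↑ 4 ≈ (x * x) * (x * x))
      (Σᶠ : ∀ {n} → (Fin n → Carrier) → Carrier) (Σᶠ≈ : ∀ n f → Σᶠ {n} (λ k → f (toℕ k)) ≈ Σ< n f)
      where

      open Algebra.Properties.Semiring.Exp semiring

      E-power : ∀ j → E (+ d) ^ j ≈ E (D j)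
      E-power zero    = trans (sym E-0) (E-cong (≡.sym (ℤ.*-zeroʳ (+ d))))
      E-power (suc j) = trans (*-congˡ (E-power j)) (trans (sym (E-+ (+ d) (D j))) (E-cong (≡.sym (D-suc j))))

      numerator : ℤ → ℕ → Carrier
      numerator s k = Π< k λ j → B (s ℤ.+ D j)

      poch-E : ∀ s k → poch (E s) (E (+ d)) k ≈ numerator s k
      poch-E s k = trans (poch≈ (E s) (E (+ d)) k) (Π-cong k λ j _ →
        +-congˡ (-‿cong (trans (*-congˡ (E-power j)) (sym (E-+ s (D j))))))

      poch-inverse : ∀ k → poch (E (+ d)) (E (+ d)) k * G k ≈ 1#
      poch-inverse k = trans (*-congʳ (poch-E (+ d) k)) (F-inverse k)

      W≈ : ∀ s k → W s (+ d) k ≈ numerator s k * G k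
      W≈ s k = Π-* _ _ k

      quotient≈ : ∀ s k → poch (E s) (E (+ d)) k ÷ poch (E (+ d)) (E (+ d)) k ≈ W s (+ d) k
      quotient≈ s k = trans (÷≈ _ (poch-inverse k)) (trans (*-congʳ (poch-E s k)) (sym (W≈ s k)))

      fourth-quotient≈ : ∀ s k → (poch (E s) (E (+ d)) k ↑ 4) ÷ (poch (E (+ d)) (E (+ d)) k ↑ 4) ≈ fourth (W s (+ d) k)
      fourth-quotient≈ s k = trans (÷≈ _ {h = fourth (G k)} inverse) (begin
        (poch (E s) (E (+ d)) k ↑ 4) * fourth (G k)   ≈⟨ *-congʳ (trans (↑4≈ _) (*-cong (*-cong p p) (*-cong p p))) ⟩
        fourth (numerator s k) * fourth (G k)         ≈⟨ medial (numerator s k) (G k) ⟩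
        fourth (numerator s k * G k)                  ≈⟨ *-cong (*-cong (W≈ s k) (W≈ s k)) (*-cong (W≈ s k) (W≈ s k)) ⟨
        fourth (W s (+ d) k)                          ∎)
        where
        p = poch-E s k
        medial : ∀ x y → fourth x * fourth y ≈ fourth (x * y)
        medial = solve 2 λ x y → (x :* x) :* (x :* x) :* ((y :* y) :* (y :* y)) := (x :* y :* (x :* y)) :* (x :* y :* (x :* y))
        inverse : (poch (E (+ d)) (E (+ d)) k ↑ 4) * fourth (G k) ≈ 1#
        inverse = begin
          (poch (E (+ d)) (E (+ d)) k ↑ 4) * fourth (G k)   ≈⟨ trans (*-congʳ (↑4≈ _)) (medial _ (G k)) ⟩
          fourth (poch (E (+ d)) (E (+ d)) k * G k)         ≈⟨ *-cong (*-cong e e) (*-cong e e) ⟩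
          fourth 1#                                         ≈⟨ solve 0 ((:1 :* :1) :* (:1 :* :1) := :1) ⟩
          1#                                                ∎
          where
          e = poch-inverse k

      module _ (t : ℤ) where

        summand≈ : ∀ k →
          (bracket (+ 2 ℤ.* + d ℤ.* + k ℤ.+ t) ⋆ ((poch (E t) (E (+ d)) k ↑ 4) ÷ (poch (E (+ d)) (E (+ d)) k ↑ 4)))
            ⋆ E ((+ d ℤ.- + 2 ℤ.* t) ℤ.* + k) ≈ term t k
        summand≈ k = begin
          _ ≈⟨ trans (⋆≈ _ _) (*-congʳ (⋆≈ _ _)) ⟩
          bracket (+ 2 ℤ.* + d ℤ.* + k ℤ.+ t) * ((poch (E t) (E (+ d)) k ↑ 4) ÷ (poch (E (+ d)) (E (+ d)) k ↑ 4)) * E ((+ d ℤ.- + 2 ℤ.* t) ℤ.* + k)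
            ≈⟨ *-congʳ (*-cong (trans (bracket≈ _) (*-congʳ (B-cong (≡.cong (λ x → x ℤ.+ t) (ℤ.*-assoc (+ 2) (+ d) (+ k)))))) (fourth-quotient≈ t k)) ⟩
          B (+ 2 ℤ.* D k ℤ.+ t) * iB 1ℤ * fourth (W t (+ d) k) * E ((+ d ℤ.- + 2 ℤ.* t) ℤ.* + k)
            ≈⟨ solve 4 (λ b i w x → b :* i :* w :* x := b :* i :* x :* w) (B (+ 2 ℤ.* D k ℤ.+ t)) (iB 1ℤ) (fourth (W t (+ d) k)) (E ((+ d ℤ.- + 2 ℤ.* t) ℤ.* + k)) ⟩
          term t k ∎

        module _ (n N : ℕ) (m : ℤ) (m≡ : m ≡ ℤ.- t ℤ.* + N) where

          closed-form≈ : ((poch (E (+ 2 ℤ.* t)) (E (+ d)) N ÷ poch (E (+ d)) (E (+ d)) N) ⋆ bracket (+ n)) ⋆ E m ≈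
            closed-form t n N
          closed-form≈ = trans (⋆≈ _ _) (*-cong (trans (⋆≈ _ _) (*-cong (quotient≈ (+ 2 ℤ.* t) N) (bracket≈ (+ n)))) (E-cong m≡))

          difference≈ : ∀ L →
            Σ< L (term t) - closed-form t n N ≈
            Σᶠ {L} (λ k → (bracket (+ 2 ℤ.* + d ℤ.* + toℕ k ℤ.+ t) ⋆ ((poch (E t) (E (+ d)) (toℕ k) ↑ 4) ÷ (poch (E (+ d)) (E (+ d)) (toℕ k) ↑ 4)))
                ⋆ E ((+ d ℤ.- + 2 ℤ.* t) ℤ.* + toℕ k))
              ∸ (((poch (E (+ 2 ℤ.* t)) (E (+ d)) N ÷ poch (E (+ d)) (E (+ d)) N) ⋆ bracket (+ n)) ⋆ E m)
          difference≈ L = sym (trans (∸≈ _ _) (+-cong (trans (Σᶠ≈ L _) (Σ-cong L λ k _ → summand≈ k)) (-‿cong closed-form≈)))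

    -- Both sums modulo a single cyclotomic factor

    module _ {o} (S : Subring K o) where

      open Subring S
      open Congruences K S

      module _
        (e : ℕ) (1<e : 1 < e) (π h : Carrier)
        (O-E : ∀ m → O (E m))
        (O-iB : ∀ {m} → ¬ (+ e ℤ.∣ m) → O (iB m))
        (O-quotient : ∀ k → O (B (+ e) * iB (+ suc k ℤ.* + e)))
        (B-e∼0 : B (+ e) ∼ 0# [ π ])
        (O-h : O h) (h+h≈1 : h + h ≈ 1#)
        (d⁻¹ l₀ : ℤ) (d-inverse : + d ℤ.* d⁻¹ ≡ 1ℤ ℤ.+ l₀ ℤ.* + e)
        where

        instance
          e-nonZero : NonZero e
          e-nonZero = ℕ.>-nonZero (ℕ.<-trans ℕ.z<s 1<e)

        open Progressions d e d⁻¹ l₀ d-inverse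

        ∤⇒≢0 : ∀ {m} → ¬ (+ e ℤ.∣ m) → m ≢ 0ℤ
        ∤⇒≢0 e∤m ≡.refl = e∤m (divides 0ℤ ≡.refl)

        O-B : ∀ m → O (B m)
        O-B m = O-+ O-1 (O-neg (O-E m))

        O-iB-1 : O (iB 1ℤ)
        O-iB-1 = O-iB (∤-small ℕ.z<s 1<e)

        B-multiple⁺ : ∀ k → ∃ λ z → O z × B (+ k ℤ.* + e) ≈ z * B (+ e)
        B-multiple⁺ zero    = 0# , O-0 , trans (+-congˡ (-‿cong E-0)) (trans (-‿inverseʳ 1#) (sym (zeroˡ _)))
        B-multiple⁺ (suc k) with z , oz , eq ← B-multiple⁺ k = 1# + E (+ e) * z , O-+ O-1 (O-* (O-E (+ e)) oz) , (begin
          B (+ suc k ℤ.* + e)                   ≈⟨ B-cong (ℤ.suc-* (+ k) (+ e)) ⟩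
          B (+ e ℤ.+ + k ℤ.* + e)               ≈⟨ B-+ (+ e) (+ k ℤ.* + e) ⟩
          B (+ e) + E (+ e) * B (+ k ℤ.* + e)   ≈⟨ +-congˡ (*-congˡ eq) ⟩
          B (+ e) + E (+ e) * (z * B (+ e))     ≈⟨ solve 3 (λ b x z → b :+ x :* (z :* b) := (:1 :+ x :* z) :* b) (B (+ e)) (E (+ e)) z ⟩
          (1# + E (+ e) * z) * B (+ e)          ∎)

        B-multiple-neg : ∀ m → (∃ λ z → O z × B m ≈ z * B (+ e)) → ∃ λ z → O z × B (ℤ.- m) ≈ z * B (+ e)
        B-multiple-neg m (z , oz , eq) = - (E (ℤ.- m) * z) , O-neg (O-* (O-E (ℤ.- m)) oz) , (begin
          B (ℤ.- m)                        ≈⟨ B-neg m ⟩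
          - (E (ℤ.- m) * B m)              ≈⟨ -‿cong (*-congˡ eq) ⟩
          - (E (ℤ.- m) * (z * B (+ e)))    ≈⟨ solve 3 (λ b x z → :- (x :* (z :* b)) := :- (x :* z) :* b) (B (+ e)) (E (ℤ.- m)) z ⟩
          - (E (ℤ.- m) * z) * B (+ e)      ∎)

        B-multiple : ∀ l → ∃ λ z → O z × B (l ℤ.* + e) ≈ z * B (+ e)
        B-multiple (+ k)    = B-multiple⁺ k
        B-multiple -[1+ k ] = ≡.subst (λ m → ∃ λ z → O z × B m ≈ z * B (+ e)) (ℤ.neg-distribˡ-* (+ suc k) (+ e))
          (B-multiple-neg (+ suc k ℤ.* + e) (B-multiple⁺ (suc k)))

        B-multiple∼0 : ∀ l → B (l ℤ.* + e) ∼ 0# [ π ]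
        B-multiple∼0 l with z , oz , eq ← B-multiple l = ∼-trans (∼-reflexive eq) (∼0-*ˡ oz B-e∼0)

        E-periodic : ∀ {m n} l → m ≡ n ℤ.+ l ℤ.* + e → E m ∼ E n [ π ]
        E-periodic {m} {n} l eq = ∼-move (∼-trans (∼-reflexive difference) (∼0-*ˡ (O-neg (O-E n)) (B-multiple∼0 l)))
          where
          difference : E m - E n ≈ - E n * B (l ℤ.* + e)
          difference = trans (+-congʳ (trans (E-cong eq) (E-+ n (l ℤ.* + e))))
            (solve 2 (λ x y → x :* y :- x := :- x :* (:1 :- y)) (E n) (E (l ℤ.* + e)))

        B-periodic : ∀ {m n} l → m ≡ n ℤ.+ l ℤ.* + e → B m ∼ B n [ π ]
        B-periodic l eq = ∼-+ ∼-refl (∼-neg (E-periodic l eq))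

        iB-periodic : ∀ {m n} l → m ≡ n ℤ.+ l ℤ.* + e → ¬ (+ e ℤ.∣ n) → O (iB m) × iB m ∼ iB n [ π ]
        iB-periodic {m} {n} l eq e∤n = O-iB e∤m , ∼-inverse (O-iB e∤m) (O-iB e∤n) (B-inverse (∤⇒≢0 e∤m)) (B-inverse (∤⇒≢0 e∤n)) (B-periodic l eq)
          where
          e∤m : ¬ (+ e ℤ.∣ m)
          e∤m p = e∤n (∣-+-multiple l (≡.subst (λ x → + e ℤ.∣ x) eq p))

        -- The bound keeps i + 1 < e for all i < k, so that e divides neither the exponents d (i +
        -- 1) in the denominator nor their shifts by multiples of e.
        W-periodic : ∀ s s₁ l l′ k → s ≡ s₁ ℤ.+ l ℤ.* + e → k ≤ e ℕ.∸ 1 →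
          O (W s (+ d ℤ.+ l′ ℤ.* + e) k) × W s (+ d ℤ.+ l′ ℤ.* + e) k ∼ W s₁ (+ d) k [ π ]
        W-periodic s s₁ l l′ k eq k<e =
          O-Π k (λ i i<k → O-* (O-B _) (proj₁ (denominator i i<k))) ,
          ∼-Π k (λ i i<k → O-* (O-B _) (proj₁ (denominator i i<k)))
                (λ i i<k → O-* (O-B _) (O-iB (e∤ i i<k)))
                (λ i i<k → ∼-* (O-B _) (O-iB (e∤ i i<k))
                  (B-periodic l (≡.trans (≡.cong (λ x → x ℤ.+ D i) eq) (shift s₁ (l ℤ.* + e) (D i))))
                  (proj₂ (denominator i i<k)))
          where
          shift : ∀ s x y → s ℤ.+ x ℤ.+ y ≡ s ℤ.+ y ℤ.+ x
          shift = solve-∀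
          e∤ : ∀ i → i < k → ¬ (+ e ℤ.∣ + d ℤ.+ D i)
          e∤ i i<k = ∤-denominator (ℕ.≤-trans (s≤s (ℕ.≤-trans i<k k<e)) (ℕ.≤-reflexive (ℕ.suc-pred e)))
          denominator : ∀ i → i < k → O (iB (+ d ℤ.+ l′ ℤ.* + e ℤ.+ D i)) × iB (+ d ℤ.+ l′ ℤ.* + e ℤ.+ D i) ∼ iB (+ d ℤ.+ D i) [ π ]
          denominator i i<k = iB-periodic l′ (shift (+ d) (l′ ℤ.* + e) (D i)) (e∤ i i<k)

        e≢0 : + e ≢ 0ℤ
        e≢0 eq = ℕ.<⇒≢ (ℕ.<-trans ℕ.z<s 1<e) (≡.sym (ℤ.+-injective eq))

        iB-e*B : ∀ {m} → + e ℤ.∣ m → O (iB (+ e) * B m)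
        iB-e*B {m} (divides l eq) with z , oz , eqz ← B-multiple l = O-resp (begin
          z                       ≈⟨ combine₁ (- z) (B-inverse e≢0) (solve 3 (λ z x b → z := x :* (z :* b) :+ :- z :* (b :* x :- :1)) z (iB (+ e)) (B (+ e))) ⟩
          iB (+ e) * (z * B (+ e))       ≈⟨ *-congˡ eqz ⟨
          iB (+ e) * B (l ℤ.* + e)       ≈⟨ *-congˡ (B-cong eq) ⟨
          iB (+ e) * B m                 ∎) oz

        -- The exponent is d (j + i + 1), a positive multiple of e, and `O-quotient` covers exactly
        -- the positive ones.
        B-e*iB : ∀ j i → + e ℤ.∣ + d ℤ.+ D j ℤ.+ D i → O (B (+ e) * iB (+ d ℤ.+ D j ℤ.+ D i))
        B-e*iB j i p with k , index ← positive-quotient (+ d ℤ.+ D j ℤ.+ D i) (d ℕ.* suc (j ℕ.+ i)) {{ℕ.m*n≢0 d (suc (j ℕ.+ i))}}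
          (≡.trans (≡.trans (≡.cong (λ x → x ℤ.+ D i) (≡.sym (D-suc j))) (≡.sym (D-+ (suc j) i))) (≡.sym (ℤ.pos-* d (suc (j ℕ.+ i))))) p =
          O-resp (*-congˡ (reflexive (≡.cong iB (≡.sym index)))) (O-quotient k)

        regroup-window : ∀ x b n n′ → b * x ≈ 1# → x * n * (b * n′) ≈ n * n′
        regroup-window x b n n′ e = combine₁ (n * n′) e
          (solve 4 (λ x b n n′ → x :* n :* (b :* n′) := n :* n′ :+ n :* n′ :* (b :* x :- :1)) x b n n′)

        -- A window of length e meets the multiples of e exactly once, both in
        -- the numerator and in the denominator.
        O-W-window : ∀ s j → O (W s (+ d ℤ.+ D j) e)
        O-W-window s j =
          let i , i<e , p = progression-hits s
              i′ , i′<e , p′ = progression-hits (+ d ℤ.+ D j)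
          in
          O-resp (trans (regroup-window (iB (+ e)) (B (+ e)) _ _ (B-inverse e≢0)) (sym (Π-* _ _ e)))
            (O-* (O-*Π (iB (+ e)) e i i<e (λ _ _ _ → O-B _) (iB-e*B p))
                 (O-*Π (B (+ e)) e i′ i′<e
                   (λ k k<e k≢i′ → O-iB (window-others (+ d ℤ.+ D j) i′<e k<e (λ i′≡k → k≢i′ (≡.sym i′≡k)) p′)) (B-e*iB j i′ p′)))

        O-fourth : ∀ {x} → O x → O (fourth x)
        O-fourth o = O-* (O-* o o) (O-* o o)

        ∼-fourth : ∀ {a x y} → O x → O y → x ∼ y [ a ] → fourth x ∼ fourth y [ a ]
        ∼-fourth ox oy e = ∼-* (O-* ox ox) (O-* oy oy) (∼-* ox oy e e) (∼-* ox oy e e)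

        D-multiple : ∀ J → D (J ℕ.* e) ≡ (+ d ℤ.* + J) ℤ.* + e
        D-multiple J = ≡.trans (≡.cong (λ x → + d ℤ.* x) (ℤ.pos-* J e)) (≡.sym (ℤ.*-assoc (+ d) (+ J) (+ e)))

        W-rest : ∀ s J r → r < e → let m = J ℕ.* e in
          O (W (s ℤ.+ D m) (+ d ℤ.+ D m) r) × W (s ℤ.+ D m) (+ d ℤ.+ D m) r ∼ W s (+ d) r [ π ]
        W-rest s J r r<e rewrite D-multiple J =
          W-periodic (s ℤ.+ + d ℤ.* + J ℤ.* + e) s (+ d ℤ.* + J) (+ d ℤ.* + J) r ≡.refl (ℕ.<⇒≤pred r<e)

        O-W-blocks : ∀ s J → O (W s (+ d) (J ℕ.* e))
        O-W-blocks s zero    = O-1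
        O-W-blocks s (suc J) = ≡.subst (λ k → O (W s (+ d) k)) (ℕ.+-comm (J ℕ.* e) e)
          (O-resp (sym (W-+ s (+ d) (J ℕ.* e) e)) (O-* (O-W-blocks s J) (O-W-window (s ℤ.+ D (J ℕ.* e)) (J ℕ.* e))))

        -- Full blocks are windows, and e divides no denominator exponent of the remaining factors
        -- up to periodicity. Hence the terms are integral even where (q^d;q^d)_k vanishes modulo π.
        O-W : ∀ s k → O (W s (+ d) k)
        O-W s k = ≡.subst (λ k → O (W s (+ d) k)) (≡.sym (≡.trans (ℕ.m≡m%n+[m/n]*n k e) (ℕ.+-comm (k ℕ.% e) _)))
          (O-resp (sym (W-+ s (+ d) (k ℕ./ e ℕ.* e) (k ℕ.% e)))
            (O-* (O-W-blocks s (k ℕ./ e)) (proj₁ (W-rest s (k ℕ./ e) (k ℕ.% e) (ℕ.m%n<n k e)))))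

        O-weight : ∀ t k → O (weight t k)
        O-weight t k = O-* (O-* (O-B _) O-iB-1) (O-E _)

        O-term : ∀ t k → O (term t k)
        O-term t k = O-* (O-weight t k) (O-fourth (O-W t k))

        ∼-weight : ∀ {t t₁ k k₁} l l′ → + 2 ℤ.* D k ℤ.+ t ≡ + 2 ℤ.* D k₁ ℤ.+ t₁ ℤ.+ l ℤ.* + e →
          (+ d ℤ.- + 2 ℤ.* t) ℤ.* + k ≡ (+ d ℤ.- + 2 ℤ.* t₁) ℤ.* + k₁ ℤ.+ l′ ℤ.* + e → weight t k ∼ weight t₁ k₁ [ π ]
        ∼-weight l l′ eq eq′ = ∼-* (O-* (O-B _) O-iB-1) (O-E _) (∼-* (O-B _) O-iB-1 (B-periodic l eq) ∼-refl) (E-periodic l′ eq′)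

        -- The first J e factors of `W` split off, while the weight and the other factors are
        -- periodic. What is split off depends on J only, so it can be taken out of the sum over a
        -- block.
        term-block : ∀ t J r → r < e → term t (J ℕ.* e ℕ.+ r) ∼ fourth (W t (+ d) (J ℕ.* e)) * term t r [ π ]
        term-block t J r r<e = ∼-trans
          (∼-* (O-weight t (m ℕ.+ r)) (O-fourth (O-* (O-W t m) (O-W t r)))
            (∼-weight (+ 2 ℤ.* (+ d ℤ.* + J)) ((+ d ℤ.- + 2 ℤ.* t) ℤ.* + J)
              (≡.trans (≡.cong (λ x → + 2 ℤ.* x ℤ.+ t) (≡.trans (D-+ m r) (≡.cong (λ x → x ℤ.+ D r) (D-multiple J))))
                (shift (+ d ℤ.* + J) (D r) (+ e) t))
              (≡.trans (≡.cong (λ x → (+ d ℤ.- + 2 ℤ.* t) ℤ.* (x ℤ.+ + r)) (ℤ.pos-* J e))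
                (shift′ (+ d ℤ.- + 2 ℤ.* t) (+ J) (+ r) (+ e))))
            (∼-trans (∼-fourth (O-W t (m ℕ.+ r)) (O-* (O-W t m) (proj₁ rest)) (∼-reflexive (W-+ t (+ d) m r)))
              (∼-fourth (O-* (O-W t m) (proj₁ rest)) (O-* (O-W t m) (O-W t r)) (∼-* (O-W t m) (O-W t r) ∼-refl (proj₂ rest)))))
          (∼-reflexive (solve 3 (λ w x y → w :* ((x :* y) :* (x :* y) :* ((x :* y) :* (x :* y)))
            := (x :* x) :* (x :* x) :* (w :* ((y :* y) :* (y :* y)))) (weight t r) (W t (+ d) m) (W t (+ d) r)))
          where
          m = J ℕ.* e
          rest = W-rest t J r r<e
          shift : ∀ x y e t → + 2 ℤ.* (x ℤ.* e ℤ.+ y) ℤ.+ t ≡ + 2 ℤ.* y ℤ.+ t ℤ.+ + 2 ℤ.* x ℤ.* e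
          shift = solve-∀
          shift′ : ∀ a J r e → a ℤ.* (J ℤ.* e ℤ.+ r) ≡ a ℤ.* r ℤ.+ a ℤ.* J ℤ.* e
          shift′ = solve-∀

        module Residue (t : ℤ) (M : ℕ) (M<e : M < e) (l : ℤ) (t-residue : t ≡ ℤ.- D M ℤ.+ l ℤ.* + e) where

          -- The numerator of index M has exponent t + D M = l e.
          W-vanishes : ∀ {k} → M < k → k < e → W t (+ d) k ∼ 0# [ π ]
          W-vanishes {k} M<k k<e = ∼0-Π k M M<k (λ i i<k → O-* (O-B _) (O-iB (∤-denominator (ℕ.≤-<-trans i<k k<e))))
            (∼0-*ʳ (O-iB (∤-denominator (ℕ.≤-<-trans M<k k<e)))
              (∼-trans (∼-reflexive (B-cong (≡.trans (≡.cong (λ x → x ℤ.+ D M) t-residue) (cancel (D M) (l ℤ.* + e))))) (B-multiple∼0 l)))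
            where
            cancel : ∀ x y → ℤ.- x ℤ.+ y ℤ.+ x ≡ y
            cancel = solve-∀

          term-vanishes : ∀ {k} → M < k → k < e → term t k ∼ 0# [ π ]
          term-vanishes {k} M<k k<e = ∼0-*ˡ (O-weight t k) (∼0-*ˡ (O-* (O-W t k) (O-W t k)) (∼0-*ˡ (O-W t k) (W-vanishes M<k k<e)))

          -- With - D M in place of t the reflection is an exact identity; this is how
          -- `term-reflection` is brought to bear on t.
          term∼ : ∀ {k} → k ≤ M → term t k ∼ term (ℤ.- D M) k [ π ]
          term∼ {k} k≤M = ∼-* (O-weight t k) (O-fourth (O-W (ℤ.- D M) k))
            (∼-weight l (ℤ.- + 2 ℤ.* l ℤ.* + k)
              (≡.trans (≡.cong (λ x → + 2 ℤ.* D k ℤ.+ x) t-residue) (shift (D k) (ℤ.- D M) l (+ e)))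
              (≡.trans (≡.cong (λ x → (+ d ℤ.- + 2 ℤ.* x) ℤ.* + k) t-residue) (shift′ (+ d) (ℤ.- D M) l (+ k) (+ e))))
            (∼-fourth (O-W t k) (O-W (ℤ.- D M) k)
              (≡.subst (λ s → W t s k ∼ W (ℤ.- D M) (+ d) k [ π ]) (ℤ.+-identityʳ (+ d)) (proj₂ (W-periodic t (ℤ.- D M) l 0ℤ k t-residue (ℕ.<⇒≤pred (ℕ.≤-<-trans k≤M M<e))))))
            where
            shift : ∀ x s l e → + 2 ℤ.* x ℤ.+ (s ℤ.+ l ℤ.* e) ≡ + 2 ℤ.* x ℤ.+ s ℤ.+ l ℤ.* e
            shift = solve-∀
            shift′ : ∀ d s l k e → (d ℤ.- + 2 ℤ.* (s ℤ.+ l ℤ.* e)) ℤ.* k ≡ (d ℤ.- + 2 ℤ.* s) ℤ.* k ℤ.+ ℤ.- + 2 ℤ.* l ℤ.* k ℤ.* e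
            shift′ = solve-∀

          term-antisymmetric : ∀ i j → i ℕ.+ j ≡ M → term t i ∼ - term t j [ π ]
          term-antisymmetric i j ≡.refl = ∼-trans (∼-trans (term∼ (ℕ.m≤m+n i j)) (∼-reflexive (term-reflection i j)))
            (∼-neg (∼-sym (term∼ (ℕ.m≤n+m j i))))

          initial-sum : Σ< (suc M) (term t) ∼ 0# [ π ]
          initial-sum = antisymmetric-sum O-h h+h≈1 M term-antisymmetric

          period-sum : Σ< e (term t) ∼ 0# [ π ]
          period-sum = ≡.subst (λ n → Σ< n (term t) ∼ 0# [ π ]) (ℕ.m+[n∸m]≡n M<e)
            (∼-trans (∼-reflexive (Σ-split (term t) (suc M) (e ℕ.∸ suc M))) (∼-trans (∼-+ initial-sum rest) (∼-reflexive (+-identityʳ 0#))))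
            where
            rest : Σ< (e ℕ.∸ suc M) (λ i → term t (suc M ℕ.+ i)) ∼ 0# [ π ]
            rest = ∼-trans (∼-Σ (e ℕ.∸ suc M) λ i i<e-M → term-vanishes (ℕ.m≤m+n (suc M) i)
                     (ℕ.<-≤-trans (ℕ.+-monoʳ-< (suc M) i<e-M) (ℕ.≤-reflexive (ℕ.m+[n∸m]≡n M<e))))
              (∼-reflexive (Σ-0 _ (e ℕ.∸ suc M) λ _ _ → refl))

          block-sum : ∀ J n → n ≤ e → Σ< n (term t) ∼ 0# [ π ] → Σ< n (λ r → term t (J ℕ.* e ℕ.+ r)) ∼ 0# [ π ]
          block-sum J n n≤e z = ∼-trans (∼-Σ n λ r r<n → term-block t J r (ℕ.<-≤-trans r<n n≤e))
            (∼-trans (∼-reflexive (sym (*-Σ _ (term t) n))) (∼0-*ˡ (O-fourth (O-W t (J ℕ.* e))) z))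

          full-sum : ∀ J → Σ< (J ℕ.* e) (term t) ∼ 0# [ π ]
          -- The piece after the full blocks has length M + 1 in the sum up to N and length e in the
          -- induction step of `full-sum`.
          extended-sum : ∀ J n → n ≤ e → Σ< n (term t) ∼ 0# [ π ] → Σ< (J ℕ.* e ℕ.+ n) (term t) ∼ 0# [ π ]

          extended-sum J n n≤e z = ∼-trans (∼-reflexive (Σ-split (term t) (J ℕ.* e) n))
            (∼-trans (∼-+ (full-sum J) (block-sum J n n≤e z)) (∼-reflexive (+-identityʳ 0#)))

          full-sum zero    = ∼-refl
          full-sum (suc J) = ≡.subst (λ n → Σ< n (term t) ∼ 0# [ π ]) (ℕ.+-comm (J ℕ.* e) e) (extended-sum J e ℕ.≤-refl period-sum)

        module PartialSums (t : ℤ) (n N : ℕ) (n-eq : + n ≡ t ℤ.+ D N) (e∣n : e ℕ.∣ n) where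

          private
            M J κ : ℕ
            M = N ℕ.% e
            J = N ℕ./ e
            κ = ℕ._∣_.quotient e∣n

            n≡κe : + n ≡ + κ ℤ.* + e
            n≡κe = ≡.trans (≡.cong +_ (ℕ._∣_.equality e∣n)) (ℤ.pos-* κ e)

            N-eq : N ≡ J ℕ.* e ℕ.+ M
            N-eq = ≡.trans (ℕ.m≡m%n+[m/n]*n N e) (ℕ.+-comm M (J ℕ.* e))

            -- t = n - dN with n = κ e and N = J e + M.
            residue : t ≡ ℤ.- D M ℤ.+ (+ κ ℤ.- + d ℤ.* + J) ℤ.* + e
            residue = ≡.trans (≡.trans (cancel t (D N)) (≡.cong₂ (λ x y → x ℤ.- y)
                (≡.trans (≡.sym n-eq) n≡κe)
                (≡.trans (≡.cong D N-eq) (≡.trans (D-+ (J ℕ.* e) M) (≡.cong (λ x → x ℤ.+ D M) (D-multiple J))))))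
              (collect (+ κ) (+ e) (+ d ℤ.* + J) (D M))
              where
              cancel : ∀ t x → t ≡ t ℤ.+ x ℤ.- x
              cancel = solve-∀
              collect : ∀ q e y x → q ℤ.* e ℤ.- (y ℤ.* e ℤ.+ x) ≡ ℤ.- x ℤ.+ (q ℤ.- y) ℤ.* e
              collect = solve-∀

            closed-form∼0 : closed-form t n N ∼ 0# [ π ]
            closed-form∼0 = ∼0-*ʳ (O-E _) (∼0-*ˡ (O-W (+ 2 ℤ.* t) N) (∼0-*ʳ O-iB-1
              (≡.subst (λ m → B m ∼ 0# [ π ]) (≡.sym n≡κe) (B-multiple∼0 (+ κ)))))

          open Residue t M (ℕ.m%n<n N e) (+ κ ℤ.- + d ℤ.* + J) residue

          short-sum : Σ< (suc N) (term t) ∼ closed-form t n N [ π ]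
          short-sum = ∼-trans
            (≡.subst (λ m → Σ< m (term t) ∼ 0# [ π ]) (≡.trans (ℕ.+-suc (J ℕ.* e) M) (≡.cong suc (≡.sym N-eq)))
              (extended-sum J (suc M) (ℕ.m%n<n N e) initial-sum)) (∼-sym closed-form∼0)

          long-sum : Σ< n (term t) ∼ closed-form t n N [ π ]
          long-sum = ∼-trans
            (≡.subst (λ m → Σ< m (term t) ∼ 0# [ π ]) (≡.sym (ℕ._∣_.equality e∣n)) (full-sum κ)) (∼-sym closed-form∼0)

        -- Both sums modulo the cube, with e in the role of n

        module PartialSumsCubed (O-π : O π)
          (t : ℤ) (M : ℕ) (M<e : M < e) (e-eq : + e ≡ t ℤ.+ D M)
          (t+D≢0 : ∀ k → t ℤ.+ D k ≢ 0ℤ)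
          (d-e+D≢0 : ∀ k → + d ℤ.- + e ℤ.+ D k ≢ 0ℤ)
          where

          open ExactSum t e M e-eq t+D≢0 d-e+D≢0

          private
            ν : ℤ
            ν = + e

          t-residue : t ≡ ℤ.- D M ℤ.+ 1ℤ ℤ.* ν
          t-residue = ≡.trans (lemma t (D M)) (≡.cong (λ x → ℤ.- D M ℤ.+ 1ℤ ℤ.* x) (≡.sym e-eq))
            where
            lemma : ∀ t x → t ≡ ℤ.- x ℤ.+ 1ℤ ℤ.* (t ℤ.+ x)
            lemma = solve-∀

          open Residue t M M<e 1ℤ t-residue

          -- Chosen so that B (m + ν) B (m - ν) = (B m)² - E m ε.
          ε : Carrier
          ε = B ν * B ν * E (ℤ.- ν)

          ε∼0 : ε ∼ 0# [ π * π ]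
          ε∼0 = ∼0-*ʳ (O-E _) (∼0-*-∼0 B-e∼0 B-e∼0)

          ε*ε∼0 : ε * ε ∼ 0# [ π * π * π ]
          ε*ε∼0 = let multiple z oz eq = ∼0-*-∼0 ε∼0 ε∼0 in
            ∼-weaken O-π (multiple z oz (trans eq (+-congˡ (*-congʳ (sym (*-assoc (π * π) π π))))))

          O-ε : O ε
          O-ε = O-* (O-* (O-B ν) (O-B ν)) (O-E _)

          B-shift : ∀ {m a b} → a ≡ m ℤ.+ ν → b ≡ m ℤ.- ν → B a * B b ≈ B m * B m - E m * ε
          B-shift {m} ≡.refl ≡.refl = begin
            B (m ℤ.+ ν) * B (m ℤ.- ν)
              ≈⟨ *-cong (+-congˡ (-‿cong (E-+ m ν))) (+-congˡ (-‿cong (E-+ m (ℤ.- ν)))) ⟩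
            (1# - x * y) * (1# - x * z)
              ≈⟨ combine₁ (x * x - x - x + x * y) (E-inverse ν) (solve 3 (λ x y z →
                     (:1 :- x :* y) :* (:1 :- x :* z) := (:1 :- x) :* (:1 :- x) :- x :* ((:1 :- y) :* (:1 :- y) :* z)
                       :+ (x :* x :- x :- x :+ x :* y) :* (y :* z :- :1)) x y z) ⟩
            B m * B m - E m * ε ∎
            where
            x = E m
            y = E ν
            z = E (ℤ.- ν)

          -- By the choice of ε, B (m + ν) B (m - ν) is (B m)² (1 - g m ε) wherever 1 - q^m is
          -- invertible: `g` is the first-order response to the perturbation.
          g : ℤ → Carrier
          g m = E m * (iB m * iB m)

          O-g : ∀ {m} → ¬ (ν ℤ.∣ m) → O (g m)
          O-g p = O-* (O-E _) (O-* (O-iB p) (O-iB p))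

          g-periodic : ∀ {m n} l → m ≡ n ℤ.+ l ℤ.* ν → ¬ (ν ℤ.∣ n) → g m ∼ g n [ π ]
          g-periodic l eq p = let oi , i∼ = iB-periodic l eq p in
            ∼-* (O-E _) (O-* (O-iB p) (O-iB p)) (E-periodic l eq) (∼-* oi (O-iB p) i∼ i∼)

          g-neg : ∀ {m} → m ≢ 0ℤ → g (ℤ.- m) ≈ g m
          g-neg {m} m≢0 = begin
            y * (j * j)
              ≈⟨ *-congˡ (*-cong j≈ j≈) ⟩
            y * (- (x * i) * - (x * i))
              ≈⟨ combine₁ (x * (i * i)) (E-inverse m) (solve 3 (λ x y i → y :* (:- (x :* i) :* :- (x :* i)) := x :* (i :* i) :+ x :* (i :* i) :* (x :* y :- :1)) x y i) ⟩
            x * (i * i) ∎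
            where
            x = E m
            y = E (ℤ.- m)
            i = iB m
            j = iB (ℤ.- m)
            j≈ : j ≈ - (x * i)
            j≈ = *-cancelʳ-invertible {v = j} (B-inverse -m≢0) (trans (trans (*-comm _ _) (B-inverse -m≢0)) (sym (begin
              - (x * i) * B (ℤ.- m)
                ≈⟨ *-congˡ (B-neg m) ⟩
              - (x * i) * - (y * B m)
                ≈⟨ combine₂ (B m * i) (E-inverse m) 1# (B-inverse m≢0) (solve 4 (λ x i y b → :- (x :* i) :* :- (y :* b)
                     := :1 :+ b :* i :* (x :* y :- :1) :+ :1 :* (b :* i :- :1)) x i y (B m)) ⟩
              1# ∎)))
              where
              -m≢0 : ℤ.- m ≢ 0ℤ
              -m≢0 eq = m≢0 (ℤ.neg-injective eq)

          -- The first-order coefficient of `perturbed i` relative to the square of `plain i`: the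
          -- denominator counts positively, the numerator negatively.
          δ : ℕ → Carrier
          δ i = g (+ d ℤ.+ D i) - g (t ℤ.+ D i)

          η : ℕ → Carrier
          η k = Σ< k δ

          -- Among the e exponents t + D i with i < e there is a single multiple of e, and t + D M =
          -- e is it.
          ∤-upper : ∀ {i} → i < M → ¬ (ν ℤ.∣ t ℤ.+ D i)
          ∤-upper i<M = window-others t M<e (ℕ.<-trans i<M M<e) (λ M≡i → ℕ.<⇒≢ i<M (≡.sym M≡i))
            (divides 1ℤ (≡.trans (≡.sym e-eq) (≡.sym (ℤ.*-identityˡ ν))))

          ∤-lower : ∀ {i} → i < M → ¬ (ν ℤ.∣ + d ℤ.+ D i)
          ∤-lower i<M = ∤-denominator (ℕ.≤-<-trans i<M M<e)

          O-δ : ∀ {i} → i < M → O (δ i)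
          O-δ i<M = O-+ (O-g (∤-lower i<M)) (O-neg (O-g (∤-upper i<M)))

          -- The remainder in the expansion of (P - p X) / (Q - s X) is kept exactly, as a visible
          -- multiple of X², which dies modulo π³ for X = ε.
          first-order : ∀ {P p Q s jT jQ X j} → (Q - s * X) * j ≈ 1# → P * jT ≈ 1# → Q * jQ ≈ 1# →
            (P - p * X) * j ≈ P * jQ * (1# + X * (s * jQ - p * jT)) + X * X * (j * P * s * jQ * (s * jQ - p * jT))
          first-order {P} {p} {Q} {s} {jT} {jQ} {X} {j} r₁ r₂ r₃ = combine₃
            (P * jQ * (1# + X * (s * jQ - p * jT))) r₁ (j * X * p) r₂ (- (j * P * (1# + X * (s * jQ - p * jT)))) r₃
            (solve 8 (λ P p Q s jT jQ X j → (P :- p :* X) :* j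
              := P :* jQ :* (:1 :+ X :* (s :* jQ :- p :* jT)) :+ X :* X :* (j :* P :* s :* jQ :* (s :* jQ :- p :* jT))
               :+ P :* jQ :* (:1 :+ X :* (s :* jQ :- p :* jT)) :* ((Q :- s :* X) :* j :- :1)
               :+ j :* X :* p :* (P :* jT :- :1)
               :+ :- (j :* P :* (:1 :+ X :* (s :* jQ :- p :* jT))) :* (Q :* jQ :- :1)) P p Q s jT jQ X j)

          plain perturbed : ℕ → Carrier
          plain i = B (t ℤ.+ D i) * iB (+ d ℤ.+ D i)
          perturbed i = (B (t ℤ.+ ν ℤ.+ D i) * iB (+ d ℤ.+ ν ℤ.+ D i)) * (B (t ℤ.- ν ℤ.+ D i) * iB (+ d ℤ.- ν ℤ.+ D i))

          O-plain : ∀ {i} → i < M → O (plain i)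
          O-plain i<M = O-* (O-B _) (O-iB (∤-lower i<M))

          shift⁺ : ∀ a x y → a ℤ.+ x ℤ.+ y ≡ a ℤ.+ y ℤ.+ x
          shift⁺ = solve-∀

          shift⁻ : ∀ a x y → a ℤ.- x ℤ.+ y ≡ a ℤ.+ y ℤ.- x
          shift⁻ = solve-∀

          perturbed∼ : ∀ {i} → i < M → O (perturbed i) × perturbed i ∼ plain i * plain i * (1# + ε * δ i) [ π * π * π ]
          perturbed∼ {i} i<M = O-* (O-* (O-B _) (O-iB p⁺)) (O-* (O-B _) (O-iB p⁻)) ,
            ∼-trans (∼-reflexive expansion)
              (∼-trans (∼-+ ∼-refl (∼0-*ʳ (O-* (O-* (O-* (O-* (O-* (O-iB p⁺) (O-iB p⁻)) (O-* (O-B T) (O-B T))) (O-E U)) (O-* (O-iB (∤-lower i<M)) (O-iB (∤-lower i<M))))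
                  (O-δ i<M)) ε*ε∼0))
                (∼-reflexive (solve 4 (λ b i ε δ → b :* b :* (i :* i) :* (:1 :+ ε :* δ) :+ :0 := b :* i :* (b :* i) :* (:1 :+ ε :* δ))
                  (B T) (iB U) ε (δ i))))
            where
            T = t ℤ.+ D i
            U = + d ℤ.+ D i
            p⁺ : ¬ (ν ℤ.∣ + d ℤ.+ ν ℤ.+ D i)
            p⁺ p = ∤-lower i<M (∣-+-multiple 1ℤ (≡.subst (λ x → ν ℤ.∣ x) (≡.trans (shift⁺ (+ d) ν (D i)) (≡.cong (λ x → U ℤ.+ x) (≡.sym (ℤ.*-identityˡ ν)))) p))
            p⁻ : ¬ (ν ℤ.∣ + d ℤ.- ν ℤ.+ D i)
            p⁻ p = ∤-lower i<M (∣-+-multiple (ℤ.- 1ℤ) (≡.subst (λ x → ν ℤ.∣ x) (≡.trans (shift⁻ (+ d) ν (D i)) (≡.cong (λ x → U ℤ.+ x) (≡.sym (ℤ.-1*i≡-i ν)))) p))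
            j = iB (+ d ℤ.+ ν ℤ.+ D i) * iB (+ d ℤ.- ν ℤ.+ D i)
            square-inverse : ∀ {x y} → x * y ≈ 1# → x * x * (y * y) ≈ 1#
            square-inverse {x} {y} e = trans (solve 2 (λ x y → x :* x :* (y :* y) := x :* y :* (x :* y)) x y) (trans (*-cong e e) (*-identityˡ 1#))
            expansion : perturbed i ≈ B T * B T * (iB U * iB U) * (1# + ε * δ i) + ε * ε * (j * (B T * B T) * E U * (iB U * iB U) * δ i)
            expansion = begin
              perturbed i
                ≈⟨ solve 4 (λ a b c d → a :* b :* (c :* d) := a :* c :* (b :* d)) _ _ _ _ ⟩
              B (t ℤ.+ ν ℤ.+ D i) * B (t ℤ.- ν ℤ.+ D i) * j
                ≈⟨ *-congʳ (B-shift (shift⁺ t ν (D i)) (shift⁻ t ν (D i))) ⟩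
              (B T * B T - E T * ε) * j
                ≈⟨ first-order (begin
                     (B U * B U - E U * ε) * j
                       ≈⟨ *-congʳ (B-shift (shift⁺ (+ d) ν (D i)) (shift⁻ (+ d) ν (D i))) ⟨
                     B (+ d ℤ.+ ν ℤ.+ D i) * B (+ d ℤ.- ν ℤ.+ D i) * j
                       ≈⟨ solve 4 (λ a b c d → a :* c :* (b :* d) := a :* b :* (c :* d)) _ _ _ _ ⟩
                     _
                       ≈⟨ *-cong (B-inverse (∤⇒≢0 p⁺)) (B-inverse (∤⇒≢0 p⁻)) ⟩
                     1# * 1#
                       ≈⟨ *-identityˡ 1# ⟩
                     1# ∎)
                     (square-inverse (B-inverse (∤⇒≢0 (∤-upper i<M))))
                     (square-inverse (B-inverse (∤⇒≢0 (∤-lower i<M)))) ⟩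
              B T * B T * (iB U * iB U) * (1# + ε * δ i) + ε * ε * (j * (B T * B T) * E U * (iB U * iB U) * δ i) ∎

          O-η : ∀ {k} → k ≤ M → O (η k)
          O-η {k} k≤M = O-Σ k λ i i<k → O-δ (ℕ.<-≤-trans i<k k≤M)

          O-perturbed-product : ∀ {k} → k ≤ M → O (Π< k perturbed)
          O-perturbed-product {k} k≤M = O-Π k λ i i<k → proj₁ (perturbed∼ (ℕ.<-≤-trans i<k k≤M))

          -- Multiplying the factors adds their first-order coefficients; the mixed terms carry ε²,
          -- a multiple of π⁴.
          product∼ : ∀ k → k ≤ M → Π< k perturbed ∼ W t (+ d) k * W t (+ d) k * (1# + ε * η k) [ π * π * π ]
          product∼ zero    _   = ∼-reflexive (solve 1 (λ ε → :1 := :1 :* :1 :* (:1 :+ ε :* :0)) ε)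
          product∼ (suc k) k<M = ∼-trans
            (∼-* (O-perturbed-product (ℕ.<⇒≤ k<M))
              (O-* (O-* (O-plain k<M) (O-plain k<M)) (O-+ O-1 (O-* O-ε (O-δ k<M)))) (product∼ k (ℕ.<⇒≤ k<M)) (proj₂ (perturbed∼ k<M)))
            (∼-trans (∼-reflexive (solve 5 (λ w b ε η δ → w :* w :* (:1 :+ ε :* η) :* (b :* b :* (:1 :+ ε :* δ))
                := w :* b :* (w :* b) :* (:1 :+ ε :* (η :+ δ)) :+ w :* b :* (w :* b) :* (η :* δ) :* (ε :* ε))
                (W t (+ d) k) (plain k) ε (η k) (δ k)))
              (∼-trans (∼-+ ∼-refl (∼0-*ˡ (O-* (O-* w w) (O-* (O-η (ℕ.<⇒≤ k<M)) (O-δ k<M))) ε*ε∼0)) (∼-reflexive (+-identityʳ _))))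
            where
            w : O (W t (+ d) (suc k))
            w = O-W t (suc k)

          perturbed-term∼ : ∀ k → k ≤ M → perturbed-term k ∼ term t k + ε * (term t k * η k) [ π * π * π ]
          perturbed-term∼ k k≤M = ∼-trans
            (∼-* (O-weight t k) (O-* (O-* w w) (O-* (O-* w w) (O-+ O-1 (O-* O-ε (O-η k≤M))))) ∼-refl
              (∼-* (O-* w w) (O-* (O-* w w) (O-+ O-1 (O-* O-ε (O-η k≤M)))) ∼-refl
                (∼-trans (∼-reflexive (sym (Π-* _ _ k))) (product∼ k k≤M))))
            (∼-reflexive (solve 4 (λ v w ε η → v :* (w :* w :* (w :* w :* (:1 :+ ε :* η)))
              := v :* (w :* w :* (w :* w)) :+ ε :* (v :* (w :* w :* (w :* w)) :* η)) (weight t k) (W t (+ d) k) ε (η k)))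
            where
            w : O (W t (+ d) k)
            w = O-W t k

          H : ℕ → Carrier
          H k = Σ< k λ i → g (+ d ℤ.+ D i)

          -- t + D i = ν - (d + D j), while `g` is even and, modulo π, has period ν.
          g-reflection : ∀ i j → suc (i ℕ.+ j) ≡ M → g (t ℤ.+ D i) ∼ g (+ d ℤ.+ D j) [ π ]
          g-reflection i j eq = ∼-trans (g-periodic 1ℤ index p) (∼-reflexive (g-neg (d+D≢0 j)))
            where
            index : t ℤ.+ D i ≡ ℤ.- (+ d ℤ.+ D j) ℤ.+ 1ℤ ℤ.* ν
            index = ≡.trans (lemma t (+ d) (+ i) (+ j)) (≡.cong (λ x → ℤ.- (+ d ℤ.+ D j) ℤ.+ 1ℤ ℤ.* x)
              (≡.trans (≡.cong (λ m → t ℤ.+ D m) eq) (≡.sym e-eq)))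
              where
              lemma : ∀ t d i j → t ℤ.+ d ℤ.* i ≡ ℤ.- (d ℤ.+ d ℤ.* j) ℤ.+ 1ℤ ℤ.* (t ℤ.+ d ℤ.* (1ℤ ℤ.+ (i ℤ.+ j)))
              lemma = solve-∀
            p : ¬ (ν ℤ.∣ ℤ.- (+ d ℤ.+ D j))
            p (divides q eq′) = ∤-lower (ℕ.≤-trans (s≤s (ℕ.m≤n+m j i)) (ℕ.≤-reflexive eq)) (divides (ℤ.- q)
              (≡.trans (≡.sym (ℤ.neg-involutive _)) (≡.trans (≡.cong (λ x → ℤ.- x) eq′) (ℤ.neg-distribˡ-* q ν))))

          -- By `g-reflection` the values g (t + D i) with i < k are the summands of `H M` from
          -- index m on. The resulting expression is symmetric in k and m, while the terms are
          -- antisymmetric.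
          η∼ : ∀ k m → k ℕ.+ m ≡ M → η k ∼ H k + H m - H M [ π ]
          η∼ zero    m ≡.refl = ∼-reflexive (solve 1 (λ h → :0 := :0 :+ h :- h) (H m))
          η∼ (suc k) m eq     = ∼-trans
            (∼-+ (η∼ k (suc m) (≡.trans (ℕ.+-suc k m) eq)) (∼-+ ∼-refl (∼-neg (g-reflection k m eq))))
            (∼-reflexive (solve 5 (λ h h′ hM x y → h :+ (h′ :+ y) :- hM :+ (x :- y) := h :+ x :+ h′ :- hM)
              (H k) (H m) (H M) (g (+ d ℤ.+ D k)) (g (+ d ℤ.+ D m))))

          correction∼0 : Σ< (suc M) (λ k → term t k * η k) ∼ 0# [ π ]
          correction∼0 = antisymmetric-sum O-h h+h≈1 M λ i j eq →
            ∼-trans (∼-* (O-term t i) (O-η (ℕ.≤-trans (ℕ.m≤n+m j i) (ℕ.≤-reflexive eq))) (term-antisymmetric i j eq)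
              (∼-trans (η∼ i j eq) (∼-trans (∼-reflexive (+-congʳ (+-comm (H i) (H j)))) (∼-sym (η∼ j i (≡.trans (ℕ.+-comm j i) eq))))))
            (∼-reflexive (solve 2 (λ x y → :- x :* y := :- (x :* y)) (term t j) (η j)))

          -- The closed form is the perturbed sum, so the congruence is read from right to left: ε
          -- supplies π² and the sum of the corrections the third π.
          short-sum : Σ< (suc M) (term t) ∼ closed-form t e M [ π * π * π ]
          short-sum = ∼-sym (∼-trans (∼-reflexive (sym perturbed-sum))
            (∼-trans (∼-Σ (suc M) λ k k≤M → perturbed-term∼ k (ℕ.≤-pred k≤M))
            (∼-trans (∼-reflexive (trans (Σ-+ _ _ (suc M)) (+-congˡ (sym (*-Σ ε _ (suc M))))))
            (∼-trans (∼-+ ∼-refl (∼0-*-∼0 ε∼0 correction∼0)) (∼-reflexive (+-identityʳ _))))))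

          -- `W` is a multiple of π there and enters to the fourth power.
          tail-vanishes : ∀ {k} → M < k → k < e → term t k ∼ 0# [ π * π * π ]
          tail-vanishes {k} M<k k<e = ∼0-*ˡ (O-weight t k) (let multiple z oz eq = ∼0-*-∼0 (∼0-*-∼0 w w) (∼0-*-∼0 w w) in
            ∼-weaken O-π (multiple z oz (trans eq (+-congˡ (*-congʳ (sym (*-assoc (π * π) π π)))))))
            where
            w : W t (+ d) k ∼ 0# [ π ]
            w = W-vanishes M<k k<e

          long-sum : Σ< e (term t) ∼ closed-form t e M [ π * π * π ]
          long-sum = ≡.subst (λ n → Σ< n (term t) ∼ closed-form t e M [ π * π * π ]) (ℕ.m+[n∸m]≡n M<e)
            (∼-trans (∼-reflexive (Σ-split (term t) (suc M) (e ℕ.∸ suc M)))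
              (∼-trans (∼-+ short-sum rest) (∼-reflexive (+-identityʳ _))))
            where
            rest : Σ< (e ℕ.∸ suc M) (λ i → term t (suc M ℕ.+ i)) ∼ 0# [ π * π * π ]
            rest = ∼-trans (∼-Σ (e ℕ.∸ suc M) λ i i<e-M → tail-vanishes (ℕ.m≤m+n (suc M) i)
                     (ℕ.<-≤-trans (ℕ.+-monoʳ-< (suc M) i<e-M) (ℕ.≤-reflexive (ℕ.m+[n∸m]≡n M<e))))
              (∼-reflexive (Σ-0 _ (e ℕ.∸ suc M) λ _ _ → refl))

-- Comaximal elements and divisibility

module Comaximality {c ℓ} (R : CommutativeRing c ℓ) where

  open CommutativeRing R
  open RingSolver R
  open RingKit R

  Comaximal : Carrier → Carrier → Set _
  Comaximal a b = ∃₂ λ u v → u * a + v * b ≈ 1#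

  infix 4 _∣ᴿ_
  _∣ᴿ_ : Carrier → Carrier → Set _
  a ∣ᴿ b = ∃ λ k → k * a ≈ b

  divides-refl : ∀ {a} → a ∣ᴿ a
  divides-refl = 1# , *-identityˡ _

  divides-trans : ∀ {a b c} → a ∣ᴿ b → b ∣ᴿ c → a ∣ᴿ c
  divides-trans {a} (k , e) (l , e′) = l * k , trans (*-assoc l k a) (trans (*-congˡ e) e′)

  divides-resp : ∀ {a b c} → b ≈ c → a ∣ᴿ b → a ∣ᴿ c
  divides-resp e (k , e′) = k , trans e′ e

  divides-*ˡ : ∀ {a b} c → a ∣ᴿ b → a ∣ᴿ c * b
  divides-*ˡ {a} c (k , e) = c * k , trans (*-assoc c k a) (*-congˡ e)

  divides-* : ∀ {a b c d} → a ∣ᴿ b → c ∣ᴿ d → a * c ∣ᴿ b * d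
  divides-* {a} {b} {c} {d} (k , e) (l , e′) = k * l ,
    trans (solve 4 (λ k l a c → k :* l :* (a :* c) := k :* a :* (l :* c)) k l a c) (*-cong e e′)

  divides-Π : ∀ {f g} n → (∀ i → i < n → f i ∣ᴿ g i) → Π< n f ∣ᴿ Π< n g
  divides-Π zero    e = divides-refl
  divides-Π (suc n) e = divides-* (divides-Π n λ i i<n → e i (ℕ.m<n⇒m<1+n i<n)) (e n (ℕ.n<1+n n))

  comaximal-sym : ∀ {a b} → Comaximal a b → Comaximal b a
  comaximal-sym (u , v , e) = v , u , trans (+-comm _ _) e

  comaximal-1 : ∀ {a} → Comaximal a 1#
  comaximal-1 {a} = 0# , 1# , solve 1 (λ a → :0 :* a :+ :1 :* :1 := :1) a

  comaximal-* : ∀ {a b c} → Comaximal a b → Comaximal a c → Comaximal a (b * c)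
  comaximal-* {a} {b} {c} (u , v , e) (u′ , v′ , e′) = u * u′ * a + u * v′ * c + v * b * u′ , v * v′ ,
    trans (solve 7 (λ a b c u v u′ v′ → (u :* u′ :* a :+ u :* v′ :* c :+ v :* b :* u′) :* a :+ v :* v′ :* (b :* c)
        := (u :* a :+ v :* b) :* (u′ :* a :+ v′ :* c)) a b c u v u′ v′)
      (trans (*-cong e e′) (*-identityˡ 1#))

  comaximal-Π : ∀ {a f} n → (∀ i → i < n → Comaximal a (f i)) → Comaximal a (Π< n f)
  comaximal-Π zero    e = comaximal-1
  comaximal-Π (suc n) e = comaximal-* (comaximal-Π n λ i i<n → e i (ℕ.m<n⇒m<1+n i<n)) (e n (ℕ.n<1+n n))

  -- In c = u a c + v b c, use b ∣ c in the first summand and a ∣ c in the second.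
  comaximal⇒*-divides : ∀ {a b c} → Comaximal a b → a ∣ᴿ c → b ∣ᴿ c → a * b ∣ᴿ c
  comaximal⇒*-divides {a} {b} {c} (u , v , e) (k , ek) (l , el) = u * l + v * k , combine₃ c e (v * b) ek (u * a) el
    (solve 7 (λ a b c u v k l → (u :* l :+ v :* k) :* (a :* b) := c :+ c :* (u :* a :+ v :* b :- :1)
      :+ v :* b :* (k :* a :- c) :+ u :* a :* (l :* b :- c)) a b c u v k l)

-- The elements x^m - 1 and their cyclotomic factors

module PowersMinusOne {c ℓ} (R : CommutativeRing c ℓ) (x : CommutativeRing.Carrier R) where

  open CommutativeRing R
  open RingSolver R
  open RingKit R
  open Comaximality R
  open Algebra.Properties.Semiring.Exp semiring using (_^_; ^-homo-*)
  open Algebra.Definitions.RawSemiring (RawRing.rawSemiring rawRing) public using () renaming (_×_ to _·_)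

  β : ℕ → Carrier
  β m = x ^ m - 1#

  β-+ : ∀ m n → β (m ℕ.+ n) ≈ x ^ m * β n + β m
  β-+ m n = trans (+-congʳ (^-homo-* x m n)) (solve 2 (λ a b → a :* b :- :1 := a :* (b :- :1) :+ (a :- :1)) (x ^ m) (x ^ n))

  geometric : ℕ → ℕ → Carrier
  geometric zero    m = 0#
  geometric (suc k) m = 1# + x ^ m * geometric k m

  geometric-* : ∀ k m → geometric k m * β m ≈ β (k ℕ.* m)
  geometric-* zero    m = solve 1 (λ b → :0 :* b := :1 :- :1) (β m)
  geometric-* (suc k) m = sym (trans (β-+ m (k ℕ.* m)) (combine₁ (- x ^ m) (geometric-* k m)
    (solve 4 (λ y g b b′ → y :* b′ :+ b := (:1 :+ y :* g) :* b :+ :- y :* (g :* b :- b′)) (x ^ m) (geometric k m) (β m) (β (k ℕ.* m)))))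

  β-∣ : ∀ {m n} k → n ≡ k ℕ.* m → β m ∣ᴿ β n
  β-∣ {m} k ≡.refl = geometric k m , geometric-* k m

  -- Each of the k powers of x^m is 1 modulo `β m`.
  geometric-mod : ∀ k m → ∃ λ v → geometric k m ≈ k · 1# + v * β m
  geometric-mod zero    m = 0# , solve 1 (λ b → :0 := :0 :+ :0 :* b) (β m)
  geometric-mod (suc k) m with v , e ← geometric-mod k m = x ^ m * v + k · 1# , combine₁ (x ^ m) e
    (solve 4 (λ y g v k → :1 :+ y :* g := :1 :+ k :+ (y :* v :+ k) :* (y :- :1) :+ y :* (g :- (k :+ v :* (y :- :1))))
      (x ^ m) (geometric k m) v (k · 1#))

  -- β (k m) = β (g + l n) = x^g β (l n) + β g, where β m divides the left side and β n divides β (l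
  -- n). Bézout identities in ℕ have this one-sided form, so both cases of `β-gcd` reduce to it.
  β-bézout : ∀ g m n k l → g ℕ.+ l ℕ.* n ≡ k ℕ.* m → β g ≈ geometric k m * β m + - x ^ g * geometric l n * β n
  β-bézout g m n k l eq = combine₃ 1# (trans (sym (β-+ g (l ℕ.* n))) (reflexive (≡.cong β eq)))
    (- 1#) (geometric-* k m) (x ^ g) (geometric-* l n)
    (solve 8 (λ b y s bm t bn bkm bln → b := s :* bm :+ :- y :* t :* bn
      :+ :1 :* (y :* bln :+ b :- bkm) :+ :- :1 :* (s :* bm :- bkm) :+ y :* (t :* bn :- bln))
      (β g) (x ^ g) (geometric k m) (β m) (geometric l n) (β n) (β (k ℕ.* m)) (β (l ℕ.* n)))

  β-gcd : ∀ m n → ∃₂ λ u v → β (ℕ.gcd m n) ≈ u * β m + v * β n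
  β-gcd m n with ℕ.Bézout.identity (ℕ.gcd-GCD m n)
  ... | ℕ.Bézout.+- k l eq = _ , _ , β-bézout (ℕ.gcd m n) m n k l eq
  ... | ℕ.Bézout.-+ k l eq = _ , _ , trans (β-bézout (ℕ.gcd m n) n m l k eq) (+-comm _ _)

  comaximal-via-gcd : ∀ {p r} m n → p ∣ᴿ β m → r ∣ᴿ β n → Comaximal p (β (ℕ.gcd m n)) → Comaximal p r
  comaximal-via-gcd {p} {r} m n (k , ek) (l , el) (u , v , e) with a , b , eg ← β-gcd m n =
    u + v * a * k , v * b * l , combine₂ 1# e (- v) (trans eg (+-cong (*-congˡ (sym ek)) (*-congˡ (sym el))))
      (solve 9 (λ p r k l u v a b g → (u :+ v :* a :* k) :* p :+ v :* b :* l :* r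
        := :1 :+ :1 :* (u :* p :+ v :* g :- :1) :+ :- v :* (g :- (a :* (k :* p) :+ b :* (l :* r)))) p r k l u v a b (β (ℕ.gcd m n)))

quotient-positive : ∀ {g n} k → g < n → n ≡ k ℕ.* g → 0 < k
quotient-positive zero    g<n ≡.refl = contradiction g<n λ ()
quotient-positive (suc k) _   _      = ℕ.z<s

divisor-positive : ∀ {i n} → 0 < n → i ℕ.∣ n → 0 < i
divisor-positive {zero}  0<n p = contradiction (ℕ.0∣⇒≡0 p) (ℕ.m<n⇒n≢0 0<n)
divisor-positive {suc i} _   _ = ℕ.z<s

module _ {c ℓ} (R : CommutativeRing c ℓ) (x : CommutativeRing.Carrier R) where

  open CommutativeRing R
  open RingSolver R
  open RingKit R
  open Comaximality R
  open PowersMinusOne R x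
  open Relation.Binary.Reasoning.Setoid setoid

  -- A sequence ψ with ∏_{e ∣ n} ψ e = x^n - 1 consists of pairwise comaximal
  -- elements when the positive integers are invertible, since for g ∣ n
  -- the quotient of x^n - 1 by x^g - 1 is n / g modulo x^g - 1.
  module CyclotomicFactors
    (β-cancel : ∀ {m} a b → 0 < m → a * β m ≈ b * β m → a ≈ b)
    (ℕ-invertible : ∀ k → 0 < k → ∃ λ u → u * (k · 1#) ≈ 1#)
    where

    select : ℕ → (ℕ → Carrier) → ℕ → Carrier
    select n ψ e = if does (e ℕ.∣? n) then ψ e else 1#

    select-∣ : ∀ {n e} ψ → e ℕ.∣ n → select n ψ e ≡ ψ e
    select-∣ {n} {e} ψ p = ≡.cong (if_then ψ e else 1#) (dec-true (e ℕ.∣? n) p)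

    select-∤ : ∀ {n e} ψ → ¬ (e ℕ.∣ n) → select n ψ e ≡ 1#
    select-∤ {n} {e} ψ p = ≡.cong (if_then ψ e else 1#) (dec-false (e ℕ.∣? n) p)

    select-elim : ∀ {q} (Q : Carrier → Set q) {n} ψ e → (e ℕ.∣ n → Q (ψ e)) → (¬ (e ℕ.∣ n) → Q 1#) → Q (select n ψ e)
    select-elim Q {n} ψ e yes′ no′ with e ℕ.∣? n
    ... | yes p = yes′ p
    ... | no ¬p = no′ ¬p

    Factors : (ℕ → Carrier) → ℕ → Set ℓ
    Factors ψ n = Π< n (select n ψ) * ψ n ≈ β n

    factors-transfer : ∀ {ψ ψ′ φ} n → (∀ i → i < n → ψ′ i ≡ ψ i) → ψ′ n ≡ φ → Π< n (select n ψ) * φ ≈ β n → Factors ψ′ n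
    factors-transfer n e eₙ f = trans (*-cong (Π-cong n λ i i<n → reflexive
      (≡.cong (if does (i ℕ.∣? n) then_else 1#) (e i i<n))) (reflexive eₙ)) f

    -- Divisors of g divide n, and g itself is below n, so the product over the proper divisors of n
    -- contains the whole factorisation of `β g`.
    divisors-divide : ∀ ψ {g n} → g ℕ.∣ n → g < n → Π< g (select g ψ) * ψ g ∣ᴿ Π< n (select n ψ)
    divisors-divide ψ {g} {n} g∣n g<n = divides-resp (sym split) (divides-*ˡ _ initial)
      where
      split : Π< n (select n ψ) ≈ Π< (n ℕ.∸ suc g) (λ i → select n ψ (suc g ℕ.+ i)) * Π< (suc g) (select n ψ)
      split = trans (reflexive (≡.cong (λ m → Π< m (select n ψ)) (≡.sym (ℕ.m+[n∸m]≡n g<n)))) (trans (Π-split _ (suc g) _) (*-comm _ _))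
      factorwise : ∀ i → select g ψ i ∣ᴿ select n ψ i
      factorwise i with i ℕ.∣? g
      ... | yes p = divides-resp (reflexive (≡.sym (select-∣ ψ (ℕ.∣-trans p g∣n)))) divides-refl
      ... | no  _ = _ , *-identityʳ _
      initial : Π< g (select g ψ) * ψ g ∣ᴿ Π< (suc g) (select n ψ)
      initial = divides-* (divides-Π g λ i _ → factorwise i) (divides-resp (reflexive (≡.sym (select-∣ ψ g∣n))) divides-refl)

    comaximal-β-divisor : ∀ ψ {φ g n} → g ℕ.∣ n → 0 < g → g < n → Factors ψ g → Π< n (select n ψ) * φ ≈ β n → Comaximal φ (β g)
    comaximal-β-divisor ψ {φ} {g} {n} g∣n@(ℕ.divides k n≡kg) 0<g g<n fg fn = u * w , - (u * v) , combine₃ u quotient u ev 1# eu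
      (solve 7 (λ u w φ v b s k → u :* w :* φ :+ :- (u :* v) :* b
        := :1 :+ u :* (w :* φ :- s) :+ u :* (s :- (k :+ v :* b)) :+ :1 :* (u :* k :- :1)) u w φ v (β g) (geometric k g) (k · 1#))
      where
      u v w : Carrier
      u = proj₁ (ℕ-invertible k (quotient-positive k g<n n≡kg))
      v = proj₁ (geometric-mod k g)
      w = proj₁ (divisors-divide ψ g∣n g<n)
      eu : u * (k · 1#) ≈ 1#
      eu = proj₂ (ℕ-invertible k (quotient-positive k g<n n≡kg))
      ev : geometric k g ≈ k · 1# + v * β g
      ev = proj₂ (geometric-mod k g)
      -- `w` is the cofactor of `β g` in the product over proper divisors; cancelling `β g` shows
      -- that φ divides the quotient of `β n` by `β g`.
      quotient : w * φ ≈ geometric k g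
      quotient = β-cancel _ _ 0<g (begin
        w * φ * β g                                     ≈⟨ *-congˡ fg ⟨
        w * φ * (Π< g (select g ψ) * ψ g)               ≈⟨ solve 3 (λ w φ p → w :* φ :* p := w :* p :* φ) w φ _ ⟩
        w * (Π< g (select g ψ) * ψ g) * φ               ≈⟨ *-congʳ (proj₂ (divisors-divide ψ g∣n g<n)) ⟩
        Π< n (select n ψ) * φ                           ≈⟨ fn ⟩
        β n                                             ≈⟨ reflexive (≡.cong β n≡kg) ⟩
        β (k ℕ.* g)                                     ≈⟨ geometric-* k g ⟨
        geometric k g * β g                             ∎)

    module _ (ψ : ℕ → Carrier) (n : ℕ) (factors : ∀ m → 0 < m → m < n → Factors ψ m) where

      ψ-divides-β : ∀ {e} → 0 < e → e < n → ψ e ∣ᴿ β e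
      ψ-divides-β 0<e e<n = _ , factors _ 0<e e<n

      comaximal-ψ-gcd : ∀ {e m} → 0 < e → e < n → ℕ.gcd e m < e → 0 < ℕ.gcd e m → Comaximal (ψ e) (β (ℕ.gcd e m))
      comaximal-ψ-gcd {e} {m} 0<e e<n g<e 0<g = comaximal-β-divisor ψ (ℕ.gcd[m,n]∣m e m) 0<g g<e
        (factors _ 0<g (ℕ.<-trans g<e e<n)) (factors e 0<e e<n)

      gcd-positive : ∀ {e} m → 0 < e → 0 < ℕ.gcd e m
      gcd-positive {e} m 0<e = ℕ.n≢0⇒n>0 λ eq → ℕ.<⇒≢ 0<e (≡.sym (ℕ.gcd[m,n]≡0⇒m≡0 eq))

      gcd<⊎∣ : ∀ {e} m → 0 < e → ℕ.gcd e m < e ⊎ e ℕ.∣ m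
      gcd<⊎∣ {e} m 0<e with ℕ.m≤n⇒m<n∨m≡n (ℕ.∣⇒≤ {{ℕ.>-nonZero 0<e}} (ℕ.gcd[m,n]∣m e m))
      ... | inj₁ lt = inj₁ lt
      ... | inj₂ eq = inj₂ (≡.subst (ℕ._∣ m) eq (ℕ.gcd[m,n]∣n e m))

      -- As e does not divide m, gcd e m is a proper divisor of e, and its β is a combination of
      -- `β e` and `β m`.
      comaximal-β : ∀ {e m r} → 0 < e → e < n → ¬ (e ℕ.∣ m) → r ∣ᴿ β m → Comaximal (ψ e) r
      comaximal-β {e} {m} 0<e e<n e∤m p with gcd<⊎∣ m 0<e
      ... | inj₁ lt  = comaximal-via-gcd e m (ψ-divides-β 0<e e<n) p (comaximal-ψ-gcd 0<e e<n lt (gcd-positive m 0<e))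
      ... | inj₂ e∣m = contradiction e∣m e∤m

      comaximal-ψ : ∀ {e m} → 0 < e → e < n → 0 < m → m < n → e ≢ m → Comaximal (ψ e) (ψ m)
      comaximal-ψ {e} {m} 0<e e<n 0<m m<n e≢m with e ℕ.∣? m
      ... | no  e∤m = comaximal-β 0<e e<n e∤m (ψ-divides-β 0<m m<n)
      ... | yes e∣m = comaximal-sym (comaximal-β 0<m m<n (λ m∣e → e≢m (ℕ.∣-antisym e∣m m∣e)) (ψ-divides-β 0<e e<n))

      comaximal-select : ∀ {e N} → 0 < e → e < n → 0 < N → ∀ {i} → i < n → i ≢ e → Comaximal (ψ e) (select N ψ i)
      comaximal-select {e} {N} 0<e e<n 0<N {i} i<n i≢e with i ℕ.∣? N
      ... | no  _   = comaximal-1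
      ... | yes i∣N = comaximal-ψ 0<e e<n (divisor-positive 0<N i∣N) i<n λ e≡i → i≢e (≡.sym e≡i)

      select-divides-β : ∀ {N} → 0 < N → ∀ i → i < n → select N ψ i ∣ᴿ β N
      select-divides-β {N} 0<N i i<n with i ℕ.∣? N
      ... | no  _   = _ , *-identityʳ _
      ... | yes i∣N@(ℕ.divides k eq) = divides-trans (ψ-divides-β (divisor-positive 0<N i∣N) i<n) (β-∣ k eq)

      -- Comaximal divisors of `β N` can be multiplied together one at a time. Taken over all proper
      -- divisors, this shows the quotient defining the next cyclotomic polynomial to be a
      -- polynomial.
      product-divides-β : ∀ {N} → 0 < N → ∀ k → k ≤ n → Π< k (select N ψ) ∣ᴿ β N
      product-divides-β         0<N zero    _   = _ , *-identityʳ _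
      product-divides-β {N} 0<N (suc k) k<n = comaximal⇒*-divides coprime (product-divides-β 0<N k (ℕ.<⇒≤ k<n)) (select-divides-β 0<N k k<n)
        where
        coprime : Comaximal (Π< k (select N ψ)) (select N ψ k)
        coprime with k ℕ.∣? N
        ... | no  _ = comaximal-1
        ... | yes p = comaximal-sym (comaximal-Π k λ i i<k →
          comaximal-select (divisor-positive 0<N p) k<n 0<N (ℕ.<-trans i<k k<n) (ℕ.<⇒≢ i<k))

      -- Splitting off the indices 0 and 1, the former contributing 1 because 0 does not divide n,
      -- isolates `β 1`; the other factor is [n].
      β-factorisation : 1 < n → Factors ψ n →
        β n ≈ β 1 * (Π< (n ℕ.∸ 2) (λ i → select n ψ (2 ℕ.+ i)) * ψ n)
      β-factorisation 1<n fn = begin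
        β n
          ≈⟨ fn ⟨
        Π< n (select n ψ) * ψ n
          ≈⟨ *-congʳ (trans (reflexive (≡.cong (λ m → Π< m (select n ψ)) (≡.sym (ℕ.m+[n∸m]≡n 1<n)))) (Π-split (select n ψ) 2 (n ℕ.∸ 2))) ⟩
        1# * select n ψ 0 * select n ψ 1 * q * ψ n
          ≈⟨ *-congʳ (*-congʳ (*-cong (*-congˡ (reflexive (≡.trans (select-∤ ψ (0∤ (ℕ.<-trans ℕ.z<s 1<n))) (≡.sym (select-∤ ψ (0∤ {1} ℕ.z<s))))))
               (reflexive (select-∣ ψ (ℕ.1∣ n))))) ⟩
        1# * select 1 ψ 0 * ψ 1 * q * ψ n
          ≈⟨ *-congʳ (*-congʳ (factors 1 ℕ.z<s 1<n)) ⟩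
        β 1 * q * ψ n
          ≈⟨ *-assoc _ _ _ ⟩
        β 1 * (q * ψ n) ∎
        where
        q = Π< (n ℕ.∸ 2) (λ i → select n ψ (2 ℕ.+ i))
        0∤ : ∀ {m} → 0 < m → ¬ (0 ℕ.∣ m)
        0∤ 0<m p = ℕ.m<n⇒n≢0 0<m (ℕ.0∣⇒≡0 p)

-- Integer powers of a unit

module _ {c ℓ} (K : CommutativeRing c ℓ) where

  open CommutativeRing K
  open Algebra.Properties.Semiring.Exp semiring
  open RingSolver K
  open RingKit K
  open Relation.Binary.Reasoning.Setoid setoid

  module UnitPowers
    (u : Carrier) (E : ℤ → Carrier)
    (E-+ve : ∀ m → E (+ m) ≈ u ^ m)
    (E-‿ve : ∀ m → E -[1+ m ] * u ^ suc m ≈ 1#)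
    where

    E-0 : E 0ℤ ≈ 1#
    E-0 = E-+ve 0

    power-invertible : ∀ k → ∃ λ v → u ^ k * v ≈ 1#
    power-invertible zero    = 1# , *-identityˡ 1#
    power-invertible (suc k) = E -[1+ k ] , trans (*-comm _ _) (E-‿ve k)

    E-shift : ∀ m k l → m ℤ.+ + k ≡ + l → E m * u ^ k ≈ u ^ l
    E-shift (+ a)    k l eq = trans (*-congʳ (E-+ve a))
      (trans (sym (^-homo-* u a k)) (reflexive (≡.cong (u ^_) (ℤ.+-injective eq))))
    E-shift -[1+ a ] k l eq = begin
      E -[1+ a ] * u ^ k                      ≈⟨ *-congˡ (trans (reflexive (≡.cong (u ^_) index)) (^-homo-* u (suc a) l)) ⟩
      E -[1+ a ] * (u ^ suc a * u ^ l)        ≈⟨ *-assoc _ _ _ ⟨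
      E -[1+ a ] * u ^ suc a * u ^ l          ≈⟨ *-congʳ (E-‿ve a) ⟩
      1# * u ^ l                              ≈⟨ *-identityˡ _ ⟩
      u ^ l                                   ∎
      where
      index : k ≡ suc a ℕ.+ l
      index = ℤ.+-injective (≡.trans (cancel (+ suc a) (+ k)) (≡.cong (λ x → + suc a ℤ.+ x) eq))
        where
        cancel : ∀ a k → k ≡ a ℤ.+ (ℤ.- a ℤ.+ k)
        cancel = solve-∀

    clear : ∀ m → ∃₂ λ k l → m ℤ.+ + k ≡ + l
    clear (+ a)    = 0 , a , ℤ.+-identityʳ (+ a)
    clear -[1+ a ] = suc a , 0 , ℤ.+-inverseˡ (+ suc a)

    -- Both sides are multiplied by a power of u that makes all exponents natural, which avoids a
    -- case distinction on signs.
    E-+ : ∀ m n → E (m ℤ.+ n) ≈ E m * E n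
    E-+ m n with k , l , eq ← clear m | k′ , l′ , eq′ ← clear n = *-cancelʳ-invertible (proj₂ (power-invertible (k ℕ.+ k′))) (begin
      E (m ℤ.+ n) * u ^ (k ℕ.+ k′)     ≈⟨ E-shift (m ℤ.+ n) (k ℕ.+ k′) (l ℕ.+ l′) (≡.trans (swap m n (+ k) (+ k′)) (≡.cong₂ (λ x y → x ℤ.+ y) eq eq′)) ⟩
      u ^ (l ℕ.+ l′)                   ≈⟨ ^-homo-* u l l′ ⟩
      u ^ l * u ^ l′                   ≈⟨ *-cong (E-shift m k l eq) (E-shift n k′ l′ eq′) ⟨
      E m * u ^ k * (E n * u ^ k′)     ≈⟨ solve 4 (λ a b c d → a :* b :* (c :* d) := a :* c :* (b :* d)) (E m) (u ^ k) (E n) (u ^ k′) ⟩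
      E m * E n * (u ^ k * u ^ k′)     ≈⟨ *-congˡ (^-homo-* u k k′) ⟨
      E m * E n * u ^ (k ℕ.+ k′)       ∎)
      where
      swap : ∀ m n k k′ → m ℤ.+ n ℤ.+ (k ℤ.+ k′) ≡ (m ℤ.+ k) ℤ.+ (n ℤ.+ k′)
      swap = solve-∀

-- Fractions with denominator comaximal with p

module _ {a ℓ c ℓ′} (P : CommutativeRing a ℓ) (K : CommutativeRing c ℓ′) where

  open CommutativeRing K
  open RingSolver K
  open RingKit K
  open Relation.Binary.Reasoning.Setoid setoid
  private module P = CommutativeRing P
  private module S = RingSolver P
  open Comaximality P

  module LocalFractions
    (ι : P.Carrier → Carrier)
    (ι-cong : ∀ {x y} → x P.≈ y → ι x ≈ ι y)
    (ι-+ : ∀ x y → ι (x P.+ y) ≈ ι x + ι y)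
    (ι-* : ∀ x y → ι (x P.* y) ≈ ι x * ι y)
    (ι-neg : ∀ x → ι (P.- x) ≈ - ι x)
    (ι-1 : ι P.1# ≈ 1#)
    where

    ι-- : ∀ x y → ι (x P.- y) ≈ ι x - ι y
    ι-- x y = trans (ι-+ x (P.- y)) (+-congˡ (ι-neg y))

    ι-Π : ∀ f n → ι (RingKit.Π< P n f) ≈ Π< n (λ i → ι (f i))
    ι-Π f zero    = ι-1
    ι-Π f (suc n) = trans (ι-* _ _) (*-congʳ (ι-Π f n))

    -- f is b x / s with s comaximal with p, cleared of the division so that s need not be known to
    -- be nonzero. With b = 1 this describes the local subring, with b = p the congruence f ≡ 0
    -- modulo p.
    Fraction : P.Carrier → P.Carrier → Carrier → Set (a ⊔ ℓ ⊔ ℓ′)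
    Fraction p b f = ∃₂ λ x s → Comaximal p s × f * ι s ≈ ι (b P.* x)

    localSubring : P.Carrier → Subring K (a ⊔ ℓ ⊔ ℓ′)
    localSubring p = record
      { O = Fraction p P.1#
      ; O-resp = λ e (x , s , p⊥s , eq) → x , s , p⊥s , trans (*-congʳ (sym e)) eq
      ; O-+ = λ {f} {g} (x , s , p⊥s , eq) (y , r , p⊥r , eq′) → x P.* r P.+ y P.* s , s P.* r , comaximal-* p⊥s p⊥r , (begin
          (f + g) * ι (s P.* r)                        ≈⟨ *-congˡ (ι-* s r) ⟩
          (f + g) * (ι s * ι r)                        ≈⟨ solve 4 (λ f g s r → (f :+ g) :* (s :* r) := f :* s :* r :+ g :* r :* s) f g (ι s) (ι r) ⟩
          f * ι s * ι r + g * ι r * ι s                ≈⟨ +-cong (*-congʳ eq) (*-congʳ eq′) ⟩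
          ι (P.1# P.* x) * ι r + ι (P.1# P.* y) * ι s  ≈⟨ +-cong (ι-* _ r) (ι-* _ s) ⟨
          ι (P.1# P.* x P.* r) + ι (P.1# P.* y P.* s)  ≈⟨ ι-+ _ _ ⟨
          ι (P.1# P.* x P.* r P.+ P.1# P.* y P.* s)    ≈⟨ ι-cong (S.solve 4 (λ x y s r → S.:1 S.:* x S.:* r S.:+ S.:1 S.:* y S.:* s S.:= S.:1 S.:* (x S.:* r S.:+ y S.:* s)) x y s r) ⟩
          ι (P.1# P.* (x P.* r P.+ y P.* s))           ∎)
      ; O-* = λ {f} {g} (x , s , p⊥s , eq) (y , r , p⊥r , eq′) → x P.* y , s P.* r , comaximal-* p⊥s p⊥r , (begin
          f * g * ι (s P.* r)                          ≈⟨ *-congˡ (ι-* s r) ⟩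
          f * g * (ι s * ι r)                          ≈⟨ solve 4 (λ f g s r → f :* g :* (s :* r) := f :* s :* (g :* r)) f g (ι s) (ι r) ⟩
          f * ι s * (g * ι r)                          ≈⟨ *-cong eq eq′ ⟩
          ι (P.1# P.* x) * ι (P.1# P.* y)              ≈⟨ ι-* _ _ ⟨
          ι (P.1# P.* x P.* (P.1# P.* y))              ≈⟨ ι-cong (S.solve 2 (λ x y → S.:1 S.:* x S.:* (S.:1 S.:* y) S.:= S.:1 S.:* (x S.:* y)) x y) ⟩
          ι (P.1# P.* (x P.* y))                       ∎)
      ; O-neg = λ {f} (x , s , p⊥s , eq) → P.- x , s , p⊥s , (begin
          - f * ι s                                    ≈⟨ solve 2 (λ f s → :- f :* s := :- (f :* s)) f (ι s) ⟩
          - (f * ι s)                                  ≈⟨ -‿cong eq ⟩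
          - ι (P.1# P.* x)                             ≈⟨ ι-neg _ ⟨
          ι (P.- (P.1# P.* x))                         ≈⟨ ι-cong (S.solve 1 (λ x → S.:- (S.:1 S.:* x) S.:= S.:1 S.:* S.:- x) x) ⟩
          ι (P.1# P.* P.- x)                           ∎)
      ; O-1 = P.1# , P.1# , comaximal-1 , trans (*-identityˡ _) (ι-cong (P.sym (P.*-identityˡ _)))
      }

    O-ι : ∀ {p} x → Fraction p P.1# (ι x)
    O-ι x = x , P.1# , comaximal-1 , trans (sym (ι-* x P.1#)) (ι-cong (P.*-comm x P.1#))

    O-inverse : ∀ {p s f} x → Comaximal p s → f * ι s ≈ ι x → Fraction p P.1# f
    O-inverse {s = s} x p⊥s eq = x , s , p⊥s , trans eq (ι-cong (P.sym (P.*-identityˡ x)))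

    ∼⇒fraction : ∀ {p x y b k} → k ≈ ι b → let open Congruences K (localSubring p) in x ∼ y [ k ] → Fraction p b (x - y)
    ∼⇒fraction {p} {x} {y} {b} {k} ek (Congruences.multiple z (w , s , p⊥s , eqz) eq) = w , s , p⊥s , (begin
      (x - y) * ι s              ≈⟨ combine₂ (ι s) eq (z * ι s) ek (solve 6 (λ x y z k b s → (x :- y) :* s := b :* (z :* s) :+ s :* (x :- (y :+ k :* z)) :+ z :* s :* (k :- b)) x y z k (ι b) (ι s)) ⟩
      ι b * (z * ι s)            ≈⟨ *-congˡ eqz ⟩
      ι b * ι (P.1# P.* w)       ≈⟨ ι-* _ _ ⟨
      ι (b P.* (P.1# P.* w))     ≈⟨ ι-cong (P.*-congˡ (P.*-identityˡ w)) ⟩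
      ι (b P.* w)                ∎)

    fraction-denominator : ∀ {p b f} → Fraction p b f → (∀ {s} → Comaximal p s → Comaximal b s) → Fraction b b f
    fraction-denominator (x , s , p⊥s , eq) φ = x , s , φ p⊥s , eq

    -- With a P + b P′ = 1, the element b P′ v s + a P v′ s′ is a common
    -- denominator that is 1 modulo both P and P′.
    fraction-* : ∀ {p p′ f} → Comaximal p p′ → Fraction p p f → Fraction p′ p′ f → Fraction (p P.* p′) (p P.* p′) f
    fraction-* {p} {p′} {f} (a , b , e) (x , s , (u , v , e₁) , eq) (x′ , s′ , (u′ , v′ , e₂) , eq′) =
      b P.* v P.* x P.+ a P.* v′ P.* x′ , σ , comaximal-sym (comaximal-* (comaximal-sym left) (comaximal-sym right)) , (begin
        f * ι σ
          ≈⟨ *-congˡ (trans (ι-+ _ _) (+-cong (ι-* _ _) (ι-* _ _))) ⟩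
        f * (ι (b P.* p′ P.* v) * ι s + ι (a P.* p P.* v′) * ι s′)
          ≈⟨ solve 5 (λ f y s y′ s′ → f :* (y :* s :+ y′ :* s′) := y :* (f :* s) :+ y′ :* (f :* s′)) f (ι (b P.* p′ P.* v)) (ι s) (ι (a P.* p P.* v′)) (ι s′) ⟩
        ι (b P.* p′ P.* v) * (f * ι s) + ι (a P.* p P.* v′) * (f * ι s′)
          ≈⟨ +-cong (*-congˡ eq) (*-congˡ eq′) ⟩
        ι (b P.* p′ P.* v) * ι (p P.* x) + ι (a P.* p P.* v′) * ι (p′ P.* x′)
          ≈⟨ trans (ι-+ _ _) (+-cong (ι-* _ _) (ι-* _ _)) ⟨
        ι (b P.* p′ P.* v P.* (p P.* x) P.+ a P.* p P.* v′ P.* (p′ P.* x′))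
          ≈⟨ ι-cong (S.solve 8 (λ a b v x p v′ x′ p′ → b S.:* p′ S.:* v S.:* (p S.:* x) S.:+ a S.:* p S.:* v′ S.:* (p′ S.:* x′)
               S.:= p S.:* p′ S.:* (b S.:* v S.:* x S.:+ a S.:* v′ S.:* x′)) a b v x p v′ x′ p′) ⟩
        ι (p P.* p′ P.* (b P.* v P.* x P.+ a P.* v′ P.* x′)) ∎)
      where
      σ = b P.* p′ P.* v P.* s P.+ a P.* p P.* v′ P.* s′
      module C = RingKit P
      left : Comaximal p σ
      left = a P.- a P.* v′ P.* s′ P.+ b P.* p′ P.* u , P.1# , C.combine₂ (b P.* p′) e₁ P.1# e
        (S.solve 9 (λ a b p p′ u v s v′ s′ → (a S.:- a S.:* v′ S.:* s′ S.:+ b S.:* p′ S.:* u) S.:* p S.:+ S.:1 S.:* (b S.:* p′ S.:* v S.:* s S.:+ a S.:* p S.:* v′ S.:* s′)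
          S.:= S.:1 S.:+ b S.:* p′ S.:* (u S.:* p S.:+ v S.:* s S.:- S.:1) S.:+ S.:1 S.:* (a S.:* p S.:+ b S.:* p′ S.:- S.:1)) a b p p′ u v s v′ s′)
      right : Comaximal p′ σ
      right = b P.- b P.* v P.* s P.+ a P.* p P.* u′ , P.1# , C.combine₂ (a P.* p) e₂ P.1# e
        (S.solve 9 (λ a b p p′ u′ v s v′ s′ → (b S.:- b S.:* v S.:* s S.:+ a S.:* p S.:* u′) S.:* p′ S.:+ S.:1 S.:* (b S.:* p′ S.:* v S.:* s S.:+ a S.:* p S.:* v′ S.:* s′)
          S.:= S.:1 S.:+ a S.:* p S.:* (u′ S.:* p′ S.:+ v′ S.:* s′ S.:- S.:1) S.:+ S.:1 S.:* (a S.:* p S.:+ b S.:* p′ S.:- S.:1)) a b p p′ u′ v s v′ s′)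

    fraction-1 : ∀ {f} x s → f * ι s ≈ ι x → Fraction P.1# P.1# f
    fraction-1 x s eq = O-inverse x (comaximal-sym comaximal-1) eq

    fraction-Π : ∀ {f} g n → Fraction P.1# P.1# f → (∀ i j → i < n → j < i → Comaximal (g i) (g j)) →
      (∀ i → i < n → Fraction (g i) (g i) f) → Fraction (RingKit.Π< P n g) (RingKit.Π< P n g) f
    fraction-Π g zero    f₁ ⊥ fr = f₁
    fraction-Π g (suc n) f₁ ⊥ fr = fraction-*
      (comaximal-sym (comaximal-Π n λ j j<n → ⊥ n j (ℕ.n<1+n n) j<n))
      (fraction-Π g n f₁ (λ i j i<n → ⊥ i j (ℕ.m<n⇒m<1+n i<n)) (λ i i<n → fr i (ℕ.m<n⇒m<1+n i<n)))
      (fr n (ℕ.n<1+n n))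

  -- Cyclotomic polynomials as elements of the polynomial ring

  module _
    (ι : P.Carrier → Carrier)
    (ι-cong : ∀ {x y} → x P.≈ y → ι x ≈ ι y)
    (ι-+ : ∀ x y → ι (x P.+ y) ≈ ι x + ι y)
    (ι-* : ∀ x y → ι (x P.* y) ≈ ι x * ι y)
    (ι-neg : ∀ x → ι (P.- x) ≈ - ι x)
    (ι-1 : ι P.1# ≈ 1#)
    where

    open LocalFractions ι ι-cong ι-+ ι-* ι-neg ι-1

    module _ (X : P.Carrier) where

      open PowersMinusOne P X

      module _
        (ℕ-invertible : ∀ k → 0 < k → ∃ λ u → u P.* (k · P.1#) P.≈ P.1#)
        (β-cancel : ∀ {m} a b → 0 < m → a P.* β m P.≈ b P.* β m → a P.≈ b)
        where

        open Algebra.Properties.Semiring.Exp semiring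
        open CyclotomicFactors P X β-cancel ℕ-invertible

        module CyclotomicSequence
          (χ : ℕ → Carrier)
          (χ-characterisation : ∀ n x → 0 < n → x * Π< n (λ e → if does (e ℕ.∣? n) then χ e else 1#) ≈ ι (β n) → x ≈ χ n)
          where

          private module PB = RingKit P

          CyclotomicUpTo : ℕ → (ℕ → P.Carrier) → Set _
          CyclotomicUpTo n ψ = ∀ e → 0 < e → e < n → ι (ψ e) ≈ χ e × Factors ψ e

          if-ι : ∀ {b} {A : Set b} (A? : Dec A) {p x} → (A → ι p ≈ x) → ι (if does A? then p else P.1#) ≈ (if does A? then x else 1#)
          if-ι (yes a) e = e a
          if-ι (no  _) e = ι-1

          -- χ n is given only as an element of K. The polynomial comes from `product-divides-β`,
          -- and `χ-characterisation` identifies it with χ n.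
          module Extend (n : ℕ) (0<n : 0 < n) (ψ : ℕ → P.Carrier) (upto : CyclotomicUpTo n ψ) where

            factors : ∀ m → 0 < m → m < n → Factors ψ m
            factors m 0<m m<n = proj₂ (upto m 0<m m<n)

            T φ : P.Carrier
            T = PB.Π< n (select n ψ)
            φ = proj₁ (product-divides-β ψ n factors 0<n n ℕ.≤-refl)

            φ*T≈β : φ P.* T P.≈ β n
            φ*T≈β = proj₂ (product-divides-β ψ n factors 0<n n ℕ.≤-refl)

            φ≈χ : ι φ ≈ χ n
            φ≈χ = χ-characterisation n (ι φ) 0<n (trans (*-congˡ (sym T≈)) (trans (sym (ι-* φ T)) (ι-cong φ*T≈β)))
              where
              T≈ : ι T ≈ Π< n (λ e → if does (e ℕ.∣? n) then χ e else 1#)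
              T≈ = trans (ι-Π (select n ψ) n) (Π-cong n λ i i<n →
                if-ι (i ℕ.∣? n) λ p → proj₁ (upto i (divisor-positive 0<n p) i<n))

            ψ′ : ℕ → P.Carrier
            ψ′ e = if does (e ℕ.≟ n) then φ else ψ e

            ψ′-≡ : ψ′ n ≡ φ
            ψ′-≡ = ≡.cong (if_then φ else ψ n) (dec-true (n ℕ.≟ n) ≡.refl)

            ψ′-≢ : ∀ {e} → e ≢ n → ψ′ e ≡ ψ e
            ψ′-≢ {e} e≢n = ≡.cong (if_then φ else ψ e) (dec-false (e ℕ.≟ n) e≢n)

            extended : CyclotomicUpTo (suc n) ψ′
            extended e 0<e e<1+n with ℕ.m≤n⇒m<n∨m≡n (ℕ.≤-pred e<1+n)
            ... | inj₁ e<n = trans (reflexive (≡.cong ι (ψ′-≢ (ℕ.<⇒≢ e<n)))) (proj₁ (upto e 0<e e<n)) ,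
              factors-transfer e (λ i i<e → ψ′-≢ (ℕ.<⇒≢ (ℕ.<-trans i<e e<n))) (ψ′-≢ (ℕ.<⇒≢ e<n)) (factors e 0<e e<n)
            ... | inj₂ ≡.refl = trans (reflexive (≡.cong ι ψ′-≡)) φ≈χ ,
              factors-transfer e (λ i i<e → ψ′-≢ (ℕ.<⇒≢ i<e)) ψ′-≡ (P.trans (P.*-comm T φ) φ*T≈β)

          cyclotomic-polynomials : ∀ n → ∃ (CyclotomicUpTo n)
          cyclotomic-polynomials zero          = (λ _ → P.1#) , λ _ _ ()
          cyclotomic-polynomials (suc zero)    = (λ _ → P.1#) , λ e 0<e e<1 → contradiction 0<e (ℕ.≤⇒≯ (ℕ.≤-pred e<1))
          cyclotomic-polynomials (suc (suc n)) = let ψ , upto = cyclotomic-polynomials (suc n) in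
            Extend.ψ′ (suc n) ℕ.z<s ψ upto , Extend.extended (suc n) ℕ.z<s ψ upto

        -- Local conditions on the powers of q

        module _
          (E : ℤ → Carrier)
          (E-+ve : ∀ m → E (+ m) ≈ ι X ^ m)
          (E-‿ve : ∀ m → E -[1+ m ] * ι X ^ suc m ≈ 1#)
          (iB : ℤ → Carrier)
          (B-inverse : ∀ {m} → m ≢ 0ℤ → (1# - E m) * iB m ≈ 1#)
          (d : ℕ) .{{_ : NonZero d}}
          where

          open UnitPowers K (ι X) E E-+ve E-‿ve
          open PowersOfQ K E iB E-+ E-0 B-inverse d
          open Algebra.Properties.Semiring.Exp P.semiring renaming (_^_ to _^ᴾ_) using ()

          ι-^ : ∀ m → ι (X ^ᴾ m) ≈ ι X ^ m
          ι-^ zero    = ι-1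
          ι-^ (suc m) = trans (ι-* X (X ^ᴾ m)) (*-congˡ (ι-^ m))

          E≈ι : ∀ m → E (+ m) ≈ ι (X ^ᴾ m)
          E≈ι m = trans (E-+ve m) (sym (ι-^ m))

          B≈ι : ∀ m → 1# - E (+ m) ≈ - ι (β m)
          B≈ι m = trans (+-congˡ (-‿cong (E≈ι m))) (sym (trans (-‿cong (trans (ι-- _ _) (+-congˡ (-‿cong ι-1))))
            (solve 1 (λ x → :- (x :- :1) := :1 :- x) (ι (X ^ᴾ m)))))

          halves : ∃ λ h → ι h + ι h ≈ 1#
          halves with h , e ← ℕ-invertible 2 ℕ.z<s = h , trans (sym (ι-+ h h))
            (trans (ι-cong (P.trans (S.solve 1 (λ h → h S.:+ h S.:= h S.:* (S.:1 S.:+ (S.:1 S.:+ S.:0))) h) e)) ι-1)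

          module _ (e : ℕ) (1<e : 1 < e) (p : P.Carrier) (p∣β : p ∣ᴿ β e)
            (p⊥β : ∀ m → ¬ (e ℕ.∣ m) → Comaximal p (β m))
            where

            open Subring (localSubring p)
            open Congruences K (localSubring p)

            w : P.Carrier
            w = proj₁ p∣β

            X^-pred : X ^ᴾ ℕ.pred e P.* X P.≈ X ^ᴾ e
            X^-pred = P.trans (P.*-comm (X ^ᴾ ℕ.pred e) X)
              (P.reflexive (≡.cong (X ^ᴾ_) (ℕ.suc-pred e {{ℕ.>-nonZero (ℕ.<-trans ℕ.z<s 1<e)}})))

            -- p divides X^e - 1, so X^(e-1) X - w p = 1. This makes the negative powers of q
            -- integral.
            p⊥X : Comaximal p X
            p⊥X = P.- w , X ^ᴾ ℕ.pred e , RingKit.combine₂ P P.1# X^-pred (P.- P.1#) (proj₂ p∣β)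
              (S.solve 4 (λ w p y z → S.:- w S.:* p S.:+ z
                S.:= S.:1 S.:+ S.:1 S.:* (z S.:- y) S.:+ S.:- S.:1 S.:* (w S.:* p S.:- (y S.:- S.:1))) w p (X ^ᴾ e) (X ^ᴾ ℕ.pred e P.* X))

            p⊥X^ : ∀ m → Comaximal p (X ^ᴾ m)
            p⊥X^ zero    = comaximal-1
            p⊥X^ (suc m) = comaximal-* p⊥X (p⊥X^ m)

            O-E : ∀ m → O (E m)
            O-E (+ m)    = O-resp (sym (E≈ι m)) (O-ι (X ^ᴾ m))
            O-E -[1+ m ] = O-inverse P.1# (p⊥X^ (suc m)) (trans (*-congˡ (ι-^ (suc m))) (trans (E-‿ve m) (sym ι-1)))

            O-iB : ∀ {m} → ¬ (+ e ℤ.∣ m) → O (iB m)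
            O-iB {+ m} e∤m = O-inverse (P.- P.1#) (p⊥β m λ e∣m → e∤m (∣ᵤ⇒∣ e∣m)) (begin
              iB (+ m) * ι (β m)              ≈⟨ solve 2 (λ i b → i :* b := :- (:- b :* i)) (iB (+ m)) (ι (β m)) ⟩
              - (- ι (β m) * iB (+ m))        ≈⟨ -‿cong (*-congʳ (B≈ι m)) ⟨
              - ((1# - E (+ m)) * iB (+ m))   ≈⟨ -‿cong (B-inverse λ m≡0 → e∤m (divides 0ℤ m≡0)) ⟩
              - 1#                            ≈⟨ trans (ι-neg P.1#) (-‿cong ι-1) ⟨
              ι (P.- P.1#)                    ∎)
            -- 1 - X^(-(m+1)) is (X^(m+1) - 1) / X^(m+1), which explains the numerator.
            O-iB { -[1+ m ]} e∤m = O-inverse (X ^ᴾ suc m) (p⊥β (suc m) λ e∣m → e∤m (∣ᵤ⇒∣ e∣m)) (begin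
              i * ι (β (suc m))               ≈⟨ *-congˡ (trans (ι-- _ _) (+-congˡ (-‿cong ι-1))) ⟩
              i * (y - 1#)                    ≈⟨ combine₂ i (trans (*-congˡ {E -[1+ m ]} (ι-^ (suc m))) (E-‿ve m)) y (B-inverse λ ())
                                                   (solve 3 (λ i x y → i :* (y :- :1) := y :+ i :* (x :* y :- :1) :+ y :* ((:1 :- x) :* i :- :1)) i (E -[1+ m ]) y) ⟩
              y                               ∎)
              where
              i = iB -[1+ m ]
              y = ι (X ^ᴾ suc m)

            -- The quotient is the inverse of a geometric sum of k + 1 terms, which is k + 1 modulo
            -- p, and positive integers are units.
            O-quotient : ∀ k → O ((1# - E (+ e)) * iB (+ suc k ℤ.* + e))
            O-quotient k =
              let v , ev = geometric-mod (suc k) e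
                  u , eu = ℕ-invertible (suc k) ℕ.z<s
              in
              O-inverse P.1# (P.- (u P.* v P.* w) , u , RingKit.combine₃ P u ev P.1# eu (P.- (u P.* v)) (proj₂ p∣β)
                (S.solve 7 (λ u v w p s k b → S.:- (u S.:* v S.:* w) S.:* p S.:+ u S.:* s
                  S.:= S.:1 S.:+ u S.:* (s S.:- (k S.:+ v S.:* b)) S.:+ S.:1 S.:* (u S.:* k S.:- S.:1) S.:+ S.:- (u S.:* v) S.:* (w S.:* p S.:- b))
                  u v w p (geometric (suc k) e) (suc k · P.1#) (β e))) (begin
                (1# - E (+ e)) * iB m * ι (geometric (suc k) e)
                  ≈⟨ *-congʳ (*-congʳ (B≈ι e)) ⟩
                - ι (β e) * iB m * ι (geometric (suc k) e)
                  ≈⟨ solve 3 (λ b i s → :- b :* i :* s := :- (s :* b) :* i) (ι (β e)) (iB m) (ι (geometric (suc k) e)) ⟩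
                - (ι (geometric (suc k) e) * ι (β e)) * iB m
                  ≈⟨ *-congʳ (-‿cong (trans (sym (ι-* _ _)) (ι-cong (geometric-* (suc k) e)))) ⟩
                - ι (β (suc k ℕ.* e)) * iB m
                  ≈⟨ *-congʳ (trans (sym (B≈ι (suc k ℕ.* e))) (reflexive (≡.cong (λ x → 1# - E x) (ℤ.pos-* (suc k) e)))) ⟩
                (1# - E m) * iB m
                  ≈⟨ B-inverse m≢0 ⟩
                1#
                  ≈⟨ ι-1 ⟨
                ι P.1# ∎)
              where
              m = + suc k ℤ.* + e
              m≢0 : m ≢ 0ℤ
              m≢0 eq = ℕ.m<n⇒n≢0 (ℕ.<-≤-trans (ℕ.<-trans ℕ.z<s 1<e) (ℕ.m≤m+n e (k ℕ.* e))) (ℤ.+-injective (≡.trans (ℤ.pos-* (suc k) e) eq))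

            B-e∼0 : (1# - E (+ e)) ∼ 0# [ ι p ]
            B-e∼0 = multiple (- ι w) (O-neg (O-ι w)) (begin
              1# - E (+ e)            ≈⟨ B≈ι e ⟩
              - ι (β e)               ≈⟨ -‿cong (trans (sym (ι-cong (proj₂ p∣β))) (ι-* w p)) ⟩
              - (ι w * ι p)           ≈⟨ solve 2 (λ w p → :- (w :* p) := :0 :+ p :* :- w) (ι w) (ι p) ⟩
              0# + ι p * - ι w        ∎)

            module _ (d⁻¹ l₀ : ℤ) (d-inverse : + d ℤ.* d⁻¹ ≡ 1ℤ ℤ.+ l₀ ℤ.* + e) where

              private
                module Sums = PartialSums K E iB E-+ E-0 B-inverse d (localSubring p) e 1<e (ι p) (ι (proj₁ halves))
                  O-E O-iB O-quotient B-e∼0 (O-ι _) (proj₂ halves) d⁻¹ l₀ d-inverse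
                module CubedSums = PartialSumsCubed K E iB E-+ E-0 B-inverse d (localSubring p) e 1<e (ι p) (ι (proj₁ halves))
                  O-E O-iB O-quotient B-e∼0 (O-ι _) (proj₂ halves) d⁻¹ l₀ d-inverse (O-ι p)

              local-short-sum : ∀ t n N → + n ≡ t ℤ.+ D N → e ℕ.∣ n → Fraction p p (Σ< (suc N) (term t) - closed-form t n N)
              local-short-sum t n N n-eq e∣n = ∼⇒fraction refl (Sums.short-sum t n N n-eq e∣n)

              local-long-sum : ∀ t n N → + n ≡ t ℤ.+ D N → e ℕ.∣ n → Fraction p p (Σ< n (term t) - closed-form t n N)
              local-long-sum t n N n-eq e∣n = ∼⇒fraction refl (Sums.long-sum t n N n-eq e∣n)

              module _ (t : ℤ) (N : ℕ) (N<e : N < e) (e-eq : + e ≡ t ℤ.+ D N)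
                (t+D≢0 : ∀ k → t ℤ.+ D k ≢ 0ℤ)
                (d-e+D≢0 : ∀ k → + d ℤ.- + e ℤ.+ D k ≢ 0ℤ)
                where

                p³ : P.Carrier
                p³ = p P.* p P.* p

                cube : ∀ {x y} → x ∼ y [ ι p * ι p * ι p ] → Fraction p³ p³ (x - y)
                cube r = fraction-denominator (∼⇒fraction (trans (*-congʳ (sym (ι-* p p))) (sym (ι-* _ p))) r)
                  λ p⊥s → comaximal-sym (comaximal-* (comaximal-* (comaximal-sym p⊥s) (comaximal-sym p⊥s)) (comaximal-sym p⊥s))

                cubed-short-sum : Fraction p³ p³ (Σ< (suc N) (term t) - closed-form t e N)
                cubed-short-sum = cube (CubedSums.short-sum t N N<e e-eq t+D≢0 d-e+D≢0)

                cubed-long-sum : Fraction p³ p³ (Σ< e (term t) - closed-form t e N)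
                cubed-long-sum = cube (CubedSums.long-sum t N N<e e-eq t+D≢0 d-e+D≢0)

          -- Gluing over the divisors of n

          module Assembly
            (1<d : 1 < d)
            (t : ℤ) (x y : ℤ) (bézout : x ℤ.* t ℤ.+ y ℤ.* + d ≡ 1ℤ)
            (n N : ℕ) (1<n : 1 < n) (N<n : N < n) (n-eq : + n ≡ t ℤ.+ D N)
            (as-fraction : ∀ f → ∃₂ λ x s → f * ι s ≈ ι x)
            (ψ : ℕ → P.Carrier) (factors : ∀ m → 0 < m → m < suc n → Factors ψ m)
            (bracket : ℤ → Carrier) (bracket≈ : ∀ m → bracket m ≈ (1# - E m) * iB 1ℤ)
            (poch : Carrier → Carrier → ℕ → Carrier)
            (poch≈ : ∀ x y k → poch x y k ≈ Π< k (λ j → 1# - x * y ^ j))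
            (_⋆_ : Carrier → Carrier → Carrier) (⋆≈ : ∀ x y → x ⋆ y ≈ x * y)
            (_∸_ : Carrier → Carrier → Carrier) (∸≈ : ∀ x y → x ∸ y ≈ x - y)
            (_÷_ : Carrier → Carrier → Carrier) (÷≈ : ∀ f {g h} → g * h ≈ 1# → f ÷ g ≈ f * h)
            (_↑_ : Carrier → ℕ → Carrier) (↑2≈ : ∀ x → x ↑ 2 ≈ x * x) (↑4≈ : ∀ x → x ↑ 4 ≈ (x * x) * (x * x))
            (Σᶠ : ∀ {n} → (Fin n → Carrier) → Carrier) (Σᶠ≈ : ∀ n f → Σᶠ {n} (λ k → f (toℕ k)) ≈ Σ< n f)
            where

            open StatementForm K E iB E-+ E-0 B-inverse d bracket bracket≈ poch poch≈ _⋆_ ⋆≈ _∸_ ∸≈ _÷_ ÷≈ _↑_ ↑2≈ ↑4≈ Σᶠ Σᶠ≈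
              using (difference≈)

            0<n : 0 < n
            0<n = ℕ.<-trans ℕ.z<s 1<n

            open CoprimeProgression d n N 1<d t x y bézout n-eq

            rest : ℕ → P.Carrier
            rest i = select n ψ (2 ℕ.+ i)

            -- `Q` times `ψ n` is [n] by `β-factorisation`. The three factors `ψ n` are gathered so
            -- that the modulus is a product of comaximal elements, as needed for gluing.
            Q ψₙ³ modulus : P.Carrier
            Q = RingKit.Π< P (n ℕ.∸ 2) rest
            ψₙ³ = ψ n P.* ψ n P.* ψ n
            modulus = Q P.* ψₙ³

            rest< : ∀ {i} → i < n ℕ.∸ 2 → 2 ℕ.+ i < n
            rest< i<n-2 = ℕ.<-≤-trans (ℕ.+-monoʳ-< 2 i<n-2) (ℕ.≤-reflexive (ℕ.m+[n∸m]≡n 1<n))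

            ψ⊥select : ∀ {e} → 0 < e → e < suc n → ∀ {i} → i < suc n → i ≢ e → Comaximal (ψ e) (select n ψ i)
            ψ⊥select 0<e e<1+n = comaximal-select ψ (suc n) factors 0<e e<1+n 0<n

            rest⊥rest : ∀ i j → i < n ℕ.∸ 2 → j < i → Comaximal (rest i) (rest j)
            rest⊥rest i j i<n-2 j<i = select-elim (λ z → Comaximal z (rest j)) {n} ψ (2 ℕ.+ i)
              (λ _ → ψ⊥select ℕ.z<s (ℕ.m<n⇒m<1+n (rest< i<n-2)) (ℕ.m<n⇒m<1+n (rest< (ℕ.<-trans j<i i<n-2))) λ eq → ℕ.<⇒≢ j<i (ℕ.+-cancelˡ-≡ 2 j i eq))
              (λ _ → comaximal-sym comaximal-1)

            Q⊥ψₙ³ : Comaximal Q ψₙ³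
            Q⊥ψₙ³ = comaximal-* (comaximal-* Q⊥ψₙ Q⊥ψₙ) Q⊥ψₙ
              where
              Q⊥ψₙ : Comaximal Q (ψ n)
              Q⊥ψₙ = comaximal-sym (comaximal-Π (n ℕ.∸ 2) λ i i<n-2 →
                ψ⊥select 0<n (ℕ.n<1+n n) (ℕ.m<n⇒m<1+n (rest< i<n-2)) (ℕ.<⇒≢ (rest< i<n-2)))

            -- An index that does not divide n contributes the factor 1 to `Q`, and modulo 1 any
            -- representation of f as a fraction will do.
            trivial-fraction : ∀ f → Fraction P.1# P.1# f
            trivial-fraction f = let x , s , eq = as-fraction f in fraction-1 x s eq

            ψ∣β : ∀ {e} → 1 < e → e < suc n → ψ e ∣ᴿ β e
            ψ∣β 1<e e≤n = ψ-divides-β ψ (suc n) factors (ℕ.<-trans ℕ.z<s 1<e) e≤n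

            ψ⊥β : ∀ {e} → 1 < e → e < suc n → ∀ m → ¬ (e ℕ.∣ m) → Comaximal (ψ e) (β m)
            ψ⊥β 1<e e≤n m e∤m = comaximal-β ψ (suc n) factors (ℕ.<-trans ℕ.z<s 1<e) e≤n e∤m divides-refl

            module Total (f : Carrier)
              (at-divisor : ∀ e → 1 < e → e < suc n → e ℕ.∣ n → Fraction (ψ e) (ψ e) f)
              (at-n : Fraction ψₙ³ ψₙ³ f)
              where

              at-rest : ∀ i → i < n ℕ.∸ 2 → Fraction (rest i) (rest i) f
              at-rest i i<n-2 = select-elim (λ z → Fraction z z f) {n} ψ (2 ℕ.+ i)
                (at-divisor (2 ℕ.+ i) (s≤s (s≤s z≤n)) (ℕ.m<n⇒m<1+n (rest< i<n-2)))
                (λ _ → trivial-fraction f)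

              total : Fraction modulus modulus f
              total = fraction-* Q⊥ψₙ³ (fraction-Π rest (n ℕ.∸ 2) (trivial-fraction f) rest⊥rest at-rest) at-n

            short-fraction : Fraction modulus modulus (Σ< (suc N) (term t) - closed-form t n N)
            short-fraction = Total.total _
              (λ e 1<e e≤n e∣n → let d⁻¹ , l , inv = d-inverse e∣n in
                local-short-sum e 1<e (ψ e) (ψ∣β 1<e e≤n) (ψ⊥β 1<e e≤n) d⁻¹ l inv t n N n-eq e∣n)
              (let d⁻¹ , l , inv = d-inverse ℕ.∣-refl in
                cubed-short-sum n 1<n (ψ n) (ψ∣β 1<n (ℕ.n<1+n n)) (ψ⊥β 1<n (ℕ.n<1+n n)) d⁻¹ l inv t N N<n n-eq t+dk≢0 d-n+dk≢0)

            long-fraction : Fraction modulus modulus (Σ< n (term t) - closed-form t n N)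
            long-fraction = Total.total _
              (λ e 1<e e≤n e∣n → let d⁻¹ , l , inv = d-inverse e∣n in
                local-long-sum e 1<e (ψ e) (ψ∣β 1<e e≤n) (ψ⊥β 1<e e≤n) d⁻¹ l inv t n N n-eq e∣n)
              (let d⁻¹ , l , inv = d-inverse ℕ.∣-refl in
                cubed-long-sum n 1<n (ψ n) (ψ∣β 1<n (ℕ.n<1+n n)) (ψ⊥β 1<n (ℕ.n<1+n n)) d⁻¹ l inv t N N<n n-eq t+dk≢0 d-n+dk≢0)

            fraction-resp : ∀ {b f g} → f ≈ g → Fraction b b f → Fraction b b g
            fraction-resp e (x , s , b⊥s , eq) = x , s , b⊥s , trans (*-congʳ (sym e)) eq

            module _ (m : ℤ) (m≡ : m ≡ ℤ.- t ℤ.* + N) where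

              short-sum : Fraction modulus modulus
                (Σᶠ {suc N} (λ k → (bracket (+ 2 ℤ.* + d ℤ.* + toℕ k ℤ.+ t) ⋆ ((poch (E t) (E (+ d)) (toℕ k) ↑ 4) ÷ (poch (E (+ d)) (E (+ d)) (toℕ k) ↑ 4)))
                      ⋆ E ((+ d ℤ.- + 2 ℤ.* t) ℤ.* + toℕ k))
                  ∸ (((poch (E (+ 2 ℤ.* t)) (E (+ d)) N ÷ poch (E (+ d)) (E (+ d)) N) ⋆ bracket (+ n)) ⋆ E m))
              short-sum = fraction-resp (difference≈ t n N m m≡ (suc N)) short-fraction

              long-sum : Fraction modulus modulus
                (Σᶠ {n} (λ k → (bracket (+ 2 ℤ.* + d ℤ.* + toℕ k ℤ.+ t) ⋆ ((poch (E t) (E (+ d)) (toℕ k) ↑ 4) ÷ (poch (E (+ d)) (E (+ d)) (toℕ k) ↑ 4)))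
                      ⋆ E ((+ d ℤ.- + 2 ℤ.* t) ℤ.* + toℕ k))
                  ∸ (((poch (E (+ 2 ℤ.* t)) (E (+ d)) N ÷ poch (E (+ d)) (E (+ d)) N) ⋆ bracket (+ n)) ⋆ E m))
              long-sum = fraction-resp (difference≈ t n N m m≡ n) long-fraction

            modulus≈ : ∀ {φ} → ι (ψ n) ≈ φ → ι modulus ≈ bracket (+ n) ⋆ (φ ↑ 2)
            modulus≈ {φ} e = begin
              ι (Q P.* ψₙ³)                              ≈⟨ trans (ι-* Q ψₙ³) (*-congˡ (trans (ι-* _ (ψ n)) (*-congʳ (ι-* (ψ n) (ψ n))))) ⟩
              ι Q * (ι (ψ n) * ι (ψ n) * ι (ψ n))        ≈⟨ solve 2 (λ x y → x :* (y :* y :* y) := x :* y :* (y :* y)) (ι Q) (ι (ψ n)) ⟩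
              ι Q * ι (ψ n) * (ι (ψ n) * ι (ψ n))        ≈⟨ *-cong bracket-n (*-cong e e) ⟩
              bracket (+ n) * (φ * φ)                    ≈⟨ *-congˡ (↑2≈ φ) ⟨
              bracket (+ n) * (φ ↑ 2)                    ≈⟨ ⋆≈ _ _ ⟨
              bracket (+ n) ⋆ (φ ↑ 2)                    ∎
              where
              β-split : β n P.≈ β 1 P.* (Q P.* ψ n)
              β-split = β-factorisation ψ n (λ m 0<m m<n → factors m 0<m (ℕ.m<n⇒m<1+n m<n)) 1<n (factors n 0<n (ℕ.n<1+n n))
              bracket-n : ι Q * ι (ψ n) ≈ bracket (+ n)
              bracket-n = sym (begin
                bracket (+ n)                            ≈⟨ bracket≈ (+ n) ⟩
                B (+ n) * iB 1ℤ                          ≈⟨ *-congʳ (trans (B≈ι n) (-‿cong (trans (ι-cong β-split) (trans (ι-* _ _) (*-congˡ (ι-* Q (ψ n))))))) ⟩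
                - (ι (β 1) * (ι Q * ι (ψ n))) * iB 1ℤ    ≈⟨ solve 3 (λ b x i → :- (b :* x) :* i := x :* (:- b :* i)) (ι (β 1)) (ι Q * ι (ψ n)) (iB 1ℤ) ⟩
                ι Q * ι (ψ n) * (- ι (β 1) * iB 1ℤ)      ≈⟨ *-congˡ (trans (*-congʳ (sym (B≈ι 1))) (B-inverse λ ())) ⟩
                ι Q * ι (ψ n) * 1#                       ≈⟨ *-identityʳ _ ⟩
                ι Q * ι (ψ n)                            ∎)

-- The commutative ring of polynomials

module PolynomialRing where

  open Defs.Polynomial
  open ≡ using (refl; sym; trans; cong; cong₂; module ≡-Reasoning)

  ≈-refl : ∀ {p} → p ≈ p
  ≈-refl = coeffwise λ _ → refl

  ≈-sym : ∀ {p r} → p ≈ r → r ≈ p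
  ≈-sym e = coeffwise λ k → sym (coeff≡ e k)

  ≈-trans : ∀ {p r s} → p ≈ r → r ≈ s → p ≈ s
  ≈-trans e e′ = coeffwise λ k → trans (coeff≡ e k) (coeff≡ e′ k)

  +-cong : ∀ {p p′ r r′} → p ≈ p′ → r ≈ r′ → p + r ≈ p′ + r′
  +-cong {p} {p′} {r} {r′} e e′ = coeffwise λ k →
    trans (coeff-+ p r k) (trans (cong₂ ℚ._+_ (coeff≡ e k) (coeff≡ e′ k)) (sym (coeff-+ p′ r′ k)))

  +-comm : ∀ p r → p + r ≈ r + p
  +-comm p r = coeffwise λ k →
    trans (coeff-+ p r k) (trans (ℚ.+-comm (coeff p k) (coeff r k)) (sym (coeff-+ r p k)))

  +-assoc : ∀ p r s → (p + r) + s ≈ p + (r + s)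
  +-assoc p r s = coeffwise λ k → begin
    coeff ((p + r) + s) k                    ≡⟨ coeff-+ (p + r) s k ⟩
    coeff (p + r) k ℚ.+ coeff s k            ≡⟨ cong (ℚ._+ coeff s k) (coeff-+ p r k) ⟩
    coeff p k ℚ.+ coeff r k ℚ.+ coeff s k    ≡⟨ ℚ.+-assoc (coeff p k) (coeff r k) (coeff s k) ⟩
    coeff p k ℚ.+ (coeff r k ℚ.+ coeff s k)  ≡⟨ cong (coeff p k ℚ.+_) (coeff-+ r s k) ⟨
    coeff p k ℚ.+ coeff (r + s) k            ≡⟨ coeff-+ p (r + s) k ⟨
    coeff (p + (r + s)) k                    ∎
    where open ≡-Reasoning

  +-identityʳ : ∀ p → p + 0ₚ ≈ p
  +-identityʳ p = +-comm p 0ₚ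

  coeff-neg : ∀ p k → coeff (- p) k ≡ ℚ.- coeff p k
  coeff-neg []      k       = refl
  coeff-neg (a ∷ p) zero    = refl
  coeff-neg (a ∷ p) (suc k) = coeff-neg p k

  neg-cong : ∀ {p r} → p ≈ r → - p ≈ - r
  neg-cong {p} {r} e = coeffwise λ k →
    trans (coeff-neg p k) (trans (cong ℚ.-_ (coeff≡ e k)) (sym (coeff-neg r k)))

  +-inverseʳ : ∀ p → p + - p ≈ 0ₚ
  +-inverseʳ p = coeffwise λ k → trans (coeff-+ p (- p) k)
    (trans (cong (coeff p k ℚ.+_) (coeff-neg p k)) (ℚ.+-inverseʳ (coeff p k)))

  scale-cong : ∀ a {p r} → p ≈ r → scale a p ≈ scale a r
  scale-cong a {p} {r} e = coeffwise λ k →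
    trans (coeff-scale a p k) (trans (cong (a ℚ.*_) (coeff≡ e k)) (sym (coeff-scale a r k)))

  scale-+ : ∀ a p r → scale a (p + r) ≈ scale a p + scale a r
  scale-+ a p r = coeffwise λ k → begin
    coeff (scale a (p + r)) k                      ≡⟨ coeff-scale a (p + r) k ⟩
    a ℚ.* coeff (p + r) k                          ≡⟨ cong (a ℚ.*_) (coeff-+ p r k) ⟩
    a ℚ.* (coeff p k ℚ.+ coeff r k)                ≡⟨ ℚ.*-distribˡ-+ a _ _ ⟩
    a ℚ.* coeff p k ℚ.+ a ℚ.* coeff r k            ≡⟨ cong₂ ℚ._+_ (coeff-scale a p k) (coeff-scale a r k) ⟨
    coeff (scale a p) k ℚ.+ coeff (scale a r) k    ≡⟨ coeff-+ (scale a p) (scale a r) k ⟨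
    coeff (scale a p + scale a r) k                ∎
    where open ≡-Reasoning

  +-scale : ∀ a b p → scale (a ℚ.+ b) p ≈ scale a p + scale b p
  +-scale a b p = coeffwise λ k → begin
    coeff (scale (a ℚ.+ b) p) k                    ≡⟨ coeff-scale (a ℚ.+ b) p k ⟩
    (a ℚ.+ b) ℚ.* coeff p k                        ≡⟨ ℚ.*-distribʳ-+ (coeff p k) a b ⟩
    a ℚ.* coeff p k ℚ.+ b ℚ.* coeff p k            ≡⟨ cong₂ ℚ._+_ (coeff-scale a p k) (coeff-scale b p k) ⟨
    coeff (scale a p) k ℚ.+ coeff (scale b p) k    ≡⟨ coeff-+ (scale a p) (scale b p) k ⟨
    coeff (scale a p + scale b p) k                ∎
    where open ≡-Reasoning

  scale-scale : ∀ a b p → scale (a ℚ.* b) p ≈ scale a (scale b p)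
  scale-scale a b p = coeffwise λ k → begin
    coeff (scale (a ℚ.* b) p) k      ≡⟨ coeff-scale (a ℚ.* b) p k ⟩
    a ℚ.* b ℚ.* coeff p k            ≡⟨ ℚ.*-assoc a b _ ⟩
    a ℚ.* (b ℚ.* coeff p k)          ≡⟨ cong (a ℚ.*_) (coeff-scale b p k) ⟨
    a ℚ.* coeff (scale b p) k        ≡⟨ coeff-scale a (scale b p) k ⟨
    coeff (scale a (scale b p)) k    ∎
    where open ≡-Reasoning

  scale-1 : ∀ p → scale 1ℚ p ≈ p
  scale-1 p = coeffwise λ k → trans (coeff-scale 1ℚ p k) (ℚ.*-identityˡ _)

  shift-cong : ∀ {p r} → p ≈ r → 0ℚ ∷ p ≈ 0ℚ ∷ r
  shift-cong e = coeffwise λ { zero → refl ; (suc k) → coeff≡ e k }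

  shift-scale : ∀ a p → scale a (0ℚ ∷ p) ≈ 0ℚ ∷ scale a p
  shift-scale a p = coeffwise λ { zero → ℚ.*-zeroʳ a ; (suc k) → refl }

  interchange : ∀ p r s u → (p + r) + (s + u) ≈ (p + s) + (r + u)
  interchange p r s u = coeffwise λ k → begin
    coeff ((p + r) + (s + u)) k
      ≡⟨ trans (coeff-+ (p + r) (s + u) k) (cong₂ ℚ._+_ (coeff-+ p r k) (coeff-+ s u k)) ⟩
    (coeff p k ℚ.+ coeff r k) ℚ.+ (coeff s k ℚ.+ coeff u k)
      ≡⟨ medial (coeff p k) _ _ _ ⟩
    (coeff p k ℚ.+ coeff s k) ℚ.+ (coeff r k ℚ.+ coeff u k)
      ≡⟨ trans (coeff-+ (p + s) (r + u) k) (cong₂ ℚ._+_ (coeff-+ p s k) (coeff-+ r u k)) ⟨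
    coeff ((p + s) + (r + u)) k  ∎
    where
    open ≡-Reasoning
    open Algebra.Properties.CommutativeSemigroup (CommutativeRing.+-commutativeSemigroup ℚ.+-*-commutativeRing)
      using () renaming (interchange to medial)

  *-congˡ : ∀ p {r s} → r ≈ s → p * r ≈ p * s
  *-congˡ []      e = ≈-refl
  *-congˡ (a ∷ p) e = +-cong (scale-cong a e) (shift-cong (*-congˡ p e))

  *-zeroʳ : ∀ p → p * 0ₚ ≈ 0ₚ
  *-zeroʳ []      = ≈-refl
  *-zeroʳ (a ∷ p) = coeffwise λ { zero → refl ; (suc k) → coeff≡ (*-zeroʳ p) k }

  -- Multiplication recurses on its left argument; this mirror image for the right argument yields
  -- commutativity.
  *-∷ : ∀ p b r → p * (b ∷ r) ≈ scale b p + (0ℚ ∷ (p * r))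
  *-∷ []      b r = coeffwise λ { zero → refl ; (suc k) → refl }
  *-∷ (a ∷ p) b r = coeffwise λ
    { zero → cong (ℚ._+ 0ℚ) (ℚ.*-comm a b)
    ; (suc k) → coeff≡ (≈-trans (+-cong (≈-refl {scale a r}) (*-∷ p b r))
        (≈-trans (≈-sym (+-assoc (scale a r) (scale b p) (0ℚ ∷ (p * r))))
        (≈-trans (+-cong (+-comm (scale a r) (scale b p)) (≈-refl {0ℚ ∷ (p * r)}))
          (+-assoc (scale b p) (scale a r) (0ℚ ∷ (p * r)))))) k
    }

  *-comm : ∀ p r → p * r ≈ r * p
  *-comm []      r = ≈-sym (*-zeroʳ r)
  *-comm (a ∷ p) r = ≈-trans (+-cong ≈-refl (shift-cong (*-comm p r))) (≈-sym (*-∷ r a p))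

  *-cong : ∀ {p p′ r r′} → p ≈ p′ → r ≈ r′ → p * r ≈ p′ * r′
  *-cong {p} {p′} {r} {r′} e e′ =
    ≈-trans (*-congˡ p e′) (≈-trans (*-comm p r′) (≈-trans (*-congˡ r′ e) (*-comm r′ p′)))

  *-distribʳ : ∀ s p r → (p + r) * s ≈ p * s + r * s
  *-distribʳ s []      r       = ≈-refl
  *-distribʳ s (a ∷ p) []      = ≈-sym (+-identityʳ _)
  *-distribʳ s (a ∷ p) (b ∷ r) = ≈-trans
    (+-cong (+-scale a b s) (shift-cong (*-distribʳ s p r)))
    (interchange (scale a s) (scale b s) (0ℚ ∷ (p * s)) (0ℚ ∷ (r * s)))

  *-distribˡ : ∀ s p r → s * (p + r) ≈ s * p + s * r
  *-distribˡ s p r = ≈-trans (*-comm s (p + r))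
    (≈-trans (*-distribʳ s p r) (+-cong (*-comm p s) (*-comm r s)))

  scale-* : ∀ a p r → scale a p * r ≈ scale a (p * r)
  scale-* a []      r = ≈-refl
  scale-* a (b ∷ p) r = ≈-trans
    (+-cong (scale-scale a b r) (≈-trans (shift-cong (scale-* a p r)) (≈-sym (shift-scale a (p * r)))))
    (≈-sym (scale-+ a (scale b r) (0ℚ ∷ (p * r))))

  *-assoc : ∀ p r s → (p * r) * s ≈ p * (r * s)
  *-assoc []      r s = ≈-refl
  *-assoc (a ∷ p) r s = ≈-trans (*-distribʳ s (scale a r) (0ℚ ∷ (p * r)))
    (+-cong (scale-* a r s) (≈-trans (coeffwise (0∷-*ˡ (p * r) s)) (shift-cong (*-assoc p r s))))

  *-identityˡ : ∀ p → 1ₚ * p ≈ p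
  *-identityˡ p = ≈-trans (+-cong (scale-1 p) (∷-≈0 refl ≈-refl)) (+-identityʳ p)

  polynomialRing : CommutativeRing 0ℓ 0ℓ
  polynomialRing = record
    { Carrier = Poly ; _≈_ = _≈_ ; _+_ = _+_ ; _*_ = _*_ ; -_ = -_ ; 0# = 0ₚ ; 1# = 1ₚ
    ; isCommutativeRing = record
      { isRing = record
        { +-isAbelianGroup = record
          { isGroup = record
            { isMonoid = record
              { isSemigroup = record
                { isMagma = record
                  { isEquivalence = record { refl = ≈-refl ; sym = ≈-sym ; trans = ≈-trans }
                  ; ∙-cong = +-cong }
                ; assoc = +-assoc }
              ; identity = (λ _ → ≈-refl) , +-identityʳ }
            ; inverse = (λ p → ≈-trans (+-comm (- p) p) (+-inverseʳ p)) , +-inverseʳ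
            ; ⁻¹-cong = neg-cong }
          ; comm = +-comm }
        ; *-cong = *-cong
        ; *-assoc = *-assoc
        ; *-identity = *-identityˡ , λ p → ≈-trans (*-comm p 1ₚ) (*-identityˡ p)
        ; distrib = *-distribˡ , *-distribʳ }
      ; *-comm = *-comm } }

open PolynomialRing using (polynomialRing)

-- The field of rational functions

module FractionField where

  open Defs

  private
    module P where
      open Polynomial public using (1≉0; *-≉0; integral; _≈0?; 0ₚ)
      open CommutativeRing polynomialRing public
    open RingSolver polynomialRing
    open Relation.Binary.Reasoning.Setoid P.setoid

  *-cancelʳ : ∀ {p r s} → ¬ (s P.≈ P.0#) → p P.* s P.≈ r P.* s → p P.≈ r
  *-cancelʳ {p} {r} {s} s≉0 eq = [ p-r≈0 , (λ s≈0 → contradiction s≈0 s≉0) ]′ (P.integral (p P.- r) s (begin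
    (p P.- r) P.* s          ≈⟨ solve 3 (λ p r s → (p :- r) :* s := p :* s :- r :* s) p r s ⟩
    p P.* s P.- r P.* s      ≈⟨ P.+-congʳ eq ⟩
    r P.* s P.- r P.* s      ≈⟨ P.-‿inverseʳ (r P.* s) ⟩
    P.0#                     ∎))
    where
    p-r≈0 : p P.- r P.≈ P.0# → p P.≈ r
    p-r≈0 e = begin
      p                  ≈⟨ solve 2 (λ p r → p := (p :- r) :+ r) p r ⟩
      (p P.- r) P.+ r    ≈⟨ P.+-congʳ e ⟩
      P.0# P.+ r         ≈⟨ P.+-identityˡ r ⟩
      r                  ∎

  ≈-refl : ∀ {f} → f ≈ f
  ≈-refl = cross P.refl

  ≈-sym : ∀ {f g} → f ≈ g → g ≈ f
  ≈-sym (cross e) = cross (P.sym e)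

  -- The cross-multiplied equations combine only after multiplication by the middle denominator,
  -- which cancels in an integral domain.
  ≈-trans : ∀ {f g h} → f ≈ g → g ≈ h → f ≈ h
  ≈-trans {a / b [ _ ]} {c / d [ d≉0 ]} {x / y [ _ ]} (cross e) (cross e′) = cross (*-cancelʳ d≉0 (begin
    a P.* y P.* d      ≈⟨ solve 3 (λ a y d → a :* y :* d := (a :* d) :* y) a y d ⟩
    (a P.* d) P.* y    ≈⟨ P.*-congʳ e ⟩
    (c P.* b) P.* y    ≈⟨ solve 3 (λ c b y → (c :* b) :* y := (c :* y) :* b) c b y ⟩
    (c P.* y) P.* b    ≈⟨ P.*-congʳ e′ ⟩
    (x P.* d) P.* b    ≈⟨ solve 3 (λ x d b → (x :* d) :* b := x :* b :* d) x d b ⟩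
    x P.* b P.* d      ∎))

  +-cong : ∀ {f f′ g g′} → f ≈ f′ → g ≈ g′ → f + g ≈ f′ + g′
  +-cong {a / b [ _ ]} {a′ / b′ [ _ ]} {c / d [ _ ]} {c′ / d′ [ _ ]} (cross e) (cross e′) = cross (begin
    (a P.* d P.+ c P.* b) P.* (b′ P.* d′)
      ≈⟨ solve 6 (λ a b c d b′ d′ → (a :* d :+ c :* b) :* (b′ :* d′) := (a :* b′) :* (d :* d′) :+ (c :* d′) :* (b :* b′)) a b c d b′ d′ ⟩
    (a P.* b′) P.* (d P.* d′) P.+ (c P.* d′) P.* (b P.* b′)
      ≈⟨ P.+-cong (P.*-congʳ e) (P.*-congʳ e′) ⟩
    (a′ P.* b) P.* (d P.* d′) P.+ (c′ P.* d) P.* (b P.* b′)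
      ≈⟨ solve 6 (λ a′ b c′ d b′ d′ → (a′ :* b) :* (d :* d′) :+ (c′ :* d) :* (b :* b′) := (a′ :* d′ :+ c′ :* b′) :* (b :* d)) a′ b c′ d b′ d′ ⟩
    (a′ P.* d′ P.+ c′ P.* b′) P.* (b P.* d) ∎)

  *-cong : ∀ {f f′ g g′} → f ≈ f′ → g ≈ g′ → f * g ≈ f′ * g′
  *-cong {a / b [ _ ]} {a′ / b′ [ _ ]} {c / d [ _ ]} {c′ / d′ [ _ ]} (cross e) (cross e′) = cross (begin
    (a P.* c) P.* (b′ P.* d′)    ≈⟨ medial a c b′ d′ ⟩
    (a P.* b′) P.* (c P.* d′)    ≈⟨ P.*-cong e e′ ⟩
    (a′ P.* b) P.* (c′ P.* d)    ≈⟨ medial a′ b c′ d ⟩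
    (a′ P.* c′) P.* (b P.* d)    ∎)
    where
    medial = solve 4 λ x y z w → (x :* y) :* (z :* w) := (x :* z) :* (y :* w)

  neg-cong : ∀ {f g} → f ≈ g → - f ≈ - g
  neg-cong {a / b [ _ ]} {c / d [ _ ]} (cross e) = cross (begin
    P.- a P.* d      ≈⟨ solve 2 (λ a d → :- a :* d := :- (a :* d)) a d ⟩
    P.- (a P.* d)    ≈⟨ P.-‿cong e ⟩
    P.- (c P.* b)    ≈⟨ solve 2 (λ a d → :- (a :* d) := :- a :* d) c b ⟩
    P.- c P.* b      ∎)

  fractionField : CommutativeRing 0ℓ 0ℓ
  fractionField = record
    { Carrier = RatFun ; _≈_ = _≈_ ; _+_ = _+_ ; _*_ = _*_ ; -_ = -_ ; 0# = 0# ; 1# = 1#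
    ; isCommutativeRing = record
      { isRing = record
        { +-isAbelianGroup = record
          { isGroup = record
            { isMonoid = record
              { isSemigroup = record
                { isMagma = record
                  { isEquivalence = record { refl = ≈-refl ; sym = ≈-sym ; trans = ≈-trans }
                  ; ∙-cong = +-cong }
                ; assoc = λ (a / b [ _ ]) (c / d [ _ ]) (x / y [ _ ]) → cross (solve 6 (λ a b c d x y →
                    ((a :* d :+ c :* b) :* y :+ x :* (b :* d)) :* (b :* (d :* y))
                      := (a :* (d :* y) :+ (c :* y :+ x :* d) :* b) :* (b :* d :* y)) a b c d x y) }
              ; identity = (λ (a / b [ _ ]) → cross (solve 2 (λ a b → (:0 :* b :+ a :* :1) :* b := a :* (:1 :* b)) a b))
                         , (λ (a / b [ _ ]) → cross (solve 2 (λ a b → (a :* :1 :+ :0 :* b) :* b := a :* (b :* :1)) a b)) }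
            ; inverse = (λ (a / b [ _ ]) → cross (solve 2 (λ a b → (:- a :* b :+ a :* b) :* :1 := :0 :* (b :* b)) a b))
                      , (λ (a / b [ _ ]) → cross (solve 2 (λ a b → (a :* b :+ :- a :* b) :* :1 := :0 :* (b :* b)) a b))
            ; ⁻¹-cong = neg-cong }
          ; comm = λ (a / b [ _ ]) (c / d [ _ ]) → cross (solve 4 (λ a b c d →
              (a :* d :+ c :* b) :* (d :* b) := (c :* b :+ a :* d) :* (b :* d)) a b c d) }
        ; *-cong = *-cong
        ; *-assoc = λ (a / b [ _ ]) (c / d [ _ ]) (x / y [ _ ]) → cross (solve 6 (λ a b c d x y →
            a :* c :* x :* (b :* (d :* y)) := a :* (c :* x) :* (b :* d :* y)) a b c d x y)
        ; *-identity = (λ (a / b [ _ ]) → cross (solve 2 (λ a b → :1 :* a :* b := a :* (:1 :* b)) a b))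
                     , (λ (a / b [ _ ]) → cross (solve 2 (λ a b → a :* :1 :* b := a :* (b :* :1)) a b))
        ; distrib = (λ (x / y [ _ ]) (a / b [ _ ]) (c / d [ _ ]) → cross (solve 6 (λ a b c d x y →
              x :* (a :* d :+ c :* b) :* (y :* b :* (y :* d))
                := (x :* a :* (y :* d) :+ x :* c :* (y :* b)) :* (y :* (b :* d))) a b c d x y))
          , (λ (x / y [ _ ]) (a / b [ _ ]) (c / d [ _ ]) → cross (solve 6 (λ a b c d x y →
              (a :* d :+ c :* b) :* x :* (b :* y :* (d :* y))
                := (a :* x :* (d :* y) :+ c :* x :* (b :* y)) :* (b :* d :* y)) a b c d x y)) }
      ; *-comm = λ (a / b [ _ ]) (c / d [ _ ]) → cross (solve 4 (λ a b c d →
          a :* c :* (d :* b) := c :* a :* (b :* d)) a b c d) } }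

  ⁻¹-inverseʳ : ∀ f → ¬ (f ≈ 0#) → f * f ⁻¹ ≈ 1#
  ⁻¹-inverseʳ f@(a / b [ _ ]) f≉0 with Polynomial._≈0? a
  ... | yes a≈0 = contradiction (cross (begin
    a P.* P.1#    ≈⟨ P.*-identityʳ a ⟩
    a             ≈⟨ a≈0 ⟩
    P.0#          ∎)) f≉0
  ... | no  a≉0 = cross (solve 2 (λ a b → a :* b :* :1 := :1 :* (b :* a)) a b)

  fromPoly-cong : ∀ {p r} → p P.≈ r → fromPoly p ≈ fromPoly r
  fromPoly-cong e = cross (P.*-congʳ e)

  fromPoly-injective : ∀ {p r} → fromPoly p ≈ fromPoly r → p P.≈ r
  fromPoly-injective {p} {r} (cross e) = P.trans (P.sym (P.*-identityʳ p)) (P.trans e (P.*-identityʳ r))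

  fromPoly-+ : ∀ p r → fromPoly (p P.+ r) ≈ fromPoly p + fromPoly r
  fromPoly-+ p r = cross (solve 2 (λ p r → (p :+ r) :* (:1 :* :1) := (p :* :1 :+ r :* :1) :* :1) p r)

  fromPoly-* : ∀ p r → fromPoly (p P.* r) ≈ fromPoly p * fromPoly r
  fromPoly-* p r = cross (solve 2 (λ p r → p :* r :* (:1 :* :1) := p :* r :* :1) p r)

  fromPoly-neg : ∀ p → fromPoly (P.- p) ≈ - fromPoly p
  fromPoly-neg p = cross P.refl

  *-den : ∀ f → f * fromPoly (den f) ≈ fromPoly (num f)
  *-den (a / b [ _ ]) = cross (solve 2 (λ a b → a :* b :* :1 := a :* (b :* :1)) a b)

open FractionField using (fractionField)

-- Powers of X and invertible integers

module PolynomialPowers where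

  open Defs.Polynomial using (Poly; coeff; coeff≡; coeffwise; 1≉0)
  open CommutativeRing polynomialRing

  X : Poly
  X = 0ℚ ∷ 1ℚ ∷ []

  open PowersMinusOne polynomialRing X
  open Algebra.Properties.Semiring.Exp semiring using (_^_)

  const-* : ∀ a b → (a ∷ []) * (b ∷ []) ≈ (a ℚ.* b) ∷ []
  const-* a b = coeffwise λ { zero → ℚ.+-identityʳ (a ℚ.* b) ; (suc k) → ≡.refl }

  fromℕ : ℕ → ℚ
  fromℕ zero    = 0ℚ
  fromℕ (suc k) = 1ℚ ℚ.+ fromℕ k

  fromℕ≥0 : ∀ k → 0ℚ ℚ.≤ fromℕ k
  fromℕ≥0 zero    = ℚ.≤-refl
  fromℕ≥0 (suc k) = ℚ.≤-trans (fromℕ≥0 k) (ℚ.≤-trans (ℚ.≤-reflexive (≡.sym (ℚ.+-identityˡ (fromℕ k))))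
    (ℚ.+-monoˡ-≤ (fromℕ k) (ℚ.nonNegative⁻¹ 1ℚ)))

  fromℕ≢0 : ∀ k → fromℕ (suc k) ≢ 0ℚ
  fromℕ≢0 k eq = ℚ.<⇒≢ (ℚ.<-≤-trans (ℚ.positive⁻¹ 1ℚ)
    (ℚ.≤-trans (ℚ.≤-reflexive (≡.sym (ℚ.+-identityʳ 1ℚ))) (ℚ.+-monoʳ-≤ 1ℚ (fromℕ≥0 k)))) (≡.sym eq)

  ·≈const : ∀ k → k · 1# ≈ fromℕ k ∷ []
  ·≈const zero    = coeffwise λ { zero → ≡.refl ; (suc k) → ≡.refl }
  ·≈const (suc k) = trans (+-congˡ {1#} (·≈const k)) (coeffwise λ { zero → ≡.refl ; (suc _) → ≡.refl })

  ℕ-invertible : ∀ k → 0 < k → ∃ λ u → u * (k · 1#) ≈ 1#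
  ℕ-invertible (suc k) _ = ℚ.1/ fromℕ (suc k) ∷ [] ,
    trans (*-congˡ {ℚ.1/ fromℕ (suc k) ∷ []} (·≈const (suc k)))
      (trans (const-* (ℚ.1/ fromℕ (suc k)) (fromℕ (suc k)))
        (coeffwise λ { zero → ℚ.*-inverseˡ (fromℕ (suc k)) ; (suc _) → ≡.refl }))
    where instance _ = ℚ.≢-nonZero (fromℕ≢0 k)

  X^-constant : ∀ m → coeff (X ^ suc m) 0 ≡ 0ℚ
  X^-constant m = Defs.Polynomial.0∷-*ˡ (1ℚ ∷ []) (X ^ m) 0

  -- The constant coefficient is -1.
  β≉0 : ∀ {m} → 0 < m → ¬ (β m ≈ 0#)
  β≉0 {suc m} _ eq with () ← ≡.trans (≡.sym (≡.trans (Defs.Polynomial.coeff-+ (X ^ suc m) (- 1#) 0) (≡.cong (ℚ._+ ℚ.- 1ℚ) (X^-constant m)))) (coeff≡ eq 0)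

  β-cancel : ∀ {m} a b → 0 < m → a * β m ≈ b * β m → a ≈ b
  β-cancel a b 0<m = FractionField.*-cancelʳ (β≉0 0<m)

  X≉0 : ¬ (X ≈ 0#)
  X≉0 eq with () ← coeff≡ eq 1

  X^≉0 : ∀ m → ¬ (X ^ m ≈ 0#)
  X^≉0 zero    = 1≉0
  X^≉0 (suc m) = Defs.Polynomial.*-≉0 X≉0 (X^≉0 m)

-- Powers of q and inverses of 1 - q^m

module RationalPowers where

  open Defs
  open FractionField using (⁻¹-inverseʳ; fromPoly-cong; fromPoly-injective; fromPoly-+; fromPoly-*; fromPoly-neg)
  open PolynomialPowers
  private
    module K = CommutativeRing fractionField
    module P = CommutativeRing polynomialRing
  open PowersMinusOne polynomialRing X
  open Algebra.Properties.Semiring.Exp P.semiring using () renaming (_^_ to _^ᴾ_)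
  open RingSolver fractionField
  open RingKit fractionField
  open Relation.Binary.Reasoning.Setoid K.setoid

  fromPoly-1 : fromPoly P.1# ≈ 1#
  fromPoly-1 = K.refl

  fromPoly≉0 : ∀ {p} → ¬ (p P.≈ P.0#) → ¬ (fromPoly p ≈ 0#)
  fromPoly≉0 p≉0 eq = p≉0 (fromPoly-injective eq)

  q^≈ : ∀ m → fromPoly (X ^ᴾ m) ≈ q ^ m
  q^≈ zero    = K.refl
  q^≈ (suc m) = K.trans (fromPoly-* X (X ^ᴾ m)) (K.*-congˡ {q} (q^≈ m))

  q^≉0 : ∀ m → ¬ (q ^ m ≈ 0#)
  q^≉0 m eq = fromPoly≉0 {X ^ᴾ m} (X^≉0 m) (K.trans (q^≈ m) eq)

  q^-negative : ∀ m → q^ -[1+ m ] * q ^ suc m ≈ 1#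
  q^-negative m = K.trans (K.*-comm ((q ^ suc m) ⁻¹) (q ^ suc m)) (⁻¹-inverseʳ (q ^ suc m) (q^≉0 (suc m)))

  inverse-unique : ∀ {f g} → f * g ≈ 1# → f ⁻¹ ≈ g
  inverse-unique {f} {g} e = combine₂ (- f ⁻¹) e g (⁻¹-inverseʳ f f≉0)
    (solve 3 (λ f f′ g → f′ := g :+ :- f′ :* (f :* g :- :1) :+ g :* (f :* f′ :- :1)) f (f ⁻¹) g)
    where
    f≉0 : ¬ (f ≈ 0#)
    f≉0 eq = fromPoly≉0 {P.1#} Polynomial.1≉0 (K.trans {1#} (K.sym {f * g} e) (K.trans {f * g} {0# * g} (K.*-congʳ {g} {f} {0#} eq) (K.zeroˡ g)))

  numerator≉0 : ∀ {f g} → f ≈ g → ¬ (num f P.≈ P.0#) → ¬ (num g P.≈ P.0#)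
  numerator≉0 {f} {g} eq f≉0 g≈0 = Polynomial.*-≉0 f≉0 (den≉0 g)
    (P.trans (cross≈ eq) (P.trans (P.*-congʳ {den f} g≈0) (P.zeroˡ (den f))))

  -- The inverse branches on the numerator of a representative; equal fractions agree on whether it
  -- is zero.
  ⁻¹-cong : ∀ {f g} → f ≈ g → f ⁻¹ ≈ g ⁻¹
  ⁻¹-cong {f} {g} eq with Polynomial._≈0? (num f) | Polynomial._≈0? (num g)
  ... | yes _   | yes _   = K.refl
  ... | no  _   | no  _   = cross (P.trans (P.*-comm (den f) (num g)) (P.trans (P.sym (cross≈ eq)) (P.*-comm (num f) (den g))))
  ... | yes f≈0 | no  g≉0 = contradiction f≈0 (numerator≉0 {g} {f} (K.sym eq) g≉0)
  ... | no  f≉0 | yes g≈0 = contradiction g≈0 (numerator≉0 {f} {g} eq f≉0)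

  q^-one : ∀ m → q^ (+ m) ≈ 1# → β m P.≈ P.0#
  q^-one m eq = fromPoly-injective (begin
    fromPoly (β m)                                  ≈⟨ fromPoly-+ (X ^ᴾ m) (P.- P.1#) ⟩
    fromPoly (X ^ᴾ m) + fromPoly (P.- P.1#)         ≈⟨ K.+-cong (K.trans (q^≈ m) eq) (fromPoly-neg P.1#) ⟩
    1# - 1#                                         ≈⟨ K.-‿inverseʳ 1# ⟩
    0#                                              ∎)

  1-q^ : ℤ → RatFun
  1-q^ m = (1# - q^ m) ⁻¹

  B-inverse : ∀ {m} → m ≢ 0ℤ → (1# - q^ m) * 1-q^ m ≈ 1#
  B-inverse {m} m≢0 = ⁻¹-inverseʳ (1# - q^ m) (nonzero m m≢0)
    where
    move : ∀ {f} → 1# - f ≈ 0# → f ≈ 1#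
    move {f} eq = combine₁ (- 1#) eq (solve 1 (λ f → f := :1 :+ :- :1 :* (:1 :- f :- :0)) f)
    nonzero : ∀ m → m ≢ 0ℤ → ¬ (1# - q^ m ≈ 0#)
    nonzero (+ zero)  m≢0 _  = m≢0 ≡.refl
    nonzero (+ suc k) _   eq = β≉0 {suc k} ℕ.z<s (q^-one (suc k) (move {q ^ suc k} eq))
    -- Multiplying q^(-(k+1)) = 1 by q^(k+1) leads back to the positive case.
    nonzero -[1+ k ]  _   eq = β≉0 {suc k} ℕ.z<s (q^-one (suc k) (K.trans (K.sym {1# * q ^ suc k} (K.*-identityˡ (q ^ suc k)))
      (K.trans (K.*-congʳ {q ^ suc k} {1#} {q^ -[1+ k ]} (K.sym {q^ -[1+ k ]} {1#} (move {q^ -[1+ k ]} eq))) (q^-negative k))))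

-- Integer arithmetic of the hypotheses

module IntegerArithmetic where

  open import Data.Integer.Base using (_+_; _-_; -_; _*_)
  open import Data.Integer.Divisibility using (_∣_)
  open ≡ using (refl; sym; trans; cong; subst; subst₂)
  open ≡.≡-Reasoning

  small-multiple : ∀ {d} r → d ℕ.∣ r → r ℕ.< d → r ≡ 0
  small-multiple zero    _ _   = refl
  small-multiple (suc k) p r<d = contradiction p (ℕ.>⇒∤ r<d)

  /ℕ-exact : ∀ a d .{{_ : NonZero d}} → (a * + d) ℤ./ℕ d ≡ a
  /ℕ-exact a d = sym (ℤ.*-cancelʳ-≡ a q (+ d) (trans (ℤ.a≡a%ℕn+[a/ℕn]*n (a * + d) d)
    (trans (cong (λ z → + z + q * + d) r≡0) (ℤ.+-identityˡ (q * + d)))))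
    where
    q : ℤ
    q = (a * + d) ℤ./ℕ d
    r : ℕ
    r = (a * + d) ℤ.%ℕ d
    d∣r : d ℕ.∣ r
    d∣r = ∣⇒∣ᵤ {+ d} {+ r} (divides (a - q) (begin
      + r                              ≡⟨ cancel (+ r) (q * + d) ⟩
      + r + q * + d - q * + d          ≡⟨ cong (_- q * + d) (ℤ.a≡a%ℕn+[a/ℕn]*n (a * + d) d) ⟨
      a * + d - q * + d                ≡⟨ collect a q (+ d) ⟩
      (a - q) * + d                    ∎))
      where
      cancel : ∀ r x → r ≡ r + x - x
      cancel = solve-∀
      collect : ∀ a q d → a * d - q * d ≡ (a - q) * d
      collect = solve-∀
    r≡0 : r ≡ 0
    r≡0 = small-multiple r d∣r (ℤ.n%ℕd<d (a * + d) d)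

  -- The gcd of integers is that of absolute values, so the Bézout coefficient of t has to absorb
  -- its sign.
  abs-multiple : ∀ t → ∃ λ s → + ∣ t ∣ ≡ s * t
  abs-multiple (+ n)    = 1ℤ , sym (ℤ.*-identityˡ (+ n))
  abs-multiple -[1+ n ] = ℤ.-1ℤ , sym (ℤ.-1*i≡-i -[1+ n ])

  bézout : ∀ t d → gcd t (+ d) ≡ 1ℤ → ∃₂ λ x y → x * t + y * + d ≡ 1ℤ
  bézout t d eq with s , es ← abs-multiple t | ℕ.Bézout.identity (subst (ℕ.GCD ∣ t ∣ d) (ℤ.+-injective eq) (ℕ.gcd-GCD ∣ t ∣ d))
  ... | ℕ.Bézout.+- a b e = + a * s , - (+ b) , (begin
    + a * s * t + - (+ b) * + d              ≡⟨ rearrange (+ a) s t (+ b) (+ d) ⟩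
    + a * (s * t) - + b * + d                ≡⟨ cong (λ z → + a * z - + b * + d) es ⟨
    + a * + ∣ t ∣ - + b * + d                ≡⟨ cong (_- + b * + d) (trans (sym (ℤ.pos-* a ∣ t ∣)) (trans (cong +_ (sym e)) (cong (λ z → 1ℤ + z) (ℤ.pos-* b d)))) ⟩
    1ℤ + + b * + d - + b * + d               ≡⟨ cancel (+ b * + d) ⟩
    1ℤ                                       ∎)
    where
    rearrange : ∀ a s t b d → a * s * t + - b * d ≡ a * (s * t) - b * d
    rearrange = solve-∀
    cancel : ∀ x → 1ℤ + x - x ≡ 1ℤ
    cancel = solve-∀
  ... | ℕ.Bézout.-+ a b e = - (+ a * s) , + b , (begin
    - (+ a * s) * t + + b * + d              ≡⟨ rearrange (+ a) s t (+ b) (+ d) ⟩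
    + b * + d - + a * (s * t)                ≡⟨ cong (λ z → + b * + d - + a * z) es ⟨
    + b * + d - + a * + ∣ t ∣                ≡⟨ cong (_- + a * + ∣ t ∣) (trans (sym (ℤ.pos-* b d)) (trans (cong +_ (sym e)) (cong (λ z → 1ℤ + z) (ℤ.pos-* a ∣ t ∣)))) ⟩
    1ℤ + + a * + ∣ t ∣ - + a * + ∣ t ∣       ≡⟨ cancel (+ a * + ∣ t ∣) ⟩
    1ℤ                                       ∎)
    where
    rearrange : ∀ a s t b d → - (a * s) * t + b * d ≡ b * d - a * (s * t)
    rearrange = solve-∀
    cancel : ∀ x → 1ℤ + x - x ≡ 1ℤ
    cancel = solve-∀

  module _ (n d : ℕ) (t : ℤ) .{{_ : NonZero d}} (d∣n-t : + d ∣ + n - t) (t≤n : t ℤ.≤ + n) where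

    N : ℕ
    N = ∣ + n - t ∣ ℕ./ d

    n≡t+dN : + n ≡ t + + d * + N
    n≡t+dN = begin
      + n                      ≡⟨ expand (+ n) t ⟩
      t + (+ n - t)            ≡⟨ cong (λ z → t + z) (ℤ.0≤i⇒+∣i∣≡i (ℤ.i≤j⇒0≤j-i t≤n)) ⟨
      t + + ∣ + n - t ∣        ≡⟨ cong (λ z → t + + z) (ℕ.m/n*n≡m d∣n-t) ⟨
      t + + (N ℕ.* d)          ≡⟨ cong (λ z → t + + z) (ℕ.*-comm N d) ⟩
      t + + (d ℕ.* N)          ≡⟨ cong (λ z → t + z) (ℤ.pos-* d N) ⟩
      t + + d * + N            ∎
      where
      expand : ∀ n t → n ≡ t + (n - t)
      expand = solve-∀

    -- After adding n d - t, the lower bound on t reads d (N + 1) ≤ d n.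
    N<n : + n + + d - + n * + d ℤ.≤ t → N ℕ.< n
    N<n le = ℕ.*-cancelˡ-≤ d (ℤ.drop‿+≤+ (subst₂ ℤ._≤_ left right (ℤ.+-monoˡ-≤ (+ n * + d - t) le)))
      where
      left : + n + + d - + n * + d + (+ n * + d - t) ≡ + (d ℕ.* suc N)
      left = begin
        + n + + d - + n * + d + (+ n * + d - t)           ≡⟨ cancel (+ n) (+ d) (+ n * + d) t ⟩
        + n - t + + d                                     ≡⟨ cong (λ z → z - t + + d) n≡t+dN ⟩
        t + + d * + N - t + + d                           ≡⟨ collect t (+ d) (+ N) ⟩
        + d * (1ℤ + + N)                                  ≡⟨ ℤ.pos-* d (suc N) ⟨
        + (d ℕ.* suc N)                                   ∎
        where
        cancel : ∀ n d x t → n + d - x + (x - t) ≡ n - t + d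
        cancel = solve-∀
        collect : ∀ t d N → t + d * N - t + d ≡ d * (1ℤ + N)
        collect = solve-∀
      right : t + (+ n * + d - t) ≡ + (d ℕ.* n)
      right = trans (cancel t (+ n) (+ d)) (sym (ℤ.pos-* d n))
        where
        cancel : ∀ t n d → t + (n * d - t) ≡ d * n
        cancel = solve-∀

    -- t (t - n) = - t N d, so the division by d is exact.
    exponent : (t * (t - + n)) ℤ./ℕ d ≡ - t * + N
    exponent = trans (cong (ℤ._/ℕ d) (trans (cong (λ z → t * (t - z)) n≡t+dN) (rearrange t (+ d) (+ N)))) (/ℕ-exact (- t * + N) d)
      where
      rearrange : ∀ t d N → t * (t - (t + d * N)) ≡ - t * N * d
      rearrange = solve-∀

open import Data.Integer.Divisibility using (_∣_)
open import Defs

-- Cyclotomic polynomials and congruences as in the statement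

module RationalFunctions where

  open FractionField using (⁻¹-inverseʳ; fromPoly-cong; fromPoly-injective; fromPoly-+; fromPoly-*; fromPoly-neg; *-den)
  open PolynomialPowers
  open RationalPowers
  private
    module K = CommutativeRing fractionField
    module P = CommutativeRing polynomialRing
    module PB = RingKit polynomialRing
    module S = RingSolver polynomialRing
    module KB = RingKit fractionField
    module KE = Algebra.Properties.Semiring.Exp K.semiring
  open PowersMinusOne polynomialRing X
  open Comaximality polynomialRing
  open Algebra.Properties.Semiring.Exp P.semiring using () renaming (_^_ to _^ᴾ_)
  open Algebra.Properties.Monoid.Sum K.*-monoid using () renaming (sum-cong-≋ to product-cong)
  open LocalFractions polynomialRing fractionField fromPoly fromPoly-cong fromPoly-+ fromPoly-* fromPoly-neg fromPoly-1 using (Fraction)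

  if-cong : ∀ b {f g} → f ≈ g → (if b then f else 1#) ≈ (if b then g else 1#)
  if-cong true  e = e
  if-cong false e = K.refl

  selectΦ : ℕ → ℕ → RatFun
  selectΦ n e = if does (e ℕ.∣? n) then Φ e else 1#

  -- The recursive calls carry accessibility proofs inherited from n, while `Φ` starts afresh from
  -- `<-wellFounded`; the two values have to be identified.
  cyclotomic-irrelevant : ∀ n (a a′ : Acc _<_ n) → cyclotomic n a ≈ cyclotomic n a′
  cyclotomic-irrelevant n (acc rs) (acc rs′) = K.*-congˡ {q ^ n - 1#} (⁻¹-cong (product-cong {n} λ e →
    if-cong (does (toℕ e ℕ.∣? n)) (cyclotomic-irrelevant (toℕ e) (rs (toℕ<n e)) (rs′ (toℕ<n e)))))

  cyclotomic-recursion : ∀ n (a : Acc _<_ n) → cyclotomic n a ≈ (q ^ n - 1#) * KB.Π< n (selectΦ n) ⁻¹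
  cyclotomic-recursion n (acc rs) = K.*-congˡ {q ^ n - 1#} (⁻¹-cong (K.trans
    (product-cong {n} λ e → if-cong (does (toℕ e ℕ.∣? n)) (cyclotomic-irrelevant (toℕ e) (rs (toℕ<n e)) (<-wellFounded (toℕ e))))
    (KB.product≈Π (selectΦ n) n)))

  fromPoly-β : ∀ n → fromPoly (β n) ≈ q ^ n - 1#
  fromPoly-β n = K.trans (fromPoly-+ (X ^ᴾ n) (P.- P.1#)) (K.+-cong (q^≈ n) (fromPoly-neg P.1#))

  -- t cannot be zero because p is not, so `t ⁻¹` is a true inverse and not the default value.
  quotient-unique : ∀ {f g t p} → ¬ (p P.≈ P.0#) → fromPoly p ≈ g → f * t ≈ fromPoly p → f ≈ g * t ⁻¹
  quotient-unique {f} {g} {t} {p} p≉0 e eq = K.sym {g * t ⁻¹} {f} (KB.divide {g} {f} {t} {t ⁻¹}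
    (K.trans {g} (K.sym {fromPoly p} {g} e) (K.sym {f * t} {fromPoly p} eq)) (⁻¹-inverseʳ t t≉0))
    where
    t≉0 : ¬ (t ≈ 0#)
    t≉0 t≈0 = p≉0 (fromPoly-injective (K.trans {fromPoly p} {f * t} {0#} (K.sym {f * t} {fromPoly p} eq)
      (K.trans {f * t} {f * 0#} {0#} (K.*-congˡ {f} {t} {0#} t≈0) (K.zeroʳ f))))

  Φ-characterisation : ∀ n f → 0 < n → f * KB.Π< n (λ e → if does (e ℕ.∣? n) then Φ e else 1#) ≈ fromPoly (β n) → f ≈ Φ n
  Φ-characterisation n f 0<n eq = K.trans {f} {(q ^ n - 1#) * KB.Π< n (selectΦ n) ⁻¹} {Φ n}
    (quotient-unique {f} {q ^ n - 1#} {KB.Π< n (selectΦ n)} {β n} (β≉0 {n} 0<n) (fromPoly-β n) eq)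
    (K.sym {Φ n} (cyclotomic-recursion n (<-wellFounded n)))

  open CyclotomicSequence polynomialRing fractionField fromPoly fromPoly-cong fromPoly-+ fromPoly-* fromPoly-neg fromPoly-1
    X ℕ-invertible β-cancel Φ Φ-characterisation public

  bracket≈ : ∀ m → [ m ] ≈ (1# - q^ m) * 1-q^ 1ℤ
  bracket≈ m = K.*-congˡ {1# - q^ m} (⁻¹-cong {1# - q} {1# - q^ 1ℤ} (K.+-congˡ {1#} (K.-‿cong {q} {q ^ 1} (K.sym {q ^ 1} {q} (K.*-identityʳ q)))))

  poch≈ : ∀ x y k → ⟨ x ⨾ y ⟩ k ≈ KB.Π< k (λ j → 1# - x * y KE.^ j)
  poch≈ x y k = KB.product≈Π (λ j → 1# - x * y ^ j) k

  ÷≈ : ∀ f {g h} → g * h ≈ 1# → f ÷ g ≈ f * h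
  ÷≈ f {g} {h} e = K.*-congˡ {f} (inverse-unique {g} {h} e)

  square≈ : ∀ x → x ^ 2 ≈ x * x
  square≈ x = K.*-congˡ {x} (K.*-identityʳ x)

  fourth≈ : ∀ x → x ^ 4 ≈ (x * x) * (x * x)
  fourth≈ x = K.trans {x ^ 4} (K.sym (K.*-assoc x x (x ^ 2))) (K.*-congˡ {x * x} (square≈ x))

  as-fraction : ∀ f → ∃₂ λ p s → f * fromPoly s ≈ fromPoly p
  as-fraction f = num f , den f , *-den f

  quotient≈ : ∀ f {y s} (s≉0 : ¬ (s P.≈ P.0#)) → f * fromPoly s ≈ fromPoly y → (y / s [ s≉0 ]) ≈ f
  quotient≈ (a / b [ _ ]) {y} {s} _ (cross e) = cross (PB.combine₁ (P.- P.1#) e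
    (S.solve 4 (λ a b y s → y S.:* b S.:= a S.:* s S.:+ S.:- S.:1 S.:* (a S.:* s S.:* S.:1 S.:- y S.:* (b S.:* S.:1))) a b y s))

  -- A common divisor divides the Bézout combination u p + v s = 1.
  comaximal⇒coprime : ∀ {p s} → Comaximal p s → Polynomial.Coprime s p
  comaximal⇒coprime {p} {s} (u , v , e) {z} (RawMagma._,_ a az≈s) (RawMagma._,_ b bz≈p) = record
    { quotient = u P.* b P.+ v P.* a
    ; equality = PB.combine₃ P.1# e u bz≈p v az≈s (S.solve 7 (λ u v a b z p s → (u S.:* b S.:+ v S.:* a) S.:* z
        S.:= S.:1 S.:+ S.:1 S.:* (u S.:* p S.:+ v S.:* s S.:- S.:1) S.:+ u S.:* (b S.:* z S.:- p) S.:+ v S.:* (a S.:* z S.:- s)) u v a b z p s)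
    }

  Representable : RatFun → Poly → Set
  Representable f p = ∃ λ g → g ≈ f × Polynomial.Coprime (den g) p × p Polynomial.∣ num g

  -- If the denominator s vanishes then p is a unit, so any representation will do.
  fraction⇒representable : ∀ {p} f → Fraction p p f → Representable f p
  fraction⇒representable {p} f (x , s , p⊥s@(u , v , e) , eq) with Polynomial._≈0? s
  ... | no  s≉0 = ((p P.* x) / s [ s≉0 ]) , quotient≈ f s≉0 eq , comaximal⇒coprime p⊥s ,
    record { quotient = x ; equality = P.*-comm x p }
  ... | yes s≈0 = f , K.refl , comaximal⇒coprime {p} {den f} (u , P.0# , P.trans (P.+-congˡ {u P.* p} (P.zeroˡ (den f))) up≈1) ,
    record { quotient = num f P.* u
           ; equality = P.trans (P.*-assoc (num f) u p) (P.trans (P.*-congˡ {num f} (P.trans (P.sym (P.+-identityʳ (u P.* p))) up≈1)) (P.*-identityʳ (num f))) }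
    where
    up≈1 : u P.* p P.+ P.0# P.≈ P.1#
    up≈1 = P.trans (P.+-congˡ {u P.* p} (P.sym (P.trans (P.*-congˡ {v} s≈0) (P.zeroʳ v)))) e

  fraction⇒congruence : ∀ {A B M} p → fromPoly p ≈ M → Fraction p p (A - B) → A ≅ B [mod M ]
  fraction⇒congruence {A} {B} p p≈M r = let g , g≈ , coprime , p∣g = fraction⇒representable (A - B) r in
    p , g , p≈M , g≈ , coprime , p∣g

-- The two congruences for given n, d and t

module MainTheorem (n d : ℕ) (t : ℤ) .{{_ : NonZero d}} (1<n : 1 < n) (2≤d : 2 ≤ d)
  (coprime : gcd t (+ d) ≡ 1ℤ) (d∣n-t : + d ∣ + n ℤ.- t)
  (lower : + n ℤ.+ + d ℤ.- + n ℤ.* + d ℤ.≤ t) (upper : t ℤ.≤ + n)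
  where

  open FractionField using (fromPoly-cong; fromPoly-+; fromPoly-*; fromPoly-neg)
  open PolynomialPowers
  open RationalPowers
  open RationalFunctions
  open IntegerArithmetic using (bézout)

  private
    module K = CommutativeRing fractionField

    N : ℕ
    N = ∣ + n ℤ.- t ∣ ℕ./ d

    xy : ∃₂ λ x y → x ℤ.* t ℤ.+ y ℤ.* + d ≡ 1ℤ
    xy = bézout t d coprime

    ψ : ℕ → Poly
    ψ = proj₁ (cyclotomic-polynomials (suc n))

    ψ-cyclotomic : CyclotomicUpTo (suc n) ψ
    ψ-cyclotomic = proj₂ (cyclotomic-polynomials (suc n))

  open Assembly polynomialRing fractionField fromPoly fromPoly-cong fromPoly-+ fromPoly-* fromPoly-neg fromPoly-1
    X ℕ-invertible β-cancel q^_ (λ _ → K.refl) q^-negative 1-q^ B-inverse d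
    2≤d t (proj₁ xy) (proj₁ (proj₂ xy)) (proj₂ (proj₂ xy))
    n N 1<n (IntegerArithmetic.N<n n d t d∣n-t upper lower) (IntegerArithmetic.n≡t+dN n d t d∣n-t upper)
    as-fraction ψ (λ m 0<m m<1+n → proj₂ (ψ-cyclotomic m 0<m m<1+n))
    [_] bracket≈ ⟨_⨾_⟩ poch≈ _*_ (λ _ _ → K.refl) _-_ (λ _ _ → K.refl) _÷_ ÷≈ _^_ square≈ fourth≈
    sum (λ n f → RingKit.sum≈Σ fractionField f n)
    using (modulus; modulus≈; short-sum; long-sum; 0<n) public

  exponent : (t ℤ.* (t ℤ.- + n)) ℤ./ℕ d ≡ ℤ.- t ℤ.* + N
  exponent = IntegerArithmetic.exponent n d t d∣n-t upper

  modulus≈[n]Φ² : fromPoly modulus ≈ [ + n ] * Φ n ^ 2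
  modulus≈[n]Φ² = modulus≈ (proj₁ (ψ-cyclotomic n 0<n (ℕ.n<1+n n)))

theorem5 : (n d : ℕ) (t : ℤ) .{{_ : NonZero d}} →
    1 ℕ.< n →
    2 ℕ.≤ d →
    gcd t (+ d) ≡ 1ℤ →
    + d ∣ + n ℤ.- t →
    + n ℤ.+ + d ℤ.- + n ℤ.* + d ℤ.≤ t →
    t ℤ.≤ + n →
    let
      N = ∣ + n ℤ.- t ∣ ℕ./ d
      summand = λ (k : ℕ) →
        [ + 2 ℤ.* + d ℤ.* + k ℤ.+ t ]
          * (⟨ q^ t ⨾ q^ (+ d) ⟩ k ^ 4 ÷ ⟨ q^ (+ d) ⨾ q^ (+ d) ⟩ k ^ 4)
          * q^ ((+ d ℤ.- + 2 ℤ.* t) ℤ.* + k)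
      rhs =
        (⟨ q^ (+ 2 ℤ.* t) ⨾ q^ (+ d) ⟩ N ÷ ⟨ q^ (+ d) ⨾ q^ (+ d) ⟩ N)
          * [ + n ]
          * q^ ((t ℤ.* (t ℤ.- + n)) ℤ./ℕ d)
      modulus = [ + n ] * Φ n ^ 2
    in
      (sum {ℕ.suc N} (λ k → summand (toℕ k)) ≅ rhs [mod modulus ])
      × (sum {n} (λ k → summand (toℕ k)) ≅ rhs [mod modulus ])
theorem5 n d t 1<n 2≤d coprime d∣n-t lower upper =
  let
    N = ∣ + n ℤ.- t ∣ ℕ./ d
    summand = λ (k : ℕ) →
      [ + 2 ℤ.* + d ℤ.* + k ℤ.+ t ]
        * (⟨ q^ t ⨾ q^ (+ d) ⟩ k ^ 4 ÷ ⟨ q^ (+ d) ⨾ q^ (+ d) ⟩ k ^ 4)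
        * q^ ((+ d ℤ.- + 2 ℤ.* t) ℤ.* + k)
    rhs =
      (⟨ q^ (+ 2 ℤ.* t) ⨾ q^ (+ d) ⟩ N ÷ ⟨ q^ (+ d) ⨾ q^ (+ d) ⟩ N)
        * [ + n ]
        * q^ ((t ℤ.* (t ℤ.- + n)) ℤ./ℕ d)
  in
  -- `exponent` trades the exact quotient t (t - n) / d for - t N, the exponent produced by the
  -- summation formula.
  fraction⇒congruence {sum {ℕ.suc N} (λ k → summand (toℕ k))} {rhs} modulus modulus≈[n]Φ² (short-sum _ exponent) ,
  fraction⇒congruence {sum {n} (λ k → summand (toℕ k))} {rhs} modulus modulus≈[n]Φ² (long-sum _ exponent)
  where
  open RationalFunctions
  open MainTheorem n d t 1<n 2≤d coprime d∣n-t lower upper
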